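{- Let $p(x)=\sum_{i\ge0}x^i$, define $M_{\mu^p}(z)=M_{\mu^c}\big(z/\sqrt{p(1/c)}\big)$, expanded as a formal power series in $1/c$, and let $\hat V_i(z)=[c^{ -i}]\,M_{\mu^p}(\sqrt z)$. Then for $i=0,1,2$, $\hat V_i(z)$ is $C(z)$ times a polynomial in $zC(z)^2$, and for every $i\ge3$ there exists a polynomial $\hat Q_i(x)$ such that \[ \hat V_i(z)=C(z)\,\frac{\hat Q_i\big(zC(z)^2\big)}{\big(1-zC(z)^2\big)^{2i-3}}. \]
   Context: A tree walk of size $m$ and length $L$ is a sequence $(v_1,\dots,v_L)$ of elements of $[m]$ in which every element of $[m]$ occurs, such that the graph with vertex set $[m]$ and edges $\{v_j,v_{j+1}\}$ ($1\le j<L$) and $\{v_L,v_1\}$ is a tree. $w_{m,2\ell}$ is the number of tree walks of size $m$ and length $2\ell$ (with $w_{1,0}=1$, $w_{1,2\ell}=0$ for $\ell\ge1$, $w_{0,2\ell}=0$). $W_\xi(z)=\sum_{\ell\ge0}\frac{w_{\ell-\xi+1,2\ell}}{(\ell-\xi+1)!}z^\ell$. $M_{\mu^c}(z)=\sum_{\ell\ge0}m_{2\ell}(\mu^c)z^{2\ell}$ is the ordinary moment generating function of the limiting spectral measure $\mu^c$ of $c^{ -1/2}A(G(n,c/n))$, whose even moments are $m_{2\ell}(\mu^c)=\sum_{m=1}^{\ell+1}c^{ -(\ell-m+1)}\frac{w_{m,2\ell}}{m!}$; equivalently $M_{\mu^c}(z)=\sum_{\xi\ge0}c^{ -\xi}W_\xi(z^2)$.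 $C(z)=\frac{1-\sqrt{1-4z}}{2z}$ is the Catalan generating function. -}

module Defs where

open import Data.Fin.Base using (Fin; zero; suc; toℕ; fromℕ<; inject₁; finToFun; funToFin)
open import Data.Fin.Induction using (<-weakInduction)
open import Data.Fin.Properties
  using (_≟_; any?; all?; injective⇒≤; toℕ-fromℕ<; finToFun-funToFin; toℕ<n)
open import Data.Fin.Relation.Unary.Top using (view; view-inject₁; ‵fromℕ; ‵inject₁)
open import Data.Integer.Base using (+_)
open import Data.List.Base using (List; []; _∷_; allFin; filter; length)
open import Data.Nat.Base as ℕ using (ℕ; zero; suc; _∸_; _!; z≤n; s≤s; _<_)
import Data.Nat.Properties as ℕ
open import Data.Product.Base using (∃; _×_; _,_)
open import Data.Rational.Base using (ℚ; 0ℚ; 1ℚ; ½; _+_; _*_; _-_; _/_)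
import Data.Rational.Properties as ℚ
open import Data.Rational.Solver using (module +-*-Solver)
open import Data.Sum.Base using (_⊎_; inj₁; inj₂; swap)
open import Data.Unit.Base using (⊤; tt)
open import Function.Base using (_∘_)
open import Function.Definitions using (Injective)
open import Level using (0ℓ)
open import Relation.Binary.Core using (Rel)
open import Relation.Binary.Construct.Closure.ReflexiveTransitive
  using (Star; ε; _◅_; _◅◅_; reverse)
open import Relation.Binary.Definitions using (Decidable)
open import Relation.Binary.PropositionalEquality
  using (_≡_; refl; sym; trans; cong; cong₂; subst; _≗_; module ≡-Reasoning)
open import Relation.Nullary using (¬_; Dec; yes; no; ¬?; contradiction)
open import Relation.Nullary.Decidable using (map′; _×-dec_; _⊎-dec_)

open import Algebra.Bundles using (CommutativeRing)
open import Algebra.Properties.Semiring.Sum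
  (CommutativeRing.semiring ℚ.+-*-commutativeRing)
  using (sum⁺-syntax; sum-cong-≗; ∑-distrib-+; sum-replicate-zero)

private variable
  k m L : ℕ

-- Cyclic successor: i ↦ i + 1 modulo n.
next : ∀ {n} → Fin n → Fin n
next i with view i
... | ‵fromℕ     = zero
... | ‵inject₁ j = suc j

record IsCycle (_~_ : Rel (Fin m) 0ℓ) {k : ℕ} (c : Fin k → Fin m) : Set where
  field
    long     : 3 ℕ.≤ k
    distinct : Injective _≡_ _≡_ c
    adjacent : ∀ j → c j ~ c (next j)

record IsTree (_~_ : Rel (Fin m) 0ℓ) : Set where
  field
    nonempty  : Fin m
    loopless  : ∀ x → ¬ (x ~ x)
    connected : ∀ x y → Star _~_ x y
    acyclic   : ∀ k (c : Fin k → Fin m) → ¬ IsCycle _~_ c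

-- The graph whose edges are the sets {v_j , v_{j+1}}, indices taken cyclically.
WalkGraph : (Fin L → Fin m) → Rel (Fin m) 0ℓ
WalkGraph v x y = ∃ λ j → (v j ≡ x × v (next j) ≡ y) ⊎ (v j ≡ y × v (next j) ≡ x)

record IsTreeWalk (v : Fin L → Fin m) : Set where
  field
    covers : ∀ x → ∃ λ j → v j ≡ x
    tree   : IsTree (WalkGraph v)

next-inject₁ : ∀ {n} (i : Fin n) → next (inject₁ i) ≡ suc i
next-inject₁ i rewrite view-inject₁ i = refl

WalkGraph-sym : (v : Fin L → Fin m) → ∀ {x y} → WalkGraph v x y → WalkGraph v y x
WalkGraph-sym v (j , e) = j , swap e

WalkGraph-connected : (v : Fin L → Fin m) → (∀ x → ∃ λ j → v j ≡ x) →
                      ∀ x y → Star (WalkGraph v) x y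
WalkGraph-connected {zero} v cov x y with () , _ ← cov x
WalkGraph-connected {suc L} v cov x y with cov x | cov y
... | i , refl | j , refl = reverse (WalkGraph-sym v) (from0 i) ◅◅ from0 j
  where
  from0 : ∀ i → Star (WalkGraph v) (v zero) (v i)
  from0 = <-weakInduction (λ i → Star (WalkGraph v) (v zero) (v i)) ε
    (λ i p → p ◅◅ ((inject₁ i , inj₁ (refl , cong v (next-inject₁ i))) ◅ ε))

WalkGraph? : (v : Fin L → Fin m) → Decidable (WalkGraph v)
WalkGraph? v x y = any? λ j →
  ((v j ≟ x) ×-dec (v (next j) ≟ y)) ⊎-dec ((v j ≟ y) ×-dec (v (next j) ≟ x))

module _ {_~_ : Rel (Fin m) 0ℓ} (_~?_ : Decidable _~_) where

  isCycle? : (c : Fin k → Fin m) → Dec (IsCycle _~_ c)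
  isCycle? {k} c = map′
    (λ (l , d , a) → record { long = l ; distinct = λ {i} {j} → d i j ; adjacent = a })
    (λ r → let open IsCycle r in long , (λ i j → distinct {i} {j}) , adjacent)
    ((3 ℕ.≤? k) ×-dec all? (λ i → all? λ j → injectiveAt? i j)
      ×-dec all? (λ j → c j ~? c (next j)))
    where
    injectiveAt? : ∀ i j → Dec (c i ≡ c j → i ≡ j)
    injectiveAt? i j with c i ≟ c j | i ≟ j
    ... | no  n | _     = yes λ p → contradiction p n
    ... | yes _ | yes q = yes λ _ → q
    ... | yes p | no  n = no λ f → n (f p)

  IsCycle-resp-≗ : {c d : Fin k → Fin m} → c ≗ d → IsCycle _~_ c → IsCycle _~_ d
  IsCycle-resp-≗ {c = c} {d} eq r = record
    { long     = long
    ; distinct = λ {i} {j} p → distinct (trans (eq i) (trans p (sym (eq j))))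
    ; adjacent = λ j → subst (d j ~_) (eq (next j)) (subst (_~ c (next j)) (eq j) (adjacent j))
    } where open IsCycle r

  -- The vertices of a cycle are distinct, so only lengths up to m matter.
  acyclic? : Dec (∀ k (c : Fin k → Fin m) → ¬ IsCycle _~_ c)
  acyclic? = map′ extend (λ h i a → h (toℕ i) (finToFun a))
    (all? {n = suc m} λ i → all? {n = m ℕ.^ toℕ i} λ a → ¬? (isCycle? (finToFun {m} {toℕ i} a)))
    where
    Bounded : ℕ → Set
    Bounded k = (a : Fin (m ℕ.^ k)) → ¬ IsCycle _~_ (finToFun {m} {k} a)

    extend : (∀ (i : Fin (suc m)) → Bounded (toℕ i)) → ∀ k (c : Fin k → Fin m) → ¬ IsCycle _~_ c
    extend h k c r = bounded (funToFin c) (IsCycle-resp-≗ (sym ∘ finToFun-funToFin c) r)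
      where
      k≤m = s≤s (injective⇒≤ (IsCycle.distinct r))
      bounded : Bounded k
      bounded = subst Bounded (toℕ-fromℕ< k≤m) (h (fromℕ< k≤m))

isTreeWalk? : (v : Fin L → Fin m) → Dec (IsTreeWalk v)
isTreeWalk? {m = m} v = map′
  (λ (cov , (x , _) , loop , acyc) → record
    { covers = cov
    ; tree   = record { nonempty = x ; loopless = loop
                      ; connected = WalkGraph-connected v cov ; acyclic = acyc } })
  (λ r → let open IsTreeWalk r ; open IsTree tree in
    covers , (nonempty , refl) , loopless , acyclic)
  (all? (λ x → any? λ j → v j ≟ x)
    ×-dec any? {n = m} (λ x → x ≟ x)
    ×-dec all? (λ x → ¬? (WalkGraph? v x x))
    ×-dec acyclic? (WalkGraph? v))

-- finToFun lists each sequence of length L in Fin m exactly once.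
treeWalkCount : ℕ → ℕ → ℕ
treeWalkCount m L = length (filter (λ a → isTreeWalk? (finToFun {m} {L} a)) (allFin (m ℕ.^ L)))

-- The empty sequence is conventionally the unique tree walk of size 1.
w : ℕ → ℕ → ℕ
w 0             _       = 0
w 1             0       = 1
w 1             (suc _) = 0
w (suc (suc m)) L       = treeWalkCount (suc (suc m)) L

PowerSeries : Set
PowerSeries = ℕ → ℚ

infixl 6 _+ₚ_ _-ₚ_
infixl 7 _*ₚ_ _·ₚ_
infixr 8 _^ₚ_

const : ℚ → PowerSeries
const a zero    = a
const a (suc _) = 0ℚ

0ₚ 1ₚ X : PowerSeries
0ₚ _ = 0ℚ
1ₚ = const 1ℚ
X zero    = 0ℚ
X (suc n) = 1ₚ n

_+ₚ_ _-ₚ_ _*ₚ_ : PowerSeries → PowerSeries → PowerSeries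
(f +ₚ g) n = f n + g n
(f -ₚ g) n = f n - g n
(f *ₚ g) n = ∑[ k ≤ n ] (f (toℕ k) * g (n ∸ toℕ k))

_·ₚ_ : ℚ → PowerSeries → PowerSeries
(a ·ₚ f) n = a * f n

_^ₚ_ : PowerSeries → ℕ → PowerSeries
f ^ₚ zero  = 1ₚ
f ^ₚ suc n = f *ₚ f ^ₚ n

iterate : (PowerSeries → PowerSeries) → ℕ → PowerSeries
iterate Φ zero    = 0ₚ
iterate Φ (suc n) = Φ (iterate Φ n)

-- When coefficient n of Φ f only depends on the coefficients of f below n,
-- coefficient n of the iterates is constant from iterate n + 1 onwards, and
-- fix Φ is the fixed point of Φ.
fix : (PowerSeries → PowerSeries) → PowerSeries
fix Φ n = iterate Φ (suc n) n

-- The inverse of a series with constant coefficient 1 (see recip-inverse); a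
-- junk value for any other series.
recip : PowerSeries → PowerSeries
recip f = fix λ g → 1ₚ -ₚ (f -ₚ 1ₚ) *ₚ g

-- The square root with constant coefficient 1 of a series with constant
-- coefficient 1 (see sqrt-square); a junk value for any other series.  The
-- equation (1 + r)² = f is solved as r = ((f - 1) - r²) / 2.
sqrt : PowerSeries → PowerSeries
sqrt f = 1ₚ +ₚ fix λ r → ½ ·ₚ ((f -ₚ 1ₚ) -ₚ r *ₚ r)

-- f ≈[ n ] g : the coefficients below n agree
_≈[_]_ : PowerSeries → ℕ → PowerSeries → Set
f ≈[ n ] g = ∀ k → k < n → f k ≡ g k

module Fix (Φ : PowerSeries → PowerSeries) (P : PowerSeries → Set)
           (P-fix : (h : PowerSeries) → h 0 ≡ iterate Φ 1 0 → P h) (P0 : P 0ₚ)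
           (contr : ∀ {f g} n → P f → P g → f ≈[ n ] g → Φ f ≈[ suc n ] Φ g) where

  P-iter : ∀ n → P (iterate Φ n)
  step   : ∀ n → iterate Φ n ≈[ n ] iterate Φ (suc n)
  head   : ∀ n → iterate Φ (suc n) 0 ≡ iterate Φ 1 0

  P-iter zero    = P0
  P-iter (suc n) = P-fix _ (head n)
  head zero    = refl
  head (suc n) = trans (sym (step (suc n) 0 (s≤s z≤n))) (head n)
  step zero    k ()
  step (suc n) = contr n (P-iter n) (P-iter (suc n)) (step n)

  far : ∀ d k → iterate Φ (suc k) k ≡ iterate Φ (d ℕ.+ suc k) k
  far zero    k = refl
  far (suc d) k = trans (far d k) (step (d ℕ.+ suc k) k (ℕ.m≤n+m (suc k) d))

  fix≈iter : ∀ n → fix Φ ≈[ n ] iterate Φ n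
  fix≈iter n k k<n =
    trans (far (n ∸ suc k) k) (cong (λ N → iterate Φ N k) (ℕ.m∸n+n≡m k<n))

  fix-eq : fix Φ ≗ Φ (fix Φ)
  fix-eq n = sym (contr n (P-fix _ refl) (P-iter n) (fix≈iter n) n ℕ.≤-refl)

*ₚ-distribʳ-+ : ∀ f g h → ((f +ₚ g) *ₚ h) ≗ (f *ₚ h +ₚ g *ₚ h)
*ₚ-distribʳ-+ f g h n = trans
  (sum-cong-≗ {suc n} λ k → ℚ.*-distribʳ-+ (h (n ∸ toℕ k)) (f (toℕ k)) (g (toℕ k)))
  (∑-distrib-+ {suc n} (λ k → f (toℕ k) * h (n ∸ toℕ k))
                       (λ k → g (toℕ k) * h (n ∸ toℕ k)))

*ₚ-distribˡ-+ : ∀ f g h → (f *ₚ (g +ₚ h)) ≗ (f *ₚ g +ₚ f *ₚ h)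
*ₚ-distribˡ-+ f g h n = trans
  (sum-cong-≗ {suc n} λ k → ℚ.*-distribˡ-+ (f (toℕ k)) (g (n ∸ toℕ k)) (h (n ∸ toℕ k)))
  (∑-distrib-+ {suc n} (λ k → f (toℕ k) * g (n ∸ toℕ k))
                       (λ k → f (toℕ k) * h (n ∸ toℕ k)))

*ₚ-congʳ : ∀ {f g} h → f ≗ g → (f *ₚ h) ≗ (g *ₚ h)
*ₚ-congʳ h eq n = sum-cong-≗ {suc n} λ k → cong (_* h (n ∸ toℕ k)) (eq (toℕ k))

*ₚ-identityˡ : ∀ f → (1ₚ *ₚ f) ≗ f
*ₚ-identityˡ f n = trans
  (cong₂ _+_ (ℚ.*-identityˡ (f n))
    (trans (sum-cong-≗ {n} λ k → ℚ.*-zeroˡ (f (n ∸ suc (toℕ k)))) (sum-replicate-zero n)))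
  (ℚ.+-identityʳ (f n))

*ₚ-identityʳ : ∀ f → (f *ₚ 1ₚ) ≗ f
*ₚ-identityʳ f zero = trans (ℚ.+-identityʳ _) (ℚ.*-identityʳ (f 0))
*ₚ-identityʳ f (suc n) = trans
  (cong₂ _+_ (ℚ.*-zeroʳ (f 0)) (*ₚ-identityʳ (f ∘ suc) n)) (ℚ.+-identityˡ _)

∸-suc-< : (j : Fin k) → k ∸ suc (toℕ j) < k
∸-suc-< {k} j = ℕ.∸-monoʳ-< {k} {suc (toℕ j)} {0} (s≤s z≤n) (toℕ<n j)

*ₚ-contrʳ : ∀ {f g} h n → h 0 ≡ 0ℚ → f ≈[ n ] g → (h *ₚ f) ≈[ suc n ] (h *ₚ g)
*ₚ-contrʳ {f} {g} h n h0 eq k (s≤s k≤n) = cong₂ _+_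
  (trans (cong (_* f k) h0) (trans (ℚ.*-zeroˡ (f k))
    (sym (trans (cong (_* g k) h0) (ℚ.*-zeroˡ (g k))))))
  (sum-cong-≗ {k} λ j → cong (h (suc (toℕ j)) *_)
    (eq (k ∸ suc (toℕ j)) (ℕ.<-≤-trans (∸-suc-< j) k≤n)))

*ₚ-contr : ∀ {f g} n → f 0 ≡ 0ℚ → g 0 ≡ 0ℚ → f ≈[ n ] g → (f *ₚ f) ≈[ suc n ] (g *ₚ g)
*ₚ-contr {f} {g} n f0 g0 eq k (s≤s k≤n) = sum-cong-≗ {suc k} go
  where
  go : ∀ j → f (toℕ j) * f (k ∸ toℕ j) ≡ g (toℕ j) * g (k ∸ toℕ j)
  go zero = trans (cong (_* f k) f0) (trans (ℚ.*-zeroˡ (f k))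
    (sym (trans (cong (_* g k) g0) (ℚ.*-zeroˡ (g k)))))
  go (suc j) with ℕ.m≤n⇒m<n∨m≡n (toℕ<n j)
  ... | inj₁ lt = cong₂ _*_ (eq (suc (toℕ j)) (ℕ.<-≤-trans lt k≤n))
    (eq (k ∸ suc (toℕ j)) (ℕ.<-≤-trans (∸-suc-< j) k≤n))
  ... | inj₂ e  = trans (last f f0) (sym (last g g0))
    where
    last : ∀ h → h 0 ≡ 0ℚ → h (suc (toℕ j)) * h (k ∸ suc (toℕ j)) ≡ 0ℚ
    last h h0 = trans
      (cong (λ i → h (suc (toℕ j)) * h i) (trans (cong (k ∸_) e) (ℕ.n∸n≡0 k)))
      (trans (cong (h (suc (toℕ j)) *_) h0) (ℚ.*-zeroʳ (h (suc (toℕ j)))))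

recip-inverse : ∀ f → f 0 ≡ 1ℚ → (f *ₚ recip f) ≗ 1ₚ
recip-inverse f f0 n = begin
  (f *ₚ g) n                       ≡⟨ *ₚ-congʳ g split n ⟩
  ((1ₚ +ₚ (f -ₚ 1ₚ)) *ₚ g) n       ≡⟨ *ₚ-distribʳ-+ 1ₚ (f -ₚ 1ₚ) g n ⟩
  (1ₚ *ₚ g) n + ((f -ₚ 1ₚ) *ₚ g) n ≡⟨ cong (_+ ((f -ₚ 1ₚ) *ₚ g) n) (trans (*ₚ-identityˡ g n) (F.fix-eq n)) ⟩
  1ₚ n - ((f -ₚ 1ₚ) *ₚ g) n + ((f -ₚ 1ₚ) *ₚ g) n
    ≡⟨ solve 2 (λ a b → a :- b :+ b := a) refl (1ₚ n) (((f -ₚ 1ₚ) *ₚ g) n) ⟩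
  1ₚ n ∎
  where
  open ≡-Reasoning
  open +-*-Solver using (solve; con; _:+_; _:*_; _:-_; _:=_)
  g = recip f
  module F = Fix (λ g → 1ₚ -ₚ (f -ₚ 1ₚ) *ₚ g) (λ _ → ⊤) (λ _ _ → tt) tt
    (λ n _ _ eq k k< → cong (λ x → 1ₚ k - x) (*ₚ-contrʳ (f -ₚ 1ₚ) n (cong (_- 1ℚ) f0) eq k k<))
  split : f ≗ (1ₚ +ₚ (f -ₚ 1ₚ))
  split n = solve 2 (λ a b → a := b :+ (a :- b)) refl (f n) (1ₚ n)

sqrt-square : ∀ f → f 0 ≡ 1ℚ → (sqrt f *ₚ sqrt f) ≗ f
sqrt-square f f0 n = begin
  ((1ₚ +ₚ r) *ₚ (1ₚ +ₚ r)) n                      ≡⟨ *ₚ-distribʳ-+ 1ₚ r (1ₚ +ₚ r) n ⟩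
  (1ₚ *ₚ (1ₚ +ₚ r)) n + (r *ₚ (1ₚ +ₚ r)) n
    ≡⟨ cong₂ _+_ (*ₚ-identityˡ (1ₚ +ₚ r) n)
         (trans (*ₚ-distribˡ-+ r 1ₚ r n) (cong (_+ (r *ₚ r) n) (*ₚ-identityʳ r n))) ⟩
  (1ₚ n + r n) + (r n + (r *ₚ r) n)
    ≡⟨ cong (λ x → (1ₚ n + x) + (x + (r *ₚ r) n)) (F.fix-eq n) ⟩
  (1ₚ n + ½ * y) + (½ * y + (r *ₚ r) n)
    ≡⟨ solve 3 (λ o a b → (o :+ con ½ :* ((a :- o) :- b)) :+ (con ½ :* ((a :- o) :- b) :+ b)
                          := a) refl (1ₚ n) (f n) ((r *ₚ r) n) ⟩
  f n ∎
  where
  open ≡-Reasoning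
  open +-*-Solver using (solve; con; _:+_; _:*_; _:-_; _:=_)
  Φ : PowerSeries → PowerSeries
  Φ r = ½ ·ₚ ((f -ₚ 1ₚ) -ₚ r *ₚ r)
  r = fix Φ
  y = (f n - 1ₚ n) - (r *ₚ r) n
  module F = Fix Φ (λ h → h 0 ≡ 0ℚ)
    (λ h e → trans e (cong (λ x → ½ * ((x - 1ℚ) - 0ℚ)) f0)) refl
    (λ n p q eq k k< → cong (λ x → ½ * ((f k - 1ₚ k) - x)) (*ₚ-contr n p q eq k k<))

Polynomial : Set
Polynomial = List ℚ

-- Q ⟨ f ⟩ is Q(f); the list holds the coefficients of Q, constant term first.
_⟨_⟩ : Polynomial → PowerSeries → PowerSeries
[]      ⟨ f ⟩ = 0ₚ
(a ∷ Q) ⟨ f ⟩ = const a +ₚ f *ₚ (Q ⟨ f ⟩)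

-- (1 - √(1 - 4z)) / (2z); the numerator has constant coefficient 0, and
-- division by z shifts its coefficients.
C : PowerSeries
C n = ½ * (1ₚ -ₚ sqrt (1ₚ -ₚ (+ 4 / 1) ·ₚ X)) (suc n)

zC² : PowerSeries
zC² = X *ₚ C ^ₚ 2

-- The moment m_{2ℓ}(μᶜ) of the limiting spectral measure, given by its formula
-- ∑_{m=1}^{ℓ+1} c^{-(ℓ-m+1)} w_{m,2ℓ} / m!, as a power series in 1/c.  The
-- measure itself is not constructed.  The summation index is j = m - 1.
evenMoment : ℕ → PowerSeries
evenMoment ℓ ξ = ∑[ j ≤ ℓ ]
  ((_/_ (+ w (suc (toℕ j)) (2 ℕ.* ℓ)) (suc (toℕ j) !) {{suc (toℕ j) ℕ.!≢0}})
    * (X ^ₚ (ℓ ∸ toℕ j)) ξ)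

-- A series in z whose coefficients are power series in 1/c.
PowerSeries₂ : Set
PowerSeries₂ = ℕ → PowerSeries

-- a(z) ↦ a(z²)
atSquare : PowerSeries₂ → PowerSeries₂
atSquare a 0             = a 0
atSquare a 1             = 0ₚ
atSquare a (suc (suc n)) = atSquare (a ∘ suc) n

Mμᶜ : PowerSeries₂
Mμᶜ = atSquare evenMoment

p : PowerSeries
p _ = 1ℚ

Mμᵖ : PowerSeries₂
Mμᵖ n = Mμᶜ n *ₚ recip (sqrt p) ^ₚ n

-- Mμᵖ is even in z, so the coefficient of z^ℓ in Mμᵖ(√z) is that of z^{2ℓ} in Mμᵖ(z).
V̂ : ℕ → PowerSeries
V̂ i ℓ = Mμᵖ (2 ℕ.* ℓ) i

{-# OPTIONS --safe #-}
module Submission where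

-- Let β a be the generating function of the ways to run a + 1 closed walks from a vertex, one after
-- the other, exploring a single tree, with weight X for a step down to a visited child and Y for
-- a step down to a new one.  Deciding on the first step gives
--   β a = β (a − 1) + Y ∑ₖ Xᵏ (a+k choose k) β k β (a + k),   β (−1) = 1,
-- and β 0 counts the tree walks.  With X = x (1 − x) z and Y = (1 − x) z, x = 1/c, the coefficient
-- of xⁱ in β 0 is V̂ i.  Put t = z C².  At order xⁿ the system is linear in the coefficients of that
-- order, and solving it costs one division by 1 − t: if b a n is the coefficient of xⁿ in β a, then
-- (1 − t) b 0 n = z C L, where L only involves lower orders.  The normalisation of z makes L
-- divisible by 1 − t for n = 1, 2, so b 0 0 = C, b 0 1 = − t C, b 0 2 = − 2 t³ C, and by induction
-- (1 − t)ⁿ⁻² b a n is Cᵃ⁺¹ times a polynomial in t for n ≥ 2, which is stronger than the claim.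

-- A closed walk of length 2ℓ on a tree with m vertices makes ℓ steps down, m - 1 of them to new
-- vertices. So the rescaling by `√p` puts 1 - x on every step down, and c^-(ℓ-m+1) puts a further x
-- on every step down to a visited child. An equation for β 0 alone does not close, since the first
-- child is visited again some number k of times; hence the whole family. The factor (a+k choose k)
-- decides which of the a + k breaks between the a + k + 1 walks avoiding that child are visits to
-- it; the other a separate the original walks. This recursion cuts a walk up by subtrees, whereas
-- tree walks are counted step by step. To compare the two, the sum over k is read as an action of a
-- shuffle algebra; this assigns weights to partly explored trees, and the weights satisfy the
-- one-step recursion of the walk. At a given order in x, β a occurs in its own equation as C β a,
-- and for a = 0 a second time as β 0 C. The first occurrence is absorbed by 1 / (1 - z C) = C,
-- which is where the powers of C come from; only the second, at a = 0, costs a division by 1 - t.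

-- Formal power series over a commutative ring, and agreement up to a given degree.

module SeriesRing where

  open import Data.Fin.Base using (Fin; zero; suc; toℕ)
  open import Data.Fin.Properties using (toℕ≤pred[n])
  open import Data.Nat.Base as ℕ using (ℕ; zero; suc; _∸_; _<_; s≤s)
  import Data.Nat.Properties as ℕ
  open import Data.Product.Base using (_,_)
  open import Level using (0ℓ)
  open import Algebra.Bundles using (CommutativeRing)
  import Algebra.Properties.Semiring.Sum
  import Algebra.Solver.Ring.NaturalCoefficients.Default

  module Series (R : CommutativeRing 0ℓ 0ℓ) where
    open CommutativeRing R hiding (zero)
    open Algebra.Properties.Semiring.Sum semiring using (sum⁺-syntax; sum-cong-≋)
    open Algebra.Solver.Ring.NaturalCoefficients.Default commutativeSemiring
      using (solve; con; _:+_; _:*_; _:=_)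

    Ser : Set
    Ser = ℕ → Carrier

    infix 4 _≋_
    _≋_ : Ser → Ser → Set
    f ≋ g = ∀ n → f n ≈ g n

    tail : Ser → Ser
    tail f n = f (suc n)

    zeroₛ : Ser
    zeroₛ _ = 0#

    constₛ : Carrier → Ser
    constₛ a zero    = a
    constₛ a (suc _) = 0#

    shift : Ser → Ser
    shift f zero    = 0#
    shift f (suc n) = f n

    infixl 6 _⊕_
    infixl 7 _⊛_
    _⊕_ _⊛_ : Ser → Ser → Ser
    (f ⊕ g) n = f n + g n
    (f ⊛ g) n = ∑[ k ≤ n ] (f (toℕ k) * g (n ∸ toℕ k))

    ⊖_ : Ser → Ser
    (⊖ f) n = - f n

    scale : Carrier → Ser → Ser
    scale a f n = a * f n

    ≋-sym : ∀ {f g} → f ≋ g → g ≋ f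
    ≋-sym p n = sym (p n)

    ≋-trans : ∀ {f g h} → f ≋ g → g ≋ h → f ≋ h
    ≋-trans p q n = trans (p n) (q n)

    ⊛-cong : ∀ {f f′ g g′} → f ≋ f′ → g ≋ g′ → f ⊛ g ≋ f′ ⊛ g′
    ⊛-cong p q n = sum-cong-≋ {suc n} λ k → *-cong (p (toℕ k)) (q (n ∸ toℕ k))

    ⊛-congˡ : ∀ h {f g} → f ≋ g → h ⊛ f ≋ h ⊛ g
    ⊛-congˡ h = ⊛-cong {h} (λ _ → refl)

    ⊛-head : ∀ f g → (f ⊛ g) 0 ≈ f 0 * g 0
    ⊛-head f g = +-identityʳ _

    ⊛-last : ∀ f g n → (f ⊛ g) (suc n) ≈ f (suc n) * g 0 + (f ⊛ tail g) n
    ⊛-last f g zero = solve 4 (λ a b c d → a :* b :+ (c :* d :+ con 0) := c :* d :+ (a :* b :+ con 0))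
      refl (f 0) (g 1) (f 1) (g 0)
    ⊛-last f g (suc n) = trans (+-congˡ (⊛-last (tail f) g n))
      (solve 3 (λ a b c → a :+ (b :+ c) := b :+ (a :+ c)) refl
        (f 0 * g (suc (suc n))) (f (suc (suc n)) * g 0) ((tail f ⊛ tail g) n))

    ⊛-comm : ∀ f g → f ⊛ g ≋ g ⊛ f
    ⊛-comm f g zero    = +-congʳ (*-comm _ _)
    ⊛-comm f g (suc n) = trans (+-cong (*-comm _ _) (⊛-comm (tail f) g n)) (sym (⊛-last g f n))

    ⊛-zeroˡ : ∀ f → zeroₛ ⊛ f ≋ zeroₛ
    ⊛-zeroˡ f zero    = trans (⊛-head zeroₛ f) (zeroˡ _)
    ⊛-zeroˡ f (suc n) = trans (+-cong (zeroˡ _) (⊛-zeroˡ f n)) (+-identityˡ _)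

    ⊛-distribʳ : ∀ h f g → (f ⊕ g) ⊛ h ≋ f ⊛ h ⊕ g ⊛ h
    ⊛-distribʳ h f g zero = solve 3 (λ a b c → (a :+ b) :* c :+ con 0 := (a :* c :+ con 0) :+ (b :* c :+ con 0))
      refl (f 0) (g 0) (h 0)
    ⊛-distribʳ h f g (suc n) = trans (+-congˡ (⊛-distribʳ h (tail f) (tail g) n))
      (solve 5 (λ a b c x y → (a :+ b) :* c :+ (x :+ y) := (a :* c :+ x) :+ (b :* c :+ y)) refl
        (f 0) (g 0) (h (suc n)) ((tail f ⊛ h) n) ((tail g ⊛ h) n))

    ⊛-distribˡ : ∀ h f g → h ⊛ (f ⊕ g) ≋ h ⊛ f ⊕ h ⊛ g
    ⊛-distribˡ h f g n = trans (⊛-comm h (f ⊕ g) n)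
      (trans (⊛-distribʳ h f g n) (+-cong (⊛-comm f h n) (⊛-comm g h n)))

    scale-⊛ : ∀ a f g → scale a f ⊛ g ≋ scale a (f ⊛ g)
    scale-⊛ a f g zero    = solve 3 (λ a x y → a :* x :* y :+ con 0 := a :* (x :* y :+ con 0)) refl a (f 0) (g 0)
    scale-⊛ a f g (suc n) = trans (+-congˡ (scale-⊛ a (tail f) g n))
      (solve 4 (λ a x y z → a :* x :* y :+ a :* z := a :* (x :* y :+ z)) refl
        a (f 0) (g (suc n)) ((tail f ⊛ g) n))

    constₛ-⊛ : ∀ a f → constₛ a ⊛ f ≋ scale a f
    constₛ-⊛ a f zero    = ⊛-head (constₛ a) f
    constₛ-⊛ a f (suc n) = trans (+-congˡ (⊛-zeroˡ f n)) (+-identityʳ _)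

    ⊛-assoc : ∀ f g h → (f ⊛ g) ⊛ h ≋ f ⊛ (g ⊛ h)
    ⊛-assoc f g h zero = solve 3 (λ a b c → (a :* b :+ con 0) :* c :+ con 0 := a :* (b :* c :+ con 0) :+ con 0)
      refl (f 0) (g 0) (h 0)
    ⊛-assoc f g h (suc n) = trans
      (+-cong (*-congʳ (⊛-head f g))
        (trans (⊛-distribʳ h (scale (f 0) (tail g)) (tail f ⊛ g) n)
          (+-cong (scale-⊛ (f 0) (tail g) h n) (⊛-assoc (tail f) g h n))))
      (solve 5 (λ a b c x y → a :* b :* c :+ (a :* x :+ y) := a :* (b :* c :+ x) :+ y) refl
        (f 0) (g 0) (h (suc n)) ((tail g ⊛ h) n) ((tail f ⊛ (g ⊛ h)) n))

    module _ (one : Ser) (one-identityˡ : ∀ f → one ⊛ f ≋ f) where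

      -- The unit is a parameter because `1ₚ` agrees with `constₛ 1#` only coefficient by
      -- coefficient; passing it makes the unit of the resulting ring `1ₚ` itself.
      ringWithUnit : CommutativeRing 0ℓ 0ℓ
      ringWithUnit = record
        { Carrier = Ser ; _≈_ = _≋_ ; _+_ = _⊕_ ; _*_ = _⊛_ ; -_ = ⊖_ ; 0# = zeroₛ ; 1# = one
        ; isCommutativeRing = record
          { isRing = record
            { +-isAbelianGroup = record
              { isGroup = record
                { isMonoid = record
                  { isSemigroup = record
                    { isMagma = record
                      { isEquivalence = record { refl = λ _ → refl ; sym = ≋-sym ; trans = ≋-trans }
                      ; ∙-cong = λ p q n → +-cong (p n) (q n) }
                    ; assoc = λ f g h n → +-assoc _ _ _ }
                  ; identity = (λ f n → +-identityˡ _) , (λ f n → +-identityʳ _) }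
                ; inverse = (λ f n → -‿inverseˡ _) , (λ f n → -‿inverseʳ _)
                ; ⁻¹-cong = λ p n → -‿cong (p n) }
              ; comm = λ f g n → +-comm _ _ }
            ; *-cong = ⊛-cong
            ; *-assoc = ⊛-assoc
            ; *-identity = one-identityˡ , (λ f → ≋-trans (⊛-comm f one) (one-identityˡ f))
            ; distrib = ⊛-distribˡ , ⊛-distribʳ }
          ; *-comm = ⊛-comm } }

    seriesRing : CommutativeRing 0ℓ 0ℓ
    seriesRing = ringWithUnit (constₛ 1#) λ f → ≋-trans (constₛ-⊛ 1# f) λ n → *-identityˡ _

    shift-⊛ : ∀ f g → shift f ⊛ g ≋ shift (f ⊛ g)
    shift-⊛ f g zero    = trans (⊛-head (shift f) g) (zeroˡ _)
    shift-⊛ f g (suc n) = trans (+-congʳ (zeroˡ _)) (+-identityˡ _)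

    shift-cong : ∀ {f g} → f ≋ g → shift f ≋ shift g
    shift-cong p zero    = refl
    shift-cong p (suc n) = p n

    -- Splits off the two products with a factor of index 0: in a quadratic equation these alone
    -- contain the unknowns of the current order.
    ⊛-ends : ∀ f g n → (f ⊛ g) (suc (suc n)) ≈
             f 0 * g (suc (suc n)) + f (suc (suc n)) * g 0 + (tail f ⊛ tail g) n
    ⊛-ends f g n = trans (+-congˡ (⊛-last (tail f) g n)) (sym (+-assoc _ _ _))

    infix 4 _≋[_]_
    _≋[_]_ : Ser → ℕ → Ser → Set
    f ≋[ N ] g = ∀ k → k < N → f k ≈ g k

    weaken : ∀ {f g} N → f ≋ g → f ≋[ N ] g
    weaken N p k _ = p k

    ≋[]-trans : ∀ {f g h N} → f ≋[ N ] g → g ≋[ N ] h → f ≋[ N ] h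
    ≋[]-trans p q k k<N = trans (p k k<N) (q k k<N)

    ⊕-cong[] : ∀ {f f′ g g′ N} → f ≋[ N ] f′ → g ≋[ N ] g′ → f ⊕ g ≋[ N ] f′ ⊕ g′
    ⊕-cong[] p q k k<N = +-cong (p k k<N) (q k k<N)

    ⊛-cong[] : ∀ {f f′ g g′ N} → f ≋[ N ] f′ → g ≋[ N ] g′ → f ⊛ g ≋[ N ] f′ ⊛ g′
    ⊛-cong[] p q k k<N = sum-cong-≋ {suc k} λ j → *-cong
      (p (toℕ j) (ℕ.≤-<-trans (toℕ≤pred[n] j) k<N))
      (q (k ∸ toℕ j) (ℕ.≤-<-trans (ℕ.m∸n≤m k (toℕ j)) k<N))

    shift-const-⊛ : ∀ a w → shift (constₛ a) ⊛ w ≋ shift (scale a w)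
    shift-const-⊛ a w = ≋-trans (shift-⊛ (constₛ a) w) (shift-cong (constₛ-⊛ a w))

    -- A factor of degree one gains one degree of precision. This contraction makes `β` well defined
    -- and lets identities for `▷` be proved by induction on the precision.
    shift-const-⊛-step : ∀ a {w w′} N → w ≋[ N ] w′ →
                         shift (constₛ a) ⊛ w ≋[ suc N ] shift (constₛ a) ⊛ w′
    shift-const-⊛-step a {w} {w′} N p k k<N =
      trans (shift-const-⊛ a w k) (trans (lemma k k<N) (sym (shift-const-⊛ a w′ k)))
      where
      lemma : shift (scale a w) ≋[ suc N ] shift (scale a w′)
      lemma zero    _         = refl
      lemma (suc k) (s≤s k<N) = *-congˡ (p k k<N)

-- The family β, the shuffle action, and weights of partly explored trees.

module UmbralCalculus where

  open SeriesRing
  open import Data.List.Base using (List; []; _∷_; length)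
  open import Data.Nat.Base as ℕ using (ℕ; zero; suc; _∸_; _<_; s≤s)
  import Data.Nat.Properties as ℕ
  open import Data.Unit.Base using (⊤; tt)
  open import Function.Base using (_∘_)
  open import Level using (0ℓ)
  open import Relation.Binary.PropositionalEquality as ≡ using (_≡_)
  open import Algebra.Bundles using (CommutativeRing)
  import Algebra.Properties.Semiring.Sum
  import Algebra.Solver.Ring.NaturalCoefficients.Default

  -- First child and next sibling: `node a P Q` is a tree with root `a` over the forest `P`,
  -- followed by the trees of `Q`.
  data Forest (A : Set) : Set where
    ∅    : Forest A
    node : A → Forest A → Forest A → Forest A

  -- Each tree of the forest contributes one summand; `h` gets its root, the forest below the root,
  -- and the forest of the other trees. The monoid is explicit because sequences, series,
  -- coefficients and natural numbers are all summed in this way.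
  sumPicks : {A M : Set} → (M → M → M) → M → Forest A → (A → Forest A → Forest A → M) → M
  sumPicks _∙_ e ∅            h = e
  sumPicks _∙_ e (node a P Q) h = h a P Q ∙ sumPicks _∙_ e Q λ b P′ Q′ → h b P′ (node a P Q′)

  -- 2 l + d, the length of a walk that makes l steps down and ends d levels higher, hence makes l +
  -- d steps up.
  steps : ℕ → ℕ → ℕ
  steps zero    d = d
  steps (suc l) d = suc (suc (steps l d))

  steps-suc : ∀ l d → steps l (suc d) ≡ suc (steps l d)
  steps-suc zero    d = ≡.refl
  steps-suc (suc l) d = ≡.cong (λ n → suc (suc n)) (steps-suc l d)

  module Umbral (R : CommutativeRing 0ℓ 0ℓ)
                (x̂ ŷ : CommutativeRing.Carrier R) where
    open CommutativeRing R hiding (zero)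
    open Series R
    open Algebra.Properties.Semiring.Sum semiring using ()
    open Algebra.Solver.Ring.NaturalCoefficients.Default commutativeSemiring
      using (solve; _:+_; _:*_; _:=_)
    module K = CommutativeRing seriesRing
    module KS = Algebra.Solver.Ring.NaturalCoefficients.Default K.commutativeSemiring

    X Y : Ser
    X = shift (constₛ x̂)
    Y = shift (constₛ ŷ)

    Seq : Set
    Seq = ℕ → Ser

    infix 4 _≣_
    _≣_ : Seq → Seq → Set
    P ≣ Q = ∀ n → P n ≋ Q n

    ∂ : Seq → Seq
    ∂ P n = P (suc n)

    infixr 5 _∷ₛ_
    _∷ₛ_ : Ser → Seq → Seq
    (k ∷ₛ P) zero    = k
    (k ∷ₛ P) (suc n) = P n

    infixl 6 _⊞_
    infixr 7 _·_
    _⊞_ : Seq → Seq → Seq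
    (P ⊞ Q) n = P n ⊕ Q n

    _·_ : Ser → Seq → Seq
    (k · P) n = k ⊛ P n

    0ₛ 1ₛ : Seq
    0ₛ _ = zeroₛ
    1ₛ = K.1# ∷ₛ 0ₛ

    infixl 7 _⧢_
    -- The product of exponential generating functions, ∑ₖ (n choose k) P k Q (n - k), in the form
    -- of the Leibniz rule for `∂`.
    _⧢_ : Seq → Seq → Seq
    (P ⧢ Q) zero    = P 0 ⊛ Q 0
    (P ⧢ Q) (suc n) = (∂ P ⧢ Q) n ⊕ (P ⧢ ∂ Q) n

    ⧢-cong : ∀ {P P′ Q Q′} → P ≣ P′ → Q ≣ Q′ → P ⧢ Q ≣ P′ ⧢ Q′
    ⧢-cong p q zero    = ⊛-cong (p 0) (q 0)
    ⧢-cong p q (suc n) = K.+-cong (⧢-cong (p ∘ suc) q n) (⧢-cong p (q ∘ suc) n)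

    ⧢-comm : ∀ P Q → P ⧢ Q ≣ Q ⧢ P
    ⧢-comm P Q zero    = ⊛-comm (P 0) (Q 0)
    ⧢-comm P Q (suc n) = K.trans (K.+-cong (⧢-comm (∂ P) Q n) (⧢-comm P (∂ Q) n))
                                 (K.+-comm _ _)

    private
      interchange : ∀ a b c d → (a ⊕ b) ⊕ (c ⊕ d) ≋ (a ⊕ c) ⊕ (b ⊕ d)
      interchange = KS.solve 4 (λ a b c d → (a KS.:+ b) KS.:+ (c KS.:+ d) KS.:=
                                            (a KS.:+ c) KS.:+ (b KS.:+ d)) K.refl

    ⧢-distribʳ : ∀ Q P P′ → (P ⊞ P′) ⧢ Q ≣ P ⧢ Q ⊞ P′ ⧢ Q
    ⧢-distribʳ Q P P′ zero    = ⊛-distribʳ (Q 0) (P 0) (P′ 0)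
    ⧢-distribʳ Q P P′ (suc n) = K.trans
      (K.+-cong (⧢-distribʳ Q (∂ P) (∂ P′) n) (⧢-distribʳ (∂ Q) P P′ n))
      (interchange _ _ _ _)

    ⧢-distribˡ : ∀ Q P P′ → Q ⧢ (P ⊞ P′) ≣ Q ⧢ P ⊞ Q ⧢ P′
    ⧢-distribˡ Q P P′ n = K.trans (⧢-comm Q (P ⊞ P′) n) (K.trans (⧢-distribʳ Q P P′ n)
      (K.+-cong (⧢-comm P Q n) (⧢-comm P′ Q n)))

    ⧢-·ˡ : ∀ k P Q → (k · P) ⧢ Q ≣ k · (P ⧢ Q)
    ⧢-·ˡ k P Q zero    = ⊛-assoc k (P 0) (Q 0)
    ⧢-·ˡ k P Q (suc n) = K.trans (K.+-cong (⧢-·ˡ k (∂ P) Q n) (⧢-·ˡ k P (∂ Q) n))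
                                 (K.sym (⊛-distribˡ k _ _))

    ⧢-zeroˡ : ∀ Q → 0ₛ ⧢ Q ≣ 0ₛ
    ⧢-zeroˡ Q zero    = ⊛-zeroˡ (Q 0)
    ⧢-zeroˡ Q (suc n) = K.trans (K.+-cong (⧢-zeroˡ Q n) (⧢-zeroˡ (∂ Q) n)) (K.+-identityˡ _)

    ⧢-assoc : ∀ P Q T → (P ⧢ Q) ⧢ T ≣ P ⧢ (Q ⧢ T)
    ⧢-assoc P Q T zero    = ⊛-assoc (P 0) (Q 0) (T 0)
    ⧢-assoc P Q T (suc n) = K.trans
      (K.+-cong
        (K.trans (⧢-distribʳ T (∂ P ⧢ Q) (P ⧢ ∂ Q) n)
          (K.+-cong (⧢-assoc (∂ P) Q T n) (⧢-assoc P (∂ Q) T n)))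
        (⧢-assoc P Q (∂ T) n))
      (K.trans (K.+-assoc _ _ _)
        (K.+-congˡ (K.sym (⧢-distribˡ P (∂ Q ⧢ T) (Q ⧢ ∂ T) n))))

    -- (P ▷ g) n = ∑ₖ Xᵏ (n+k choose k) P k g (n + k), so P acts as ∑ₖ P k (X d/dv)ᵏ / k! on
    -- ∑ₙ g n vⁿ; the recursion is Pascal's rule.
    infixr 7 _▷_
    _▷_ : Seq → Seq → Seq
    (P ▷ g) zero    zero    = (P 0 ⊛ g 0) zero
    (P ▷ g) zero    (suc l) = (P 0 ⊛ g 0) (suc l) + x̂ * (∂ P ▷ ∂ g) zero l
    (P ▷ g) (suc n) zero    = (P ▷ ∂ g) n zero
    (P ▷ g) (suc n) (suc l) = (P ▷ ∂ g) n (suc l) + x̂ * (∂ P ▷ ∂ g) (suc n) l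

    private
      X⊛-coeff : ∀ f w h → f zero ≈ h zero → (∀ l → f (suc l) ≈ h (suc l) + x̂ * w l) → f ≋ h ⊕ X ⊛ w
      X⊛-coeff f w h p q zero    = trans p (sym (trans (+-congˡ (shift-const-⊛ x̂ w zero)) (+-identityʳ _)))
      X⊛-coeff f w h p q (suc l) = trans (q l) (+-congˡ (sym (shift-const-⊛ x̂ w (suc l))))

    -- In `∂ P ▷ ∂ g` the index does not decrease, only the power of z still wanted does. The
    -- definition therefore proceeds by coefficients; here and in `▷-suc` they are put back
    -- together.
    ▷-zero : ∀ P g → (P ▷ g) 0 ≋ P 0 ⊛ g 0 ⊕ X ⊛ (∂ P ▷ ∂ g) 0
    ▷-zero P g = X⊛-coeff _ _ _ refl λ _ → refl

    ▷-suc : ∀ P g n → (P ▷ g) (suc n) ≋ (P ▷ ∂ g) n ⊕ X ⊛ (∂ P ▷ ∂ g) (suc n)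
    ▷-suc P g n = X⊛-coeff _ _ _ refl λ _ → refl

    ▷-cong[] : ∀ {P P′ g g′ N} → (∀ n → P n ≋[ N ] P′ n) → (∀ n → g n ≋[ N ] g′ n) →
               ∀ n → (P ▷ g) n ≋[ N ] (P′ ▷ g′) n
    ▷-cong[] p q zero    zero    l<N = ⊛-cong[] (p 0) (q 0) 0 l<N
    ▷-cong[] p q zero    (suc l) l<N = +-cong (⊛-cong[] (p 0) (q 0) (suc l) l<N)
      (*-congˡ (▷-cong[] (p ∘ suc) (q ∘ suc) zero l (ℕ.<-trans (ℕ.n<1+n l) l<N)))
    ▷-cong[] p q (suc n) zero    l<N = ▷-cong[] p (q ∘ suc) n zero l<N
    ▷-cong[] p q (suc n) (suc l) l<N = +-cong (▷-cong[] p (q ∘ suc) n (suc l) l<N)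
      (*-congˡ (▷-cong[] (p ∘ suc) (q ∘ suc) (suc n) l (ℕ.<-trans (ℕ.n<1+n l) l<N)))

    ▷-cong : ∀ {P P′ g g′} → P ≣ P′ → g ≣ g′ → P ▷ g ≣ P′ ▷ g′
    ▷-cong p q n l = ▷-cong[] {N = suc l} (λ n → weaken _ (p n)) (λ n → weaken _ (q n)) n l ℕ.≤-refl

    ▷-distribʳ : ∀ g P Q → (P ⊞ Q) ▷ g ≣ P ▷ g ⊞ Q ▷ g
    ▷-distribʳ g P Q zero    zero    = ⊛-distribʳ (g 0) (P 0) (Q 0) 0
    ▷-distribʳ g P Q zero    (suc l) = trans
      (+-cong (⊛-distribʳ (g 0) (P 0) (Q 0) (suc l)) (*-congˡ (▷-distribʳ (∂ g) (∂ P) (∂ Q) 0 l)))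
      (solve 5 (λ x a b c d → (a :+ b) :+ x :* (c :+ d) := (a :+ x :* c) :+ (b :+ x :* d)) refl
        x̂ _ _ _ _)
    ▷-distribʳ g P Q (suc n) zero    = ▷-distribʳ (∂ g) P Q n zero
    ▷-distribʳ g P Q (suc n) (suc l) = trans
      (+-cong (▷-distribʳ (∂ g) P Q n (suc l)) (*-congˡ (▷-distribʳ (∂ g) (∂ P) (∂ Q) (suc n) l)))
      (solve 5 (λ x a b c d → (a :+ b) :+ x :* (c :+ d) := (a :+ x :* c) :+ (b :+ x :* d)) refl
        x̂ _ _ _ _)

    ▷-distribˡ : ∀ P g h → P ▷ (g ⊞ h) ≣ P ▷ g ⊞ P ▷ h
    ▷-distribˡ P g h zero    zero    = ⊛-distribˡ (P 0) (g 0) (h 0) 0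
    ▷-distribˡ P g h zero    (suc l) = trans
      (+-cong (⊛-distribˡ (P 0) (g 0) (h 0) (suc l)) (*-congˡ (▷-distribˡ (∂ P) (∂ g) (∂ h) 0 l)))
      (solve 5 (λ x a b c d → (a :+ b) :+ x :* (c :+ d) := (a :+ x :* c) :+ (b :+ x :* d)) refl
        x̂ _ _ _ _)
    ▷-distribˡ P g h (suc n) zero    = ▷-distribˡ P (∂ g) (∂ h) n zero
    ▷-distribˡ P g h (suc n) (suc l) = trans
      (+-cong (▷-distribˡ P (∂ g) (∂ h) n (suc l)) (*-congˡ (▷-distribˡ (∂ P) (∂ g) (∂ h) (suc n) l)))
      (solve 5 (λ x a b c d → (a :+ b) :+ x :* (c :+ d) := (a :+ x :* c) :+ (b :+ x :* d)) refl
        x̂ _ _ _ _)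

    private
      limit : ∀ {f g} → (∀ N → f ≋[ N ] g) → f ≋ g
      limit p n = p (suc n) n ℕ.≤-refl

      -- One step of an induction on precision: what stands behind `X` has to be known to one degree
      -- less.
      contract : ∀ {f g a a′ v v′ c} N → f ≋ a ⊕ X ⊛ v → a ≋[ suc N ] a′ → v ≋[ N ] v′ →
                 a′ ⊕ X ⊛ v′ ≋ c → c ≋ g → f ≋[ suc N ] g
      contract N p q r s t = ≋[]-trans (weaken _ p)
        (≋[]-trans (⊕-cong[] q (shift-const-⊛-step x̂ N r)) (weaken _ (≋-trans s t)))

    ▷-·ˡ : ∀ k P g → (k · P) ▷ g ≣ k · (P ▷ g)
    ▷-·ˡ k P g n = limit λ N → go N P g n
      where
      fold : ∀ a v → k ⊛ a ⊕ X ⊛ (k ⊛ v) ≋ k ⊛ (a ⊕ X ⊛ v)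
      fold a v = KS.solve 4 (λ x k a v → k KS.:* a KS.:+ x KS.:* (k KS.:* v) KS.:=
                                       k KS.:* (a KS.:+ x KS.:* v)) K.refl X k a v
      go : ∀ N P g n → ((k · P) ▷ g) n ≋[ N ] k ⊛ (P ▷ g) n
      go zero    P g n       k ()
      go (suc N) P g zero    = contract N (▷-zero _ _) (weaken _ (⊛-assoc k (P 0) (g 0)))
        (go N (∂ P) (∂ g) 0) (fold _ _) (⊛-congˡ k (≋-sym (▷-zero P g)))
      go (suc N) P g (suc n) = contract N (▷-suc _ _ n) (go (suc N) P (∂ g) n)
        (go N (∂ P) (∂ g) (suc n)) (fold _ _) (⊛-congˡ k (≋-sym (▷-suc P g n)))

    ▷-·ʳ : ∀ k P g → P ▷ (k · g) ≣ k · (P ▷ g)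
    ▷-·ʳ k P g n = limit λ N → go N P g n
      where
      fold : ∀ a v → k ⊛ a ⊕ X ⊛ (k ⊛ v) ≋ k ⊛ (a ⊕ X ⊛ v)
      fold a v = KS.solve 4 (λ x k a v → k KS.:* a KS.:+ x KS.:* (k KS.:* v) KS.:=
                                       k KS.:* (a KS.:+ x KS.:* v)) K.refl X k a v
      go : ∀ N P g n → (P ▷ (k · g)) n ≋[ N ] k ⊛ (P ▷ g) n
      go zero    P g n       k ()
      go (suc N) P g zero    = contract N (▷-zero _ _)
        (weaken _ (KS.solve 3 (λ k a b → a KS.:* (k KS.:* b) KS.:= k KS.:* (a KS.:* b)) K.refl k (P 0) (g 0)))
        (go N (∂ P) (∂ g) 0) (fold _ _) (⊛-congˡ k (≋-sym (▷-zero P g)))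
      go (suc N) P g (suc n) = contract N (▷-suc _ _ n) (go (suc N) P (∂ g) n)
        (go N (∂ P) (∂ g) (suc n)) (fold _ _) (⊛-congˡ k (≋-sym (▷-suc P g n)))

    ▷-zeroˡ : ∀ g → 0ₛ ▷ g ≣ 0ₛ
    ▷-zeroˡ g n = ≋-trans (▷-cong {0ₛ} {zeroₛ · 0ₛ} {g} {g} (λ n → ≋-sym (⊛-zeroˡ zeroₛ)) (λ _ _ → refl) n)
      (≋-trans (▷-·ˡ zeroₛ 0ₛ g n) (⊛-zeroˡ _))

    ▷-identityˡ : ∀ g → 1ₛ ▷ g ≣ g
    ▷-identityˡ g zero    = ≋-trans (▷-zero 1ₛ g) (≋-trans
      (K.+-cong (K.*-identityˡ (g 0)) (⊛-congˡ (X) (▷-zeroˡ (∂ g) 0)))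
      (KS.solve 2 (λ x g → g KS.:+ x KS.:* KS.con 0 KS.:= g) K.refl X (g 0)))
    ▷-identityˡ g (suc n) = ≋-trans (▷-suc 1ₛ g n) (≋-trans
      (K.+-cong (▷-identityˡ (∂ g) n) (⊛-congˡ (X) (▷-zeroˡ (∂ g) (suc n))))
      (KS.solve 2 (λ x g → g KS.:+ x KS.:* KS.con 0 KS.:= g) K.refl X (g (suc n))))

    ∂-▷ : ∀ P g → ∂ (P ▷ g) ≣ P ▷ ∂ g ⊞ X · ∂ (∂ P ▷ ∂ g)
    ∂-▷ P g n = ▷-suc P g n

    private
      ▷-∂-▷ : ∀ P Q g n → (P ▷ ∂ (Q ▷ g)) n ≋ (P ▷ (Q ▷ ∂ g)) n ⊕ X ⊛ (P ▷ ∂ (∂ Q ▷ ∂ g)) n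
      ▷-∂-▷ P Q g n = ≋-trans (▷-cong {P} (λ _ _ → refl) (∂-▷ Q g) n) (≋-trans
        (▷-distribˡ P (Q ▷ ∂ g) (X · ∂ (∂ Q ▷ ∂ g)) n)
        (K.+-congˡ (▷-·ʳ X P (∂ (∂ Q ▷ ∂ g)) n)))

    -- Operators ∑ₖ P k (X d/dv)ᵏ / k! compose by multiplying their symbols, and the symbols, being
    -- exponential generating functions, multiply by `⧢`. The induction is on the precision and, at
    -- a given precision, on n.
    ▷-assoc : ∀ P Q g → (P ⧢ Q) ▷ g ≣ P ▷ (Q ▷ g)
    ▷-assoc P Q g n = limit λ N → go N P Q g n
      where
      go : ∀ N P Q g n → ((P ⧢ Q) ▷ g) n ≋[ N ] (P ▷ (Q ▷ g)) n
      go zero    P Q g n       k ()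
      go (suc N) P Q g zero    = contract N
        (≋-trans (▷-zero (P ⧢ Q) g) (K.+-congˡ (⊛-congˡ (X) (▷-distribʳ (∂ g) (∂ P ⧢ Q) (P ⧢ ∂ Q) 0))))
        (λ _ _ → refl)
        (⊕-cong[] (go N (∂ P) Q (∂ g) 0)
          (≋[]-trans (go N P (∂ Q) (∂ g) 0) (weaken _ (▷-zero P (∂ Q ▷ ∂ g)))))
        (KS.solve 7 (λ x p q g a b c → (p KS.:* q) KS.:* g KS.:+ x KS.:* (a KS.:+ (p KS.:* b KS.:+ x KS.:* c))
                                 KS.:= p KS.:* (q KS.:* g KS.:+ x KS.:* b) KS.:+ x KS.:* (a KS.:+ x KS.:* c)) K.refl
          X (P 0) (Q 0) (g 0) _ _ _)
        (≋-sym (≋-trans (▷-zero P (Q ▷ g)) (K.+-cong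
          (⊛-congˡ (P 0) (▷-zero Q g)) (⊛-congˡ (X) (▷-∂-▷ (∂ P) Q g 0)))))
      go (suc N) P Q g (suc n) = contract N
        (≋-trans (▷-suc (P ⧢ Q) g n) (K.+-congˡ (⊛-congˡ (X) (▷-distribʳ (∂ g) (∂ P ⧢ Q) (P ⧢ ∂ Q) (suc n)))))
        (go (suc N) P Q (∂ g) n)
        (⊕-cong[] (go N (∂ P) Q (∂ g) (suc n))
          (≋[]-trans (go N P (∂ Q) (∂ g) (suc n)) (weaken _ (▷-suc P (∂ Q ▷ ∂ g) n))))
        (KS.solve 5 (λ x u a b c → u KS.:+ x KS.:* (a KS.:+ (b KS.:+ x KS.:* c))
                                 KS.:= (u KS.:+ x KS.:* b) KS.:+ x KS.:* (a KS.:+ x KS.:* c)) K.refl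
          X _ _ _ _)
        (≋-sym (≋-trans (▷-suc P (Q ▷ g) n) (K.+-cong
          (▷-∂-▷ P Q g n) (⊛-congˡ (X) (▷-∂-▷ (∂ P) Q g (suc n))))))

    -- The term β (a - 1) is unfolded down to 1, so that every occurrence of `g` is behind a factor
    -- `Y`. With `g a` in place of `Θ g a` that summand would gain no precision.
    Θ : Seq → Seq
    Θ g zero    = K.1# ⊕ Y ⊛ (g ▷ g) 0
    Θ g (suc a) = Θ g a ⊕ Y ⊛ (g ▷ g) (suc a)

    Θ-step : ∀ {g h} N → (∀ n → g n ≋[ N ] h n) → ∀ n → Θ g n ≋[ suc N ] Θ h n
    Θ-step N p zero    = ⊕-cong[] (λ _ _ → refl) (shift-const-⊛-step ŷ N (▷-cong[] p p 0))
    Θ-step N p (suc n) = ⊕-cong[] (Θ-step N p n) (shift-const-⊛-step ŷ N (▷-cong[] p p (suc n)))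

    approx : ℕ → Seq
    approx zero    = 0ₛ
    approx (suc N) = Θ (approx N)

    -- The approximations number l + 1 and later all have the same coefficient of degree l.
    β : Seq
    β a l = approx (suc l) a l

    approx-step : ∀ N n → approx N n ≋[ N ] approx (suc N) n
    approx-step zero    n k ()
    approx-step (suc N) n = Θ-step N (approx-step N) n

    approx-stable : ∀ d k n → approx (suc k) n k ≈ approx (d ℕ.+ suc k) n k
    approx-stable zero    k n = refl
    approx-stable (suc d) k n = trans (approx-stable d k n)
      (approx-step (d ℕ.+ suc k) n k (ℕ.m≤n+m (suc k) d))

    β-approx : ∀ N n → β n ≋[ N ] approx N n
    β-approx N n k k<N = trans (approx-stable (N ∸ suc k) k n)
      (reflexive (≡.cong (λ M → approx M n k) (ℕ.m∸n+n≡m k<N)))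

    β-Θ : β ≣ Θ β
    β-Θ n k = sym (Θ-step k (β-approx k) n k ℕ.≤-refl)

    β-zero : β 0 ≋ K.1# ⊕ Y ⊛ (β ▷ β) 0
    β-zero = β-Θ 0

    β-suc : ∀ a → β (suc a) ≋ β a ⊕ Y ⊛ (β ▷ β) (suc a)
    β-suc a = ≋-trans (β-Θ (suc a)) (K.+-congʳ (≋-sym (β-Θ a)))

    β-system : β ≣ (K.1# ∷ₛ β) ⊞ Y · (β ▷ β)
    β-system zero    = β-zero
    β-system (suc a) = β-suc a

    -- F P n below weighs, up to the factor Xⁿ, what happens in the trees of P during n
    -- visits to their roots, and ⧢ interleaves.  If g does this for the children of a
    -- vertex, then Φ g d and Ψ g d do it for the vertex itself with d visits still to
    -- start, where Φ g has another visit in progress and Ψ g has not.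
    Φ Ψ 𝒟 : Seq → Seq
    Φ g = g ▷ β
    Ψ g = g 0 ∷ₛ Φ g
    𝒟 g = X · ∂ g ⊞ Y · (β ⧢ g)

    Φ-cons : ∀ g → g ▷ (K.1# ∷ₛ β) ≣ Ψ g ⊞ X · (∂ g ▷ β)
    Φ-cons g zero    = ≋-trans (▷-zero g _) (K.+-congʳ (K.*-identityʳ (g 0)))
    Φ-cons g (suc n) = ▷-suc g _ n

    -- The three possibilities at a vertex: `Ψ g` ends the visit, `X · ∂ g` enters a visited child,
    -- and `Y · (β ⧢ g)` opens a new child, whose later visits are interleaved with those of the
    -- others. They come from the equation of `β` on the right of `g ▷ β`, where the action law
    -- turns `g ▷ (β ▷ β)` into `(β ⧢ g) ▷ β`.
    Φ-step : ∀ g → Φ g ≣ Ψ g ⊞ Φ (𝒟 g)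
    Φ-step g n = begin
      (g ▷ β) n
        ≈⟨ ▷-cong {g} (λ _ _ → refl) β-system n ⟩
      (g ▷ ((K.1# ∷ₛ β) ⊞ Y · (β ▷ β))) n
        ≈⟨ ▷-distribˡ g _ _ n ⟩
      (g ▷ (K.1# ∷ₛ β)) n ⊕ (g ▷ (Y · (β ▷ β))) n
        ≈⟨ K.+-cong (Φ-cons g n) (▷-·ʳ Y g (β ▷ β) n) ⟩
      (Ψ g n ⊕ X ⊛ (∂ g ▷ β) n) ⊕ Y ⊛ (g ▷ (β ▷ β)) n
        ≈⟨ K.+-congˡ (⊛-congˡ Y (≋-trans (≋-sym (▷-assoc g β β n))
             (▷-cong (⧢-comm g β) (λ _ _ → refl) n))) ⟩
      (Ψ g n ⊕ X ⊛ (∂ g ▷ β) n) ⊕ Y ⊛ ((β ⧢ g) ▷ β) n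
        ≈⟨ K.+-assoc _ _ _ ⟩
      Ψ g n ⊕ (X ⊛ (∂ g ▷ β) n ⊕ Y ⊛ ((β ⧢ g) ▷ β) n)
        ≈⟨ K.+-congˡ (K.+-cong (≋-sym (▷-·ˡ X (∂ g) β n)) (≋-sym (▷-·ˡ Y (β ⧢ g) β n))) ⟩
      Ψ g n ⊕ (((X · ∂ g) ▷ β) n ⊕ ((Y · (β ⧢ g)) ▷ β) n)
        ≈⟨ K.+-congˡ (≋-sym (▷-distribʳ β (X · ∂ g) (Y · (β ⧢ g)) n)) ⟩
      Ψ g n ⊕ Φ (𝒟 g) n ∎
      where open import Relation.Binary.Reasoning.Setoid K.setoid

    F : Forest ⊤ → Seq
    F ∅            = 1ₛ
    F (node _ P Q) = Ψ (F P) ⧢ F Q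

    F-zero : ∀ P → F P 0 ≋ K.1#
    F-zero ∅            = λ _ → refl
    F-zero (node _ P Q) = ≋-trans (⊛-cong (F-zero P) (F-zero Q)) (K.*-identityˡ _)

    -- The weight of all ways to finish the walk. `Φ g` accounts for the visit in progress and the
    -- later ones to this vertex; the shuffle with `F Q` hands the result to the parent, for which
    -- this vertex is one child among those of `Q`.
    V : Seq → List (Forest ⊤) → Ser
    V g []       = Φ g 0
    V g (Q ∷ st) = V (Φ g ⧢ F Q) st

    V-cong : ∀ {g h} st → g ≣ h → V g st ≋ V h st
    V-cong []       p = ▷-cong {g = β} p (λ _ _ → refl) 0
    V-cong (Q ∷ st) p = V-cong st (⧢-cong (▷-cong {g = β} p (λ _ _ → refl)) (λ _ _ → refl))

    V-⊞ : ∀ st g h → V (g ⊞ h) st ≋ V g st ⊕ V h st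
    V-⊞ []       g h = ▷-distribʳ β g h 0
    V-⊞ (Q ∷ st) g h = ≋-trans
      (V-cong st λ n → ≋-trans (⧢-cong {Q = F Q} (▷-distribʳ β g h) (λ _ _ → refl) n)
                               (⧢-distribʳ (F Q) (Φ g) (Φ h) n))
      (V-⊞ st _ _)

    V-· : ∀ st k g → V (k · g) st ≋ k ⊛ V g st
    V-· []       k g = ▷-·ˡ k g β 0
    V-· (Q ∷ st) k g = ≋-trans
      (V-cong st λ n → ≋-trans (⧢-cong {Q = F Q} (▷-·ˡ k g β) (λ _ _ → refl) n)
                               (⧢-·ˡ k (Φ g) (F Q) n))
      (V-· st k _)

    V-0ₛ : ∀ st → V 0ₛ st ≋ zeroₛ
    V-0ₛ st = ≋-trans (V-cong st (λ n → ≋-sym (⊛-zeroˡ zeroₛ)))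
      (≋-trans (V-· st zeroₛ 0ₛ) (⊛-zeroˡ _))

    ∑ₛ : Forest ⊤ → (⊤ → Forest ⊤ → Forest ⊤ → Seq) → Seq
    ∑ₛ = sumPicks _⊞_ 0ₛ

    ∑ₖ : Forest ⊤ → (⊤ → Forest ⊤ → Forest ⊤ → Ser) → Ser
    ∑ₖ = sumPicks _⊕_ zeroₛ

    ∑ᵣ : Forest ⊤ → (⊤ → Forest ⊤ → Forest ⊤ → Carrier) → Carrier
    ∑ᵣ = sumPicks _+_ 0#

    V-∑ : ∀ st P h → V (∑ₛ P h) st ≋ ∑ₖ P λ a P′ Q′ → V (h a P′ Q′) st
    V-∑ st ∅            h = V-0ₛ st
    V-∑ st (node a P Q) h = ≋-trans (V-⊞ st _ _) (K.+-congˡ (V-∑ st Q _))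

    ∑ₛ-cong : ∀ P {h k} → (∀ a P′ Q′ → h a P′ Q′ ≣ k a P′ Q′) → ∑ₛ P h ≣ ∑ₛ P k
    ∑ₛ-cong ∅            p n = λ _ → refl
    ∑ₛ-cong (node a P Q) p n = K.+-cong (p a P Q n) (∑ₛ-cong Q (λ b P′ Q′ → p b P′ (node a P Q′)) n)

    ⧢-∑ : ∀ g P h → g ⧢ ∑ₛ P h ≣ ∑ₛ P λ a P′ Q′ → g ⧢ h a P′ Q′
    ⧢-∑ g ∅            h n = ≋-trans (⧢-comm g 0ₛ n) (⧢-zeroˡ g n)
    ⧢-∑ g (node a P Q) h n = ≋-trans (⧢-distribˡ g _ _ n) (K.+-congˡ (⧢-∑ g Q _ n))

    ⧢-swap : ∀ f g h → f ⧢ (g ⧢ h) ≣ g ⧢ (f ⧢ h)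
    ⧢-swap f g h n = ≋-trans (≋-sym (⧢-assoc f g h n))
      (≋-trans (⧢-cong {Q = h} (⧢-comm f g) (λ _ _ → refl) n) (⧢-assoc g f h n))

    -- One more visit has to start in one of the trees: the derivation selects it, and
    -- `∂ (Ψ g) = Φ g` puts a visit in progress there.
    ∂-F : ∀ P → ∂ (F P) ≣ ∑ₛ P λ _ P′ Q′ → Φ (F P′) ⧢ F Q′
    ∂-F ∅            n = λ _ → refl
    ∂-F (node a P Q) n = K.+-congˡ (≋-trans (⧢-cong {Ψ (F P)} (λ _ _ → refl) (∂-F Q) n)
      (≋-trans (⧢-∑ (Ψ (F P)) Q _ n)
        (∑ₛ-cong Q (λ b P′ Q′ → ⧢-swap (Ψ (F P)) (Φ (F P′)) (F Q′)) n)))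

    up : Forest ⊤ → List (Forest ⊤) → Ser
    up P []       = K.1#
    up P (Q ∷ st) = V (F (node tt P Q)) st

    V-Φ-step : ∀ P st → V (F P) st ≋ up P st ⊕ V (𝒟 (F P)) st
    V-Φ-step P []       = ≋-trans (Φ-step (F P) 0) (K.+-congʳ (F-zero P))
    V-Φ-step P (Q ∷ st) = ≋-trans
      (V-cong st λ n → ≋-trans (⧢-cong {Q = F Q} (Φ-step (F P)) (λ _ _ → refl) n)
                               (⧢-distribʳ (F Q) (Ψ (F P)) (Φ (𝒟 (F P))) n))
      (V-⊞ st _ _)

    -- The summands are the possible next steps of the walk: to the parent (or the
    -- end), to a visited child, to a new child.
    V-step : ∀ P st → V (F P) st ≋
      up P st ⊕ (X ⊛ ∑ₖ P (λ _ P′ Q′ → V (F P′) (Q′ ∷ st)) ⊕ Y ⊛ V (F ∅) (P ∷ st))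
    V-step P st = ≋-trans (V-Φ-step P st) (K.+-congˡ (≋-trans (V-⊞ st _ _) (K.+-cong
      (≋-trans (V-· st X _) (⊛-congˡ X (≋-trans (V-cong st (∂-F P)) (V-∑ st P _))))
      (≋-trans (V-· st Y _) (⊛-congˡ Y (V-cong st
        (⧢-cong {Q = F P} (λ n → ≋-sym (▷-identityˡ β n)) (λ _ _ → refl))))))))

    V-leaf : V (F ∅) [] ≋ β 0
    V-leaf = ▷-identityˡ β 0

    ∑ₖ-coeff : ∀ P h l → ∑ₖ P h l ≡ ∑ᵣ P λ a P′ Q′ → h a P′ Q′ l
    ∑ₖ-coeff ∅            h l = ≡.refl
    ∑ₖ-coeff (node a P Q) h l = ≡.cong (h a P Q l +_) (∑ₖ-coeff Q _ l)

    ∑ᵣ-cong : ∀ P {h k} → (∀ a P′ Q′ → h a P′ Q′ ≈ k a P′ Q′) → ∑ᵣ P h ≈ ∑ᵣ P k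
    ∑ᵣ-cong ∅            p = refl
    ∑ᵣ-cong (node a P Q) p = +-cong (p a P Q) (∑ᵣ-cong Q λ b P′ Q′ → p b P′ (node a P Q′))

    ∑ᵣ-zero : ∀ P {h} → (∀ a P′ Q′ → h a P′ Q′ ≈ 0#) → ∑ᵣ P h ≈ 0#
    ∑ᵣ-zero ∅            p = refl
    ∑ᵣ-zero (node a P Q) p = trans (+-cong (p a P Q) (∑ᵣ-zero Q λ b P′ Q′ → p b P′ (node a P Q′)))
                                   (+-identityˡ 0#)

    ∑ᵣ-*ˡ : ∀ c P h → (∑ᵣ P λ a P′ Q′ → c * h a P′ Q′) ≈ c * ∑ᵣ P h
    ∑ᵣ-*ˡ c ∅            h = sym (zeroʳ c)
    ∑ᵣ-*ˡ c (node a P Q) h = trans (+-congˡ (∑ᵣ-*ˡ c Q _)) (sym (distribˡ c _ _))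

    V-coeff-zero : ∀ P st → V (F P) st 0 ≈ up P st 0
    V-coeff-zero P st = trans (V-step P st 0) (trans
      (+-congˡ (trans (+-cong (shift-const-⊛ x̂ (∑ₖ P (λ _ P′ Q′ → V (F P′) (Q′ ∷ st))) 0)
                              (shift-const-⊛ ŷ (V (F ∅) (P ∷ st)) 0)) (+-identityˡ 0#)))
      (+-identityʳ _))

    V-coeff-suc : ∀ P st l → V (F P) st (suc l) ≈
      up P st (suc l) + (x̂ * ∑ᵣ P (λ _ P′ Q′ → V (F P′) (Q′ ∷ st) l) + ŷ * V (F ∅) (P ∷ st) l)
    V-coeff-suc P st l = trans (V-step P st (suc l)) (+-congˡ (+-cong
      (trans (shift-const-⊛ x̂ (∑ₖ P children) (suc l)) (*-congˡ (reflexive (∑ₖ-coeff P children l))))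
      (shift-const-⊛ ŷ (V (F ∅) (P ∷ st)) (suc l))))
      where
      children : ⊤ → Forest ⊤ → Forest ⊤ → Ser
      children _ P′ Q′ = V (F P′) (Q′ ∷ st)

    module Walks (x : Carrier) (x̂≈xŷ : x̂ ≈ x * ŷ) where

      -- As `x̂` is `x` times `ŷ`, every step down carries the same factor `ŷ`. Its power depends
      -- only on the number of steps down and is split off, so only the `x` of a step to a visited
      -- child remains.
      walks : ℕ → Forest ⊤ → List (Forest ⊤) → Carrier
      walksUp : ℕ → Forest ⊤ → List (Forest ⊤) → Carrier
      walks zero    P []       = 1#
      walks zero    P (_ ∷ _)  = 0#
      walks (suc n) P st       =
        walksUp n P st + (x * ∑ᵣ P (λ _ P′ Q′ → walks n P′ (Q′ ∷ st)) + walks n ∅ (P ∷ st))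
      walksUp n P []       = 0#
      walksUp n P (Q ∷ st) = walks n (node tt P Q) st

      walks-short : ∀ n P st → n < length st → walks n P st ≈ 0#
      walks-short zero    P (_ ∷ _)  _ = refl
      walks-short (suc n) P (Q ∷ st) (s≤s n<d) = trans
        (+-cong (walks-short n (node tt P Q) st n<d)
          (+-cong (trans (*-congˡ (∑ᵣ-zero P λ _ P′ Q′ → walks-short n P′ (Q′ ∷ Q ∷ st) n<2+d)) (zeroʳ x))
            (walks-short n ∅ (P ∷ Q ∷ st) n<2+d)))
        (trans (+-identityˡ _) (+-identityˡ _))
        where n<2+d = ℕ.<-trans n<d (ℕ.<-trans (ℕ.n<1+n _) (ℕ.n<1+n _))

      pow : ℕ → Carrier
      pow zero    = 1#
      pow (suc l) = ŷ * pow l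

      V-walks-suc : ∀ l P st → up P st (suc l) ≈ pow (suc l) * walksUp (suc (steps l (length st))) P st →
        (∀ P′ Q′ → V (F P′) (Q′ ∷ st) l ≈ pow l * walks (steps l (suc (length st))) P′ (Q′ ∷ st)) →
        V (F P) st (suc l) ≈ pow (suc l) * walks (steps (suc l) (length st)) P st
      V-walks-suc l P st up-walks ih = trans (V-coeff-suc P st l) (trans
        (+-cong up-walks (+-cong
          (*-cong x̂≈xŷ (trans (∑ᵣ-cong P λ _ P′ Q′ → deeper P′ Q′) (∑ᵣ-*ˡ (pow l) P _)))
          (*-congˡ (deeper ∅ P))))
        (solve 6 (λ x y p u s v → y :* p :* u :+ (x :* y :* (p :* s) :+ y :* (p :* v))
                                := y :* p :* (u :+ (x :* s :+ v))) refl x ŷ (pow l) _ _ _))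
        where
        deeper : ∀ P′ Q′ → V (F P′) (Q′ ∷ st) l ≈ pow l * walks (suc (steps l (length st))) P′ (Q′ ∷ st)
        deeper P′ Q′ = trans (ih P′ Q′)
          (*-congˡ (reflexive (≡.cong (λ n → walks n P′ (Q′ ∷ st)) (steps-suc l (length st)))))

      -- Both sides obey the recursion over the next step. The induction descends in l, except that
      -- a step up keeps l and shortens the stack.
      V-walks : ∀ l P st → V (F P) st l ≈ pow l * walks (steps l (length st)) P st
      V-walks zero    P []       = trans (V-coeff-zero P []) (sym (*-identityˡ 1#))
      V-walks zero    P (Q ∷ st) = trans (V-coeff-zero P (Q ∷ st)) (trans (V-walks zero (node tt P Q) st)
        (*-congˡ (sym (trans (+-congˡ (trans (+-cong
           (trans (*-congˡ (∑ᵣ-zero P λ _ P′ Q′ → walks-short (length st) P′ (Q′ ∷ Q ∷ st) d<2+d)) (zeroʳ x))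
           (walks-short (length st) ∅ (P ∷ Q ∷ st) d<2+d)) (+-identityˡ 0#)))
          (+-identityʳ _)))))
        where d<2+d = ℕ.<-trans (ℕ.n<1+n (length st)) (ℕ.n<1+n _)
      V-walks (suc l) P []       = V-walks-suc l P [] (sym (zeroʳ _)) λ P′ Q′ → V-walks l P′ (Q′ ∷ [])
      V-walks (suc l) P (Q ∷ st) = V-walks-suc l P (Q ∷ st)
        (trans (V-walks (suc l) (node tt P Q) st) (*-congˡ (reflexive
          (≡.cong (λ n → walks (suc n) (node tt P Q) st) (≡.sym (steps-suc l (length st)))))))
        λ P′ Q′ → V-walks l P′ (Q′ ∷ Q ∷ st)

      β-walks : ∀ l → β 0 l ≈ pow l * walks (steps l 0) ∅ []
      β-walks l = trans (sym (V-leaf l)) (V-walks l ∅ [])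

-- Order by order in x: powers of C and poles at t = 1.

module SingularExpansion where

  open SeriesRing
  open import Data.Fin.Base using (Fin; zero; suc; toℕ)
  open import Data.Fin.Properties using (toℕ≤pred[n])
  open import Data.Integer.Base using (+_)
  open import Data.Maybe.Base using (Maybe; just; nothing)
  open import Data.Nat.Base as ℕ using (ℕ; zero; suc; _∸_; _<_; _≤_; s≤s)
  import Data.Nat.Properties as ℕ
  open import Data.Sum.Base using (_⊎_; inj₁; inj₂)
  open import Data.Rational.Base as ℚ using (ℚ; 0ℚ; 1ℚ)
  import Data.Rational.Properties as ℚ
  open import Function.Base using (_∘_)
  open import Level using (0ℓ)
  open import Relation.Binary.PropositionalEquality as ≡ using (_≡_)
  open import Relation.Nullary using (yes; no)
  open import Algebra.Bundles using (CommutativeRing)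
  open import Algebra.Solver.Ring.AlmostCommutativeRing using (fromCommutativeRing; _-Raw-AlmostCommutative⟶_)
  import Algebra.Solver.Ring
  import Algebra.Properties.Semiring.Sum
  import Relation.Binary.Reasoning.Setoid

  module Alg (R : CommutativeRing 0ℓ 0ℓ)
             (φ : CommutativeRing.rawRing ℚ.+-*-commutativeRing -Raw-AlmostCommutative⟶ fromCommutativeRing R) where
    open CommutativeRing R hiding (zero)
    open _-Raw-AlmostCommutative⟶_ φ using (⟦_⟧)
    open Series R
    open Algebra.Properties.Semiring.Sum semiring using (sum)

    coeff≟ : ∀ a b → Maybe (⟦ a ⟧ ≈ ⟦ b ⟧)
    coeff≟ a b with a ℚ.≟ b
    ... | yes ≡.refl = just refl
    ... | no _       = nothing

    open Algebra.Solver.Ring (CommutativeRing.rawRing ℚ.+-*-commutativeRing)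
      (fromCommutativeRing R) φ coeff≟ using (solve; con; _:+_; _:*_; _:-_; :-_; _:=_)

    2ℚ 4ℚ : ℚ
    2ℚ = 1ℚ ℚ.+ 1ℚ
    4ℚ = 2ℚ ℚ.+ 2ℚ

    -- Squaring s = 1 - 2 x c gives the equation only up to the factor 4 x, which cannot be
    -- cancelled in a general ring; for power series it is cancelled later.
    quadratic : ∀ x c s → s * s ≈ 1# - ⟦ 4ℚ ⟧ * x → s ≈ 1# - ⟦ 2ℚ ⟧ * (x * c) →
                ⟦ 4ℚ ⟧ * (x * c) ≈ ⟦ 4ℚ ⟧ * (x * (1# + x * (c * c)))
    quadratic x c s p q = begin
      ⟦ 4ℚ ⟧ * (x * c)
        ≈⟨ solve 2 (λ x c → con 4ℚ :* (x :* c) := con 4ℚ :* (x :* (con 1ℚ :+ x :* (c :* c))) :+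
             ((con 1ℚ :- con 4ℚ :* x) :- (con 1ℚ :- con 2ℚ :* (x :* c)) :* (con 1ℚ :- con 2ℚ :* (x :* c))))
             refl x c ⟩
      rhs + ((⟦ 1ℚ ⟧ - ⟦ 4ℚ ⟧ * x) - (⟦ 1ℚ ⟧ - ⟦ 2ℚ ⟧ * (x * c)) * (⟦ 1ℚ ⟧ - ⟦ 2ℚ ⟧ * (x * c)))
        ≈⟨ +-congˡ (+-cong one′ (-‿cong (*-cong q′ q′))) ⟩
      rhs + ((1# - ⟦ 4ℚ ⟧ * x) - s * s)
        ≈⟨ +-congˡ (+-congˡ (-‿cong p)) ⟩
      rhs + ((1# - ⟦ 4ℚ ⟧ * x) - (1# - ⟦ 4ℚ ⟧ * x))
        ≈⟨ +-congˡ (-‿inverseʳ _) ⟩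
      rhs + 0#
        ≈⟨ +-identityʳ _ ⟩
      rhs
        ≈⟨ *-congˡ (*-congˡ (+-congʳ 1-homo)) ⟩
      ⟦ 4ℚ ⟧ * (x * (1# + x * (c * c))) ∎
      where
      open _-Raw-AlmostCommutative⟶_ φ using (1-homo)
      open Relation.Binary.Reasoning.Setoid setoid
      rhs = ⟦ 4ℚ ⟧ * (x * (⟦ 1ℚ ⟧ + x * (c * c)))
      one′ = +-congʳ 1-homo
      q′ : ⟦ 1ℚ ⟧ - ⟦ 2ℚ ⟧ * (x * c) ≈ s
      q′ = trans (+-congʳ 1-homo) (sym q)

    infixr 8 _^_
    _^_ : Carrier → ℕ → Carrier
    f ^ zero  = 1#
    f ^ suc n = f * f ^ n

    ^-+ : ∀ f a b → f ^ (a ℕ.+ b) ≈ f ^ a * f ^ b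
    ^-+ f zero    b = sym (*-identityˡ (f ^ b))
    ^-+ f (suc a) b = trans (*-congˡ (^-+ f a b)) (sym (*-assoc f (f ^ a) (f ^ b)))

    module Filtration (z C : Carrier) (C-fixed : C ≈ 1# + z * (C * C)) where

      t u : Carrier
      t = z * C ^ 2
      u = 1# - t

      data IsPoly : Carrier → Set where
        const : ∀ a → IsPoly ⟦ a ⟧
        var   : IsPoly t
        add   : ∀ {f g} → IsPoly f → IsPoly g → IsPoly (f + g)
        mul   : ∀ {f g} → IsPoly f → IsPoly g → IsPoly (f * g)
        resp  : ∀ {f g} → f ≈ g → IsPoly f → IsPoly g

      open _-Raw-AlmostCommutative⟶_ φ using (0-homo; 1-homo)

      IsPoly-1 : IsPoly 1#
      IsPoly-1 = resp 1-homo (const 1ℚ)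

      IsPoly-neg : ∀ {f} → IsPoly f → IsPoly (- f)
      IsPoly-neg {f} p = resp (solve 1 (λ f → con (ℚ.- 1ℚ) :* f := :- f) refl f) (mul (const (ℚ.- 1ℚ)) p)

      IsPoly-^ : ∀ {f} → IsPoly f → ∀ n → IsPoly (f ^ n)
      IsPoly-^ p zero    = IsPoly-1
      IsPoly-^ p (suc n) = mul p (IsPoly-^ p n)

      IsPoly-u : IsPoly u
      IsPoly-u = add IsPoly-1 (IsPoly-neg var)

      -- G c k is the set of f = Cᶜ q / (1 - t)ᵏ with q a polynomial in t.
      record G (c k : ℕ) (f : Carrier) : Set where
        constructor frac
        field
          numerator  : Carrier
          polynomial : IsPoly numerator
          equation   : u ^ k * f ≈ C ^ c * numerator

      G-resp : ∀ {c k f g} → f ≈ g → G c k f → G c k g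
      G-resp p (frac q pq e) = frac q pq (trans (*-congˡ (sym p)) e)

      G-zero : ∀ c k → G c k 0#
      G-zero c k = frac ⟦ 0ℚ ⟧ (const 0ℚ) (trans (zeroʳ _) (sym (trans (*-congˡ 0-homo) (zeroʳ _))))

      G-+ : ∀ {c k f g} → G c k f → G c k g → G c k (f + g)
      G-+ (frac q pq e) (frac r pr e′) = frac (q + r) (add pq pr)
        (trans (distribˡ _ _ _) (trans (+-cong e e′) (sym (distribˡ _ _ _))))

      G-neg : ∀ {c k f} → G c k f → G c k (- f)
      G-neg {c} {k} {f} (frac q pq e) = frac (- q) (IsPoly-neg pq) (trans
        (solve 2 (λ u f → u :* :- f := :- (u :* f)) refl (u ^ k) f)
        (trans (-‿cong e) (solve 2 (λ c q → :- (c :* q) := c :* :- q) refl (C ^ c) q)))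

      G-sub : ∀ {c k f g} → G c k f → G c k g → G c k (f - g)
      G-sub p q = G-+ p (G-neg q)

      G-* : ∀ {c d k l f g} → G c k f → G d l g → G (c ℕ.+ d) (k ℕ.+ l) (f * g)
      G-* {c} {d} {k} {l} {f} {g} (frac q pq e) (frac r pr e′) = frac (q * r) (mul pq pr) (trans
        (trans (*-congʳ (^-+ u k l))
          (solve 4 (λ a b f g → a :* b :* (f :* g) := (a :* f) :* (b :* g)) refl (u ^ k) (u ^ l) f g))
        (trans (*-cong e e′) (trans
          (solve 4 (λ a q b r → (a :* q) :* (b :* r) := a :* b :* (q :* r)) refl (C ^ c) q (C ^ d) r)
          (*-congʳ (sym (^-+ C c d))))))

      G-weaken : ∀ {c k l f} → k ≤ l → G c k f → G c l f
      G-weaken {c} {k} {l} {f} k≤l (frac q pq e) = frac (q * u ^ (l ∸ k)) (mul pq (IsPoly-^ IsPoly-u (l ∸ k))) (trans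
        (*-congʳ (trans (reflexive (≡.cong (u ^_) (≡.sym (ℕ.m+[n∸m]≡n k≤l)))) (^-+ u k (l ∸ k))))
        (trans (solve 3 (λ a b f → a :* b :* f := a :* f :* b) refl (u ^ k) (u ^ (l ∸ k)) f)
          (trans (*-congʳ e) (*-assoc _ _ _))))

      -- z C² = t: a factor z is paid for with two powers of C and leaves a factor t in the
      -- numerator.
      G-z : ∀ {c k f} → G (suc (suc c)) k f → G c k (z * f)
      G-z {c} {k} {f} (frac q pq e) = frac (t * q) (mul var pq) (trans
        (solve 3 (λ u z f → u :* (z :* f) := z :* (u :* f)) refl (u ^ k) z f)
        (trans (*-congˡ e) (trans (*-congˡ (*-congʳ (trans (sym (*-assoc C C (C ^ c))) (*-congʳ (*-congˡ (sym (*-identityʳ C)))))))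
          (solve 4 (λ z c d q → z :* (c :* d :* q) := d :* (z :* c :* q)) refl z (C ^ 2) (C ^ c) q))))

      G-C : ∀ c → G c 0 (C ^ c)
      G-C c = frac 1# IsPoly-1 (*-comm 1# (C ^ c))

      G-sum : ∀ {c k n} {f : Fin n → Carrier} → (∀ i → G c k (f i)) → G c k (sum f)
      G-sum {c} {k} {zero}  p = G-zero c k
      G-sum {c} {k} {suc n} p = G-+ (p zero) (G-sum (p ∘ suc))

      -- the coefficient of xʲ lies in G c (j ∸ s), for j < N
      record Fil (s c N : ℕ) (f : Ser) : Set where
        constructor fil
        field
          at : ∀ j → j < N → G c (j ∸ s) (f j)
      open Fil

      -- Truncated subtraction is superadditive, (i ∸ s) + ((j - i) ∸ s) ≤ j ∸ s, so no term of the
      -- convolution exceeds the pole order allowed.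
      Fil-⊛ : ∀ {s c d N f g} → Fil s c N f → Fil s d N g → Fil s (c ℕ.+ d) N (f ⊛ g)
      Fil-⊛ {s} p q = fil λ j j<N → G-sum {n = suc j} λ i → G-weaken (split j (toℕ i) (toℕ≤pred[n] i)) (G-*
        (at p (toℕ i) (ℕ.≤-<-trans (toℕ≤pred[n] i) j<N))
        (at q (j ∸ toℕ i) (ℕ.≤-<-trans (ℕ.m∸n≤m j (toℕ i)) j<N)))
        where
        subadditive : ∀ s a b → (a ∸ s) ℕ.+ (b ∸ s) ≤ (a ℕ.+ b) ∸ s
        subadditive zero    a       b = ℕ.≤-refl
        subadditive (suc s) zero    b = ℕ.≤-refl
        subadditive (suc s) (suc a) b = ℕ.≤-trans
          (ℕ.+-monoʳ-≤ (a ∸ s) (ℕ.∸-monoʳ-≤ b (ℕ.n≤1+n s))) (subadditive s a b)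
        split : ∀ j i → i ≤ j → (i ∸ s) ℕ.+ ((j ∸ i) ∸ s) ≤ j ∸ s
        split j i i≤j = ≡.subst (λ k → (i ∸ s) ℕ.+ ((j ∸ i) ∸ s) ≤ k ∸ s) (ℕ.m+[n∸m]≡n i≤j)
          (subadditive s i (j ∸ i))

      -- multiplication by 1 - x
      δ : Ser → Ser
      δ w zero    = w zero
      δ w (suc i) = w (suc i) - w i

      Fil-δ : ∀ {s c N w} → Fil s c N w → Fil s c N (δ w)
      Fil-δ {s} {c} {N} {w} p = fil go
        where
        go : ∀ j → j < N → G c (j ∸ s) (δ w j)
        go zero    i<N = at p zero i<N
        go (suc i) i<N = G-sub (at p (suc i) i<N)
          (G-weaken (ℕ.∸-monoˡ-≤ s (ℕ.n≤1+n i)) (at p i (ℕ.<-trans (ℕ.n<1+n i) i<N)))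

      -- multiplication by x (1 - x) z
      ξ : Ser → Ser
      ξ w zero    = 0#
      ξ w (suc i) = z * δ w i

      Fil-ξ : ∀ {s c N w} → Fil s (suc (suc c)) N w → Fil s c (suc N) (ξ w)
      Fil-ξ {s} {c} {N} {w} p = fil go
        where
        go : ∀ j → j < suc N → G c (j ∸ s) (ξ w j)
        go zero    _         = G-zero c (0 ∸ s)
        go (suc i) (s≤s i<N) = G-weaken (ℕ.∸-monoˡ-≤ s (ℕ.n≤1+n i)) (G-z (at (Fil-δ p) i i<N))

      Fil-⊕ : ∀ {s c N f g} → Fil s c N f → Fil s c N g → Fil s c N (f ⊕ g)
      Fil-⊕ p q = fil λ j j<N → G-+ (at p j j<N) (at q j j<N)

      Fil-resp : ∀ {s c N f g} → f ≋ g → Fil s c N f → Fil s c N g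
      Fil-resp e p = fil λ j j<N → G-resp (e j) (at p j j<N)

      Fil-pred : ∀ {s c N f} → Fil s c (suc N) f → Fil s c N f
      Fil-pred p = fil λ j j<N → at p j (ℕ.<-trans j<N (ℕ.n<1+n _))

      Fil-exp : ∀ {s c d N f} → c ≡ d → Fil s c N f → Fil s d N f
      Fil-exp ≡.refl p = p

      -- `T` turns a series in z over series in x into a series in x over series in z: the family is
      -- constructed by powers of z but has to be solved by orders of x.
      module System
        (K : Set) (T : K → Ser) (_▷_ : (ℕ → K) → (ℕ → K) → ℕ → K)
        (▷-zero : ∀ P g → T ((P ▷ g) 0) ≋ T (P 0) ⊛ T (g 0) ⊕ ξ (T (((P ∘ suc) ▷ (g ∘ suc)) 0)))
        (▷-suc : ∀ P g n → T ((P ▷ g) (suc n)) ≋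
           T ((P ▷ (g ∘ suc)) n) ⊕ ξ (T (((P ∘ suc) ▷ (g ∘ suc)) (suc n))))
        (β : ℕ → K)
        (β-zero : T (β 0) ≋ constₛ 1# ⊕ (λ i → z * δ (T ((β ▷ β) 0)) i))
        (β-suc : ∀ a → T (β (suc a)) ≋ T (β a) ⊕ (λ i → z * δ (T ((β ▷ β) (suc a))) i))
        where

        -- The exponents of C are homogeneous: term k has zᵏ times C to the power (k + p) + (a + k +
        -- q), which is tᵏ times C to the power a + p + q. The induction is on the precision in x,
        -- of which `ξ` gains one order, and on a.
        Fil-▷ : ∀ N P g p q → (∀ k → Fil 2 (k ℕ.+ p) N (T (P k))) → (∀ k → Fil 2 (k ℕ.+ q) N (T (g k))) →
                ∀ a → Fil 2 (a ℕ.+ (p ℕ.+ q)) N (T ((P ▷ g) a))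
        Fil-▷-tail : ∀ N P g p q → (∀ k → Fil 2 (k ℕ.+ p) N (T (P k))) → (∀ k → Fil 2 (k ℕ.+ q) N (T (g k))) →
                     ∀ a → Fil 2 (suc (suc (a ℕ.+ (p ℕ.+ q)))) N (T (((P ∘ suc) ▷ (g ∘ suc)) a))
        Fil-▷-tail N P g p q FP Fg a = Fil-exp
          (≡.trans (ℕ.+-suc a (p ℕ.+ suc q)) (≡.cong suc (≡.trans (≡.cong (a ℕ.+_) (ℕ.+-suc p q)) (ℕ.+-suc a (p ℕ.+ q)))))
          (Fil-▷ N (P ∘ suc) (g ∘ suc) (suc p) (suc q)
            (λ k → Fil-exp (≡.sym (ℕ.+-suc k p)) (FP (suc k)))
            (λ k → Fil-exp (≡.sym (ℕ.+-suc k q)) (Fg (suc k))) a)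
        Fil-▷ zero    P g p q FP Fg a = fil λ j ()
        Fil-▷ (suc N) P g p q FP Fg a = go g q Fg a
          where
          go : ∀ g q → (∀ k → Fil 2 (k ℕ.+ q) (suc N) (T (g k))) →
               ∀ a → Fil 2 (a ℕ.+ (p ℕ.+ q)) (suc N) (T ((P ▷ g) a))
          below : ∀ g q → (∀ k → Fil 2 (k ℕ.+ q) (suc N) (T (g k))) →
                 ∀ a → Fil 2 (suc (suc (a ℕ.+ (p ℕ.+ q)))) N (T (((P ∘ suc) ▷ (g ∘ suc)) a))
          below g q Fg = Fil-▷-tail N P g p q (λ k → Fil-pred (FP k)) (λ k → Fil-pred (Fg k))
          go g q Fg zero    = Fil-resp (≋-sym (▷-zero P g)) (Fil-⊕ (Fil-⊛ (FP 0) (Fg 0)) (Fil-ξ (below g q Fg 0)))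
          go g q Fg (suc a) = Fil-resp (≋-sym (▷-suc P g a)) (Fil-⊕
            (Fil-exp (≡.trans (≡.cong (a ℕ.+_) (ℕ.+-suc p q)) (ℕ.+-suc a (p ℕ.+ q)))
              (go (g ∘ suc) (suc q) (λ k → Fil-exp (≡.sym (ℕ.+-suc k q)) (Fg (suc k))) a))
            (Fil-ξ (below g q Fg (suc a))))

        ▷-head : ∀ P g a → T ((P ▷ g) a) 0 ≈ T (P 0) 0 * T (g a) 0
        ▷-head P g zero    = trans (▷-zero P g 0) (trans (+-identityʳ _) (⊛-head (T (P 0)) (T (g 0))))
        ▷-head P g (suc a) = trans (▷-suc P g a 0) (trans (+-identityʳ _) (▷-head P (g ∘ suc) a))

        -- The terms k ≥ 1 of the sum defining `P ▷ g`, with one factor x (1 - x) z taken out.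
        rest : (ℕ → K) → (ℕ → K) → ℕ → Ser
        rest P g zero    = T (((P ∘ suc) ▷ (g ∘ suc)) 0)
        rest P g (suc a) = rest P (g ∘ suc) a ⊕ T (((P ∘ suc) ▷ (g ∘ suc)) (suc a))

        ξ-⊕ : ∀ v w → ξ v ⊕ ξ w ≋ ξ (v ⊕ w)
        ξ-⊕ v w zero          = +-identityˡ 0#
        ξ-⊕ v w (suc zero)    = sym (distribˡ z _ _)
        ξ-⊕ v w (suc (suc i)) = solve 5 (λ z a b c d → z :* (a :- b) :+ z :* (c :- d)
                                  := z :* ((a :+ c) :- (b :+ d))) refl z _ _ _ _

        ▷-split : ∀ P g a → T ((P ▷ g) a) ≋ T (P 0) ⊛ T (g a) ⊕ ξ (rest P g a)
        ▷-split P g zero    = ▷-zero P g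
        ▷-split P g (suc a) i = trans (▷-suc P g a i) (trans (+-congʳ (▷-split P (g ∘ suc) a i))
          (trans (+-assoc _ _ _) (+-congˡ (ξ-⊕ _ _ i))))

        Fil-rest : ∀ N P g p q → (∀ k → Fil 2 (k ℕ.+ p) N (T (P k))) → (∀ k → Fil 2 (k ℕ.+ q) N (T (g k))) →
                   ∀ a → Fil 2 (suc (suc (a ℕ.+ (p ℕ.+ q)))) N (rest P g a)
        Fil-rest N P g p q FP Fg zero    = Fil-▷-tail N P g p q FP Fg 0
        Fil-rest N P g p q FP Fg (suc a) = Fil-⊕
          (Fil-exp (≡.cong (λ c → suc (suc c)) (≡.trans (≡.cong (a ℕ.+_) (ℕ.+-suc p q)) (ℕ.+-suc a (p ℕ.+ q))))
            (Fil-rest N P (g ∘ suc) p (suc q) FP (λ k → Fil-exp (≡.sym (ℕ.+-suc k q)) (Fg (suc k))) a))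
          (Fil-▷-tail N P g p q FP Fg (suc a))

        B h r : ℕ → Ser
        B a = T (β a)
        h a = T ((β ▷ β) a)
        r a = rest β β a

        -- Coefficient n + 1 of the product without the two end terms; at n = 0 the end terms are
        -- all there is.
        mid : Ser → Ser → Ser
        mid f g zero    = 0#
        mid f g (suc n) = (tail f ⊛ tail g) n

        ⊛-mid : ∀ f g n → (f ⊛ g) (suc n) ≈ f 0 * g (suc n) + f (suc n) * g 0 + mid f g n
        ⊛-mid f g zero    = sym (+-assoc _ _ _)
        ⊛-mid f g (suc n) = ⊛-ends f g n

        -- the part of coefficient n + 1 of (1 - x) h a that only involves coefficients ≤ n of the B k
        L : ℕ → ℕ → Carrier
        L a n = mid (B 0) (B a) n + z * δ (r a) n - h a n

        module Solution (unique : ∀ {f} → f ≈ 1# + z * (f * f) → f ≈ C)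
                        (u-cancel : ∀ {f g} → u * f ≈ u * g → f ≈ g) where

          t≈ : t ≈ z * (C * C)
          t≈ = *-congˡ (*-congˡ (*-identityʳ C))

          C* : ∀ f → C * f ≈ f + z * (C * C) * f
          C* f = trans (*-congʳ C-fixed) (trans (distribʳ f 1# _) (+-congʳ (*-identityˡ f)))

          u* : ∀ f → u * f ≈ f - z * (C * C) * f
          u* f = trans (distribʳ f 1# (- t)) (+-cong (*-identityˡ f)
            (trans (*-congʳ (-‿cong t≈)) (solve 2 (λ t f → (:- t) :* f := :- (t :* f)) refl (z * (C * C)) f)))

          -- C x = C a + z C² x + z C b and C = 1 + z C²
          linear : ∀ {x a b} → x ≈ a + z * (C * x + b) → x ≈ C * a + z * (C * b)
          linear {x} {a} {b} e = +-cancelʳ (z * (C * C) * x) _ _ (trans (sym (C* x)) (trans (*-congˡ e)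
            (solve 5 (λ c a z x b → c :* (a :+ z :* (c :* x :+ b)) := (c :* a :+ z :* (c :* b)) :+ z :* (c :* c) :* x)
              refl C a z x b)))
            where open import Algebra.Properties.Group +-group using () renaming (∙-cancelʳ to +-cancelʳ)

          B-zero : ∀ a → B a 0 ≈ C ^ suc a
          B-zero zero = trans (unique (trans (β-zero 0) (+-congˡ (*-congˡ (▷-head β β 0))))) (sym (*-identityʳ C))
          B-zero (suc a) = trans (linear (trans (β-suc a 0) (+-congˡ (*-congˡ (trans (▷-head β β (suc a))
              (trans (*-congʳ (trans (B-zero 0) (*-identityʳ C))) (sym (+-identityʳ _))))))))
            (trans (+-cong (*-congˡ (B-zero a)) (trans (*-congˡ (zeroʳ C)) (zeroʳ z))) (+-identityʳ _))

          B00 : B 0 0 ≈ C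
          B00 = trans (B-zero 0) (*-identityʳ C)

          h-suc : ∀ a n → h a (suc n) - h a n ≈ C * B a (suc n) + (B 0 (suc n) * B a 0 + L a n)
          h-suc a n = trans (+-congʳ (trans (▷-split β β a (suc n)) (+-congʳ (⊛-mid (B 0) (B a) n))))
            (trans (+-congʳ (+-congʳ (+-congʳ (+-congʳ (*-congʳ B00)))))
            (solve 5 (λ a b m s h → (((a :+ b) :+ m) :+ s) :- h := a :+ (b :+ (m :+ s :- h)))
              refl _ _ _ _ _))

          -- `B 0 (suc n)` counts as known here, so the unknown occurs only once and `linear` solves
          -- for it without dividing by `u`.
          B-suc-suc : ∀ a n → B (suc a) (suc n) ≈ C * B a (suc n) + z * (C * (B 0 (suc n) * B (suc a) 0 + L (suc a) n))
          B-suc-suc a n = linear (trans (β-suc a (suc n)) (+-congˡ (*-congˡ (h-suc (suc a) n))))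

          -- For a = 0 the unknown b occurs as C b and again as b times `B 0 0`. After `linear` has
          -- absorbed one occurrence, b = z C (b C + L) is left, whence the factor 1 - z C².
          B-0-suc : ∀ n → u * B 0 (suc n) ≈ z * (C * L 0 n)
          B-0-suc n = trans (u* b) (trans (+-congʳ (linear (trans (β-zero (suc n)) (+-congˡ (*-congˡ (h-suc 0 n))))))
            (trans (+-congʳ (+-congˡ (*-congˡ (*-congˡ (+-congʳ (*-congˡ B00))))))
              (trans (+-congʳ (+-congʳ (zeroʳ C)))
                (trans (+-congʳ (+-identityˡ _)) (solve 4 (λ z c b l → z :* (c :* (b :* c :+ l)) :- z :* (c :* c) :* b := z :* (c :* l)) refl z C b (L 0 n))))))
            where b = B 0 (suc n)

          G-C* : ∀ {c k f} → G c k f → G (suc c) k (C * f)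
          G-C* {c} {k} {f} (frac q pq e) = frac q pq (trans
            (solve 3 (λ u c f → u :* (c :* f) := c :* (u :* f)) refl (u ^ k) C f)
            (trans (*-congˡ e) (sym (*-assoc C (C ^ c) q))))

          G-u* : ∀ {c k f} → G c k (u * f) → G c (suc k) f
          G-u* {c} {k} {f} (frac q pq e) = frac q pq (trans
            (solve 3 (λ u v f → u :* v :* f := v :* (u :* f)) refl u (u ^ k) f) e)

          Controlled : ℕ → Set
          Controlled N = ∀ a → Fil 2 (suc a) N (B a)

          private
            shape : ∀ {N} → Controlled N → ∀ k → Fil 2 (k ℕ.+ 1) N (B k)
            shape F k = Fil-exp (ℕ.+-comm 1 k) (F k)

          L-G : ∀ n a → Controlled (suc n) → G (suc (suc a)) (n ∸ 2) (L a n)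
          L-G n a F = G-sub (G-+ (mid-G n F)
              (G-z (at (Fil-δ (Fil-exp (≡.cong (λ c → suc (suc c)) (ℕ.+-comm a 2))
                (Fil-rest (suc n) β β 1 1 (shape F) (shape F) a))) n ℕ.≤-refl)))
            (at (Fil-exp (ℕ.+-comm a 2) (Fil-▷ (suc n) β β 1 1 (shape F) (shape F) a)) n ℕ.≤-refl)
            where
            -- Dropping the coefficient of order 0 turns the bound j ∸ 2 into j ∸ 1. Coefficient n
            -- of a product of two tails then has pole order at most n ∸ 1, which is exactly the
            -- `suc n ∸ 2` required.
            tail-Fil : ∀ {n} → Controlled (suc (suc n)) → ∀ a → Fil 1 (suc a) (suc n) (tail (B a))
            tail-Fil F a = fil λ j j<N → at (F a) (suc j) (s≤s j<N)
            mid-G : ∀ n → Controlled (suc n) → G (suc (suc a)) (n ∸ 2) (mid (B 0) (B a) n)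
            mid-G zero    F = G-zero _ _
            mid-G (suc n) F = at (Fil-⊛ (tail-Fil F 0) (tail-Fil F a)) n ℕ.≤-refl

          B10 : B 1 0 ≈ C * C
          B10 = trans (B-zero 1) (*-congˡ (*-identityʳ C))

          B20 : B 2 0 ≈ C * (C * C)
          B20 = trans (B-zero 2) (*-congˡ (*-congˡ (*-identityʳ C)))

          -- This is `t` with the square written as `C * C`, the form in which the solver identities
          -- below are stated.
          τ : Carrier
          τ = z * (C * C)

          -- Replaces a division by 1 - t by the check of a guessed quotient `g`.
          u-solve : ∀ {f g l} → u * f ≈ l → l ≈ g - τ * g → f ≈ g
          u-solve {g = g} p q = u-cancel (trans p (trans q (sym (u* g))))

          r00 : r 0 0 ≈ (C * C) * (C * C)
          r00 = trans (▷-head _ _ 0) (*-cong B10 B10)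

          L00 : L 0 0 ≈ z * ((C * C) * (C * C)) - C * C
          L00 = +-cong (trans (+-identityˡ _) (*-congˡ r00)) (-‿cong (trans (▷-head β β 0) (*-cong B00 B00)))

          -- The division is exact because L = t C² - C² = - (1 - t) C². The summand - C² stems from
          -- the factor 1 - x, that is, from the normalisation of z.
          B01 : B 0 1 ≈ - (τ * C)
          B01 = u-solve (B-0-suc 0) (trans (*-congˡ (*-congˡ L00))
            (solve 2 (λ z c → z :* (c :* (z :* ((c :* c) :* (c :* c)) :- c :* c))
              := (:- (z :* (c :* c) :* c)) :- z :* (c :* c) :* (:- (z :* (c :* c) :* c))) refl z C))

          L10 : L 1 0 ≈ z * ((C * C) * (C * (C * C)) + (C * C) * (C * (C * C))) - C * (C * C)
          L10 = +-cong (trans (+-identityˡ _) (*-congˡ (+-cong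
              (trans (▷-head _ _ 0) (*-cong B10 B20)) (trans (▷-head _ _ 1) (*-cong B10 B20)))))
            (-‿cong (trans (▷-head β β 1) (*-cong B00 B10)))

          -- Needed at the next order of `B 0`, where `β 1` enters through the term k = 1 of the
          -- sum.
          B11 : B 1 1 ≈ (C * C) * (τ * τ - (τ + τ))
          B11 = trans (B-suc-suc 0 0) (trans (+-cong (*-congˡ B01) (*-congˡ (*-congˡ (+-cong (*-cong B01 B10) L10))))
            (solve 2 (λ z c → let t = z :* (c :* c) in
              c :* (:- (t :* c)) :+ z :* (c :* ((:- (t :* c)) :* (c :* c) :+
                (z :* ((c :* c) :* (c :* (c :* c)) :+ (c :* c) :* (c :* (c :* c))) :- c :* (c :* c))))
              := (c :* c) :* (t :* t :- (t :+ t))) refl z C))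

          r01 : r 0 1 ≈ ((C * C) * B 1 1 + B 1 1 * (C * C)) + z * ((C * (C * C)) * (C * (C * C)))
          r01 = trans (▷-zero _ _ 1) (+-cong
            (+-cong (*-congʳ B10) (trans (+-identityʳ _) (*-congˡ B10)))
            (*-congˡ (trans (▷-head _ _ 0) (*-cong B20 B20))))

          h01 : h 0 1 ≈ (C * B 0 1 + B 0 1 * C) + z * ((C * C) * (C * C))
          h01 = trans (▷-zero β β 1) (+-cong
            (+-cong (*-congʳ B00) (trans (+-identityʳ _) (*-congˡ B00)))
            (*-congˡ r00))

          L01 : L 0 1 ≈ (- (τ * C)) * (- (τ * C)) + z * (((C * C) * ((C * C) * (τ * τ - (τ + τ))) +
                ((C * C) * (τ * τ - (τ + τ))) * (C * C)) + z * ((C * (C * C)) * (C * (C * C))) - (C * C) * (C * C))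
                - ((C * (- (τ * C)) + (- (τ * C)) * C) + z * ((C * C) * (C * C)))
          L01 = +-cong (+-cong (trans (+-identityʳ _) (*-cong B01 B01))
              (*-congˡ (+-cong (trans r01 (+-congʳ (+-cong (*-congˡ B11) (*-congʳ B11)))) (-‿cong r00))))
            (-‿cong (trans h01 (+-congʳ (+-cong (*-congˡ B01) (*-congʳ B01)))))

          -- With z C⁴ = t C² and z² C⁶ = t² C² the long expression for L collapses to - 2 t² (1 -
          -- t) C², once more a multiple of 1 - t.
          B02 : B 0 2 ≈ - (((τ * τ) * τ + (τ * τ) * τ) * C)
          B02 = u-solve (B-0-suc 1) (trans (*-congˡ (*-congˡ L01))
            (solve 2 (λ z c → let t = z :* (c :* c) ; g = :- (((t :* t) :* t :+ (t :* t) :* t) :* c) in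
              z :* (c :* ((:- (t :* c)) :* (:- (t :* c)) :+ z :* (((c :* c) :* ((c :* c) :* (t :* t :- (t :+ t))) :+
                ((c :* c) :* (t :* t :- (t :+ t))) :* (c :* c)) :+ z :* ((c :* (c :* c)) :* (c :* (c :* c))) :- (c :* c) :* (c :* c))
                :- ((c :* (:- (t :* c)) :+ (:- (t :* c)) :* c) :+ z :* ((c :* c) :* (c :* c)))))
              := g :- t :* g) refl z C))

          IsPoly-τ : IsPoly τ
          IsPoly-τ = resp t≈ var

          G-poly*C : ∀ {q} → IsPoly q → G 1 0 (q * C)
          G-poly*C {q} p = frac q p (trans (*-identityˡ _) (trans (*-comm q C) (*-congʳ (sym (*-identityʳ C)))))

          -- From n = 2 on, the pole added by the division fits: (n ∸ 2) + 1 = (n + 1) ∸ 2. For n =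
          -- 0 and n = 1 the truncated bound is 0 on both sides and leaves no room, so the explicit
          -- values are used.
          B-0-G : ∀ n → Controlled (suc n) → G 1 (suc n ∸ 2) (B 0 (suc n))
          B-0-G 0 F = G-resp (sym B01) (G-neg (G-poly*C IsPoly-τ))
          B-0-G 1 F = G-resp (sym B02) (G-neg (G-poly*C
            (let τ³ = mul (mul IsPoly-τ IsPoly-τ) IsPoly-τ in add τ³ τ³)))
          B-0-G n@(suc (suc _)) F = G-u* (G-resp (sym (B-0-suc n)) (G-z (G-C* (L-G n 0 F))))

          B-G : ∀ n a → Controlled (suc n) → G (suc a) (suc n ∸ 2) (B a (suc n))
          B-G n zero    F = B-0-G n F
          B-G n (suc a) F = G-resp (sym (B-suc-suc a n)) (G-+ (G-C* (B-G n a F)) (G-z (G-C* (G-+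
            (G-resp (*-comm _ _) (G-resp (*-congʳ (sym (B-zero (suc a)))) (G-C^* (suc (suc a)) (B-0-G n F))))
            (G-weaken (ℕ.∸-monoˡ-≤ 2 (ℕ.n≤1+n n)) (L-G n (suc a) F))))))
            where
            G-C^* : ∀ {k f} d → G 1 k f → G (suc d) k (C ^ d * f)
            G-C^* {f = f} zero    p = G-resp (sym (*-identityˡ f)) p
            G-C^* {f = f} (suc d) p = G-resp (sym (*-assoc C (C ^ d) f)) (G-C* (G-C^* d p))

          controlled : ∀ N → Controlled N
          controlled zero    a = fil λ j ()
          controlled (suc N) a = fil λ j j<1+N → go j (ℕ.m≤n⇒m<n∨m≡n (ℕ.≤-pred j<1+N))
            where
            order : ∀ N → Controlled N → G (suc a) (N ∸ 2) (B a N)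
            order zero    F = G-resp (sym (B-zero a)) (G-C (suc a))
            order (suc n) F = B-G n a F
            go : ∀ j → j < N ⊎ j ≡ N → G (suc a) (j ∸ 2) (B a j)
            go j (inj₁ j<N)    = at (controlled N a) j j<N
            go j (inj₂ ≡.refl) = order N (controlled N)

          leading : ∀ i → G 1 (i ∸ 2) (B 0 i)
          leading i = at (controlled (suc i) 0) i ℕ.≤-refl

-- From walks on labelled vertices to walks on unlabelled forests.

module WalkCounting where

  open UmbralCalculus using (Forest; ∅; node; sumPicks; steps; steps-suc)
  open import Data.Bool.Base using (if_then_else_)
  open import Data.Fin.Base using (Fin; zero; suc)
  open import Data.Fin.Properties using (_≟_; all?)
  open import Data.List.Base using (List; []; _∷_; _++_; length; [_])
  open import Data.List.Membership.Propositional using (_∈_; _∉_)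
  open import Data.List.Relation.Binary.Permutation.Propositional
    using (_↭_; ↭-refl; ↭-trans; prep; ↭⇒↭ₛ)
  import Data.List.Relation.Binary.Permutation.Propositional.Properties as Perm
  import Data.List.Relation.Binary.Permutation.Setoid.Properties as PermSetoid
  open import Data.List.Relation.Unary.All as All using (All; []; _∷_)
  open import Data.List.Relation.Unary.Any using (here; there)
  open import Data.List.Relation.Unary.AllPairs using ([]; _∷_)
  open import Data.List.Relation.Unary.Unique.Propositional using (Unique)
  open import Data.List.Relation.Unary.Unique.Propositional.Properties using (Unique[x∷xs]⇒x∉xs)
  open import Data.Nat.Base using (ℕ; zero; suc; _+_; _*_; _!; _<_; _≤_)
  import Data.Nat.Properties as ℕ
  open import Data.Nat.Solver using (module +-*-Solver)
  open import Data.Product.Base using (_×_; _,_)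
  open import Data.Unit.Base using (⊤; tt)
  open import Function.Base using (_∘_)
  open import Relation.Binary.PropositionalEquality
    using (_≡_; refl; sym; trans; cong; cong₂; subst; setoid; module ≡-Reasoning)
  open import Relation.Nullary using (¬_; Dec; does; yes; no; ¬?; contradiction)
  open import Algebra.Properties.Semiring.Sum ℕ.+-*-semiring
    using (sum; sum-syntax; sum-cong-≗; ∑-distrib-+; *-distribˡ-sum; *-distribʳ-sum; sum-replicate-zero)

  𝟙 : {P : Set} → Dec P → ℕ
  𝟙 d = if does d then 1 else 0

  𝟙-yes : {P : Set} (d : Dec P) → P → 𝟙 d ≡ 1
  𝟙-yes (yes _) p = refl
  𝟙-yes (no ¬p) p = contradiction p ¬p

  𝟙-no : {P : Set} (d : Dec P) → ¬ P → 𝟙 d ≡ 0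
  𝟙-no (yes p) ¬p = contradiction p ¬p
  𝟙-no (no _)  ¬p = refl

  ∑-zero : ∀ {n} {f : Fin n → ℕ} → (∀ i → f i ≡ 0) → sum f ≡ 0
  ∑-zero {n} p = trans (sum-cong-≗ p) (sum-replicate-zero n)

  ∑-𝟙 : ∀ {n} (a : Fin n) c → ∑[ x < n ] (𝟙 (x ≟ a) * c) ≡ c
  ∑-𝟙 {suc n} zero c = trans (cong₂ _+_ (ℕ.+-identityʳ c) (∑-zero {n} λ _ → refl)) (ℕ.+-identityʳ c)
  ∑-𝟙 {suc n} (suc a) c = ∑-𝟙 a c

  -- A zipper: the ancestors of the present vertex, nearest first, each with its explored subtrees
  -- other than the one that contains the present vertex.
  Stack : Set → Set
  Stack A = List (A × Forest A)

  module _ {A : Set} where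

    labelsF : Forest A → List A
    labelsF ∅            = []
    labelsF (node a P Q) = a ∷ labelsF P ++ labelsF Q

    labelsS : Stack A → List A
    labelsS []             = []
    labelsS ((p , Q) ∷ st) = p ∷ labelsF Q ++ labelsS st

    labels : A → Forest A → Stack A → List A
    labels u P st = u ∷ labelsF P ++ labelsS st

    shapeF : Forest A → Forest ⊤
    shapeF ∅            = ∅
    shapeF (node _ P Q) = node tt (shapeF P) (shapeF Q)

    shapeS : Stack A → List (Forest ⊤)
    shapeS []             = []
    shapeS ((_ , Q) ∷ st) = shapeF Q ∷ shapeS st

    data Pick (a : A) (P : Forest A) : Forest A → Forest A → Set where
      here  : ∀ {Q} → Pick a P Q (node a P Q)
      there : ∀ {b P′ Q Q′} → Pick a P Q′ Q → Pick a P (node b P′ Q′) (node b P′ Q)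

    open import Algebra.Solver.CommutativeMonoid (Perm.++-commutativeMonoid {A = A})
      using (solve; _⊜_; _⊕_)

    labelsF-Pick : ∀ {a P Q R} → Pick a P Q R → labelsF R ↭ a ∷ labelsF P ++ labelsF Q
    labelsF-Pick here = ↭-refl
    labelsF-Pick (there {b} {P′} {Q} {Q′} p) = ↭-trans
      (Perm.++⁺ˡ (b ∷ labelsF P′) (labelsF-Pick p))
      (solve 5 (λ b p a x y → (b ⊕ p) ⊕ (a ⊕ x ⊕ y) ⊜ a ⊕ x ⊕ b ⊕ p ⊕ y) ↭-refl
        [ b ] (labelsF P′) [ _ ] (labelsF _) (labelsF Q′))

    -- A step within the explored tree only rearranges the zipper; `labels-parent` is the same for a
    -- step up.
    labels-child : ∀ {a P Q R} u st → Pick a P Q R →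
                   labels u R st ↭ labels a P ((u , Q) ∷ st)
    labels-child {a} {P} {Q} u st p = ↭-trans (prep u (Perm.++⁺ʳ (labelsS st) (labelsF-Pick p)))
      (solve 5 (λ u a x y s → u ⊕ (a ⊕ x ⊕ y) ⊕ s ⊜ a ⊕ x ⊕ u ⊕ y ⊕ s) ↭-refl
        [ u ] [ a ] (labelsF P) (labelsF Q) (labelsS st))

    labels-parent : ∀ u P p Q st → labels u P ((p , Q) ∷ st) ↭ labels p (node u P Q) st
    labels-parent u P p Q st =
      solve 5 (λ u x p y s → u ⊕ x ⊕ p ⊕ y ⊕ s ⊜ p ⊕ (u ⊕ x ⊕ y) ⊕ s) ↭-refl
        [ u ] (labelsF P) [ p ] (labelsF Q) (labelsS st)

    Unique-resp-↭ : ∀ {xs ys : List A} → xs ↭ ys → Unique xs → Unique ys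
    Unique-resp-↭ p = PermSetoid.Unique-resp-↭ (setoid A) (↭⇒↭ₛ p)

    sumPicks-cong : ∀ R {f g : A → Forest A → Forest A → ℕ} →
      (∀ {a P Q} → Pick a P Q R → f a P Q ≡ g a P Q) → sumPicks _+_ 0 R f ≡ sumPicks _+_ 0 R g
    sumPicks-cong ∅            p = refl
    sumPicks-cong (node a P Q) p = cong₂ _+_ (p here) (sumPicks-cong Q λ q → p (there q))

    sumPicks-zero : ∀ R {f : A → Forest A → Forest A → ℕ} →
      (∀ {a P Q} → Pick a P Q R → f a P Q ≡ 0) → sumPicks _+_ 0 R f ≡ 0
    sumPicks-zero ∅            p = refl
    sumPicks-zero (node a P Q) p = cong₂ _+_ (p here) (sumPicks-zero Q λ q → p (there q))

    sumPicks-shape : ∀ R (f : ⊤ → Forest ⊤ → Forest ⊤ → ℕ) →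
      sumPicks _+_ 0 (shapeF R) f ≡ sumPicks _+_ 0 R λ _ P Q → f tt (shapeF P) (shapeF Q)
    sumPicks-shape ∅            f = refl
    sumPicks-shape (node a P Q) f = cong (f tt (shapeF P) (shapeF Q) +_) (sumPicks-shape Q _)

    sumPicks-*ˡ : ∀ c R (f : A → Forest A → Forest A → ℕ) →
      sumPicks _+_ 0 R (λ a P Q → c * f a P Q) ≡ c * sumPicks _+_ 0 R f
    sumPicks-*ˡ c ∅            f = sym (ℕ.*-zeroʳ c)
    sumPicks-*ˡ c (node a P Q) f =
      trans (cong (c * f a P Q +_) (sumPicks-*ˡ c Q _)) (sym (ℕ.*-distribˡ-+ c (f a P Q) _))

  done : ℕ → List (Forest ⊤) → ℕ
  done zero    []      = 1
  done zero    (_ ∷ _) = 0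
  done (suc _) _       = 0

  -- returning n i P st is the number of ways to continue, in n steps of which i lead to
  -- visited children, a walk at a vertex with forest P of visited descendants below
  -- the stack st of the visited remainders of its ancestors' trees, back to the root.
  returning : ℕ → ℕ → Forest ⊤ → List (Forest ⊤) → ℕ
  returningUp : ℕ → ℕ → Forest ⊤ → List (Forest ⊤) → ℕ
  returningDown : ℕ → ℕ → Forest ⊤ → List (Forest ⊤) → ℕ
  returning zero    i P st = done i st
  returning (suc n) i P st =
    returningUp n i P st + (returningDown n i P st + returning n i ∅ (P ∷ st))
  returningUp n i P []       = 0
  returningUp n i P (Q ∷ st) = returning n i (node tt P Q) st
  returningDown n zero    P st = 0
  returningDown n (suc i) P st = sumPicks _+_ 0 P λ _ P′ Q′ → returning n i P′ (Q′ ∷ st)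

  -- Each of the i steps down to visited children has to be undone by a step up, and the depth of
  -- the stack has to be climbed as well.
  returning-short : ∀ n i P st → n < steps i (length st) → returning n i P st ≡ 0
  returning-short zero    zero    P (_ ∷ _)  n<s = refl
  returning-short zero    (suc i) P st       n<s = refl
  returning-short (suc n) i P st n<s = cong₂ _+_ (above st n<s) (cong₂ _+_ (below i n<s)
    (returning-short n i ∅ (P ∷ st) (deeper i n<s)))
    where
    deeper : ∀ i → suc n < steps i (length st) → n < steps i (suc (length st))
    deeper i n<s rewrite steps-suc i (length st) = ℕ.<-trans (ℕ.<-trans (ℕ.n<1+n n) n<s) (ℕ.n<1+n _)
    above : ∀ st → suc n < steps i (length st) → returningUp n i P st ≡ 0
    above []       n<s = refl
    above (Q ∷ st) n<s = returning-short n i (node tt P Q) st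
      (ℕ.≤-pred (subst (suc n <_) (steps-suc i (length st)) n<s))
    below : ∀ i → suc n < steps i (length st) → returningDown n i P st ≡ 0
    below zero    n<s = refl
    below (suc i) n<s = trans (cong (λ R → sumPicks _+_ 0 R _) (sym (shape-id P))) (trans
      (sumPicks-shape P _) (sumPicks-zero P λ {_} {P′} {Q′} _ →
      returning-short n i (shapeF P′) (shapeF Q′ ∷ st)
        (subst (n <_) (sym (steps-suc i (length st))) (ℕ.≤-pred n<s))))
      where
      shape-id : ∀ P → shapeF P ≡ P
      shape-id ∅             = refl
      shape-id (node tt P Q) = cong₂ (node tt) (shape-id P) (shape-id Q)

  module Count (m : ℕ) where
    open import Data.List.Membership.DecPropositional (_≟_ {m}) using (_∈?_)

    countLists : ℕ → (List (Fin m) → ℕ) → ℕ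
    countLists zero    f = f []
    countLists (suc n) f = ∑[ x < m ] countLists n (λ l → f (x ∷ l))

    countLists-cong : ∀ n {f g} → (∀ l → f l ≡ g l) → countLists n f ≡ countLists n g
    countLists-cong zero    p = p []
    countLists-cong (suc n) p = sum-cong-≗ {m} λ x → countLists-cong n λ l → p (x ∷ l)

    countLists-+ : ∀ n f g → countLists n (λ l → f l + g l) ≡ countLists n f + countLists n g
    countLists-+ zero    f g = refl
    countLists-+ (suc n) f g = trans
      (sum-cong-≗ {m} λ x → countLists-+ n (λ l → f (x ∷ l)) (λ l → g (x ∷ l)))
      (∑-distrib-+ {m} (λ x → countLists n λ l → f (x ∷ l)) (λ x → countLists n λ l → g (x ∷ l)))

    countLists-zero : ∀ n → countLists n (λ _ → 0) ≡ 0
    countLists-zero zero    = refl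
    countLists-zero (suc n) = ∑-zero {m} λ _ → countLists-zero n

    countLists-*ˡ : ∀ n c f → countLists n (λ l → c * f l) ≡ c * countLists n f
    countLists-*ˡ zero    c f = refl
    countLists-*ˡ (suc n) c f = trans (sum-cong-≗ {m} λ x → countLists-*ˡ n c λ l → f (x ∷ l))
      (sym (*-distribˡ-sum {m} c λ x → countLists n λ l → f (x ∷ l)))

    countLists-∑ : ∀ n R (f : Fin m → Forest (Fin m) → Forest (Fin m) → List (Fin m) → ℕ) →
      countLists n (λ l → sumPicks _+_ 0 R λ a P Q → f a P Q l) ≡
      sumPicks _+_ 0 R λ a P Q → countLists n (f a P Q)
    countLists-∑ n ∅            f = countLists-zero n
    countLists-∑ n (node a P Q) f = trans
      (countLists-+ n (f a P Q) (λ l → sumPicks _+_ 0 Q λ b P′ Q′ → f b P′ (node a P Q′) l))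
      (cong (countLists n (f a P Q) +_) (countLists-∑ n Q λ b P′ Q′ → f b P′ (node a P Q′)))

    ∑-sumPicks : ∀ R (f : Fin m → Fin m → Forest (Fin m) → Forest (Fin m) → ℕ) →
      ∑[ x < m ] sumPicks _+_ 0 R (f x) ≡ sumPicks _+_ 0 R λ a P Q → ∑[ x < m ] f x a P Q
    ∑-sumPicks ∅            f = ∑-zero {m} λ _ → refl
    ∑-sumPicks (node a P Q) f = trans
      (∑-distrib-+ {m} (λ x → f x a P Q) (λ x → sumPicks _+_ 0 Q λ b P′ Q′ → f x b P′ (node a P Q′)))
      (cong (∑[ x < m ] f x a P Q +_) (∑-sumPicks Q λ x b P′ Q′ → f x b P′ (node a P Q′)))

    covering? : (xs : List (Fin m)) → Dec (∀ x → x ∈ xs)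
    covering? xs = all? λ x → x ∈? xs

    ended : Fin m → Forest (Fin m) → Stack (Fin m) → ℕ
    ended u P []      = 𝟙 (covering? (labels u P []))
    ended u P (_ ∷ _) = 0

    -- follow u P st l is 1 if l continues the walk that is at u to a closed tree
    -- walk covering Fin m, and 0 otherwise.
    follow : Fin m → Forest (Fin m) → Stack (Fin m) → List (Fin m) → ℕ
    followUp : Fin m → Forest (Fin m) → Stack (Fin m) → Fin m → List (Fin m) → ℕ
    follow u P st []      = ended u P st
    follow u P st (x ∷ l) =
      followUp u P st x l +
      (sumPicks _+_ 0 P (λ a P′ Q′ → 𝟙 (x ≟ a) * follow a P′ ((u , Q′) ∷ st) l) +
       𝟙 (¬? (x ∈? labels u P st)) * follow x ∅ ((u , P) ∷ st) l)
    followUp u P []             x l = 0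
    followUp u P ((p , Q) ∷ st) x l = 𝟙 (x ≟ p) * follow p (node u P Q) st l

    H : ℕ → Fin m → Forest (Fin m) → Stack (Fin m) → ℕ
    H n u P st = countLists n (follow u P st)

    HUp : ℕ → Fin m → Forest (Fin m) → Stack (Fin m) → ℕ
    HUp n u P []             = 0
    HUp n u P ((p , Q) ∷ st) = H n p (node u P Q) st

    -- For the parent and for each visited child exactly one letter fits, so the sum over x
    -- collapses there; only for new vertices does it survive.
    H-suc : ∀ n u P st → H (suc n) u P st ≡
      HUp n u P st + (sumPicks _+_ 0 P (λ a P′ Q′ → H n a P′ ((u , Q′) ∷ st)) +
                      ∑[ x < m ] (𝟙 (¬? (x ∈? labels u P st)) * H n x ∅ ((u , P) ∷ st)))
    H-suc n u P st = begin
      H (suc n) u P st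
        ≡⟨ sum-cong-≗ {m} (λ x → trans (countLists-+ n (followUp u P st x) (λ l → Down x l + New x l))
             (cong₂ _+_ (up x st) (trans (countLists-+ n (Down x) (New x))
               (cong₂ _+_ (trans (countLists-∑ n P _) (sumPicks-cong P λ {a} {P′} {Q′} _ →
                            countLists-*ˡ n (𝟙 (x ≟ a)) (follow a P′ ((u , Q′) ∷ st))))
                          (countLists-*ˡ n (𝟙 (¬? (x ∈? labels u P st))) (follow x ∅ ((u , P) ∷ st))))))) ⟩
      ∑[ x < m ] (up′ x st + (down′ x + new′ x))
        ≡⟨ ∑-distrib-+ {m} (λ x → up′ x st) (λ x → down′ x + new′ x) ⟩
      ∑[ x < m ] up′ x st + ∑[ x < m ] (down′ x + new′ x)
        ≡⟨ cong₂ _+_ (up-sum st) (trans (∑-distrib-+ {m} down′ new′) (cong (_+ sum new′) down-sum)) ⟩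
      HUp n u P st + (sumPicks _+_ 0 P (λ a P′ Q′ → H n a P′ ((u , Q′) ∷ st)) + sum new′) ∎
      where
      open ≡-Reasoning
      Down New : Fin m → List (Fin m) → ℕ
      Down x l = sumPicks _+_ 0 P (λ a P′ Q′ → 𝟙 (x ≟ a) * follow a P′ ((u , Q′) ∷ st) l)
      New x l = 𝟙 (¬? (x ∈? labels u P st)) * follow x ∅ ((u , P) ∷ st) l
      up′ : Fin m → Stack (Fin m) → ℕ
      up′ x []             = 0
      up′ x ((p , Q) ∷ st) = 𝟙 (x ≟ p) * H n p (node u P Q) st
      down′ new′ : Fin m → ℕ
      down′ x = sumPicks _+_ 0 P λ a P′ Q′ → 𝟙 (x ≟ a) * H n a P′ ((u , Q′) ∷ st)
      new′ x = 𝟙 (¬? (x ∈? labels u P st)) * H n x ∅ ((u , P) ∷ st)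
      up : ∀ x st → countLists n (followUp u P st x) ≡ up′ x st
      up x []             = countLists-zero n
      up x ((p , Q) ∷ st) = countLists-*ˡ n (𝟙 (x ≟ p)) (follow p (node u P Q) st)
      up-sum : ∀ st → ∑[ x < m ] up′ x st ≡ HUp n u P st
      up-sum []             = ∑-zero {m} λ _ → refl
      up-sum ((p , Q) ∷ st) = ∑-𝟙 p (H n p (node u P Q) st)
      down-sum : sum down′ ≡ sumPicks _+_ 0 P (λ a P′ Q′ → H n a P′ ((u , Q′) ∷ st))
      down-sum = trans (∑-sumPicks P λ x a P′ Q′ → 𝟙 (x ≟ a) * H n a P′ ((u , Q′) ∷ st))
        (sumPicks-cong P λ {a} {P′} {Q′} _ → ∑-𝟙 a (H n a P′ ((u , Q′) ∷ st)))

    ∑-∈ : ∀ {xs : List (Fin m)} → Unique xs → ∑[ x < m ] 𝟙 (x ∈? xs) ≡ length xs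
    ∑-∈ {[]}     _ = ∑-zero {m} λ _ → refl
    ∑-∈ {a ∷ xs} (a∉ ∷ u) = trans (sum-cong-≗ {m} split)
      (trans (∑-distrib-+ {m} (λ x → 𝟙 (x ≟ a) * 1) (λ x → 𝟙 (x ∈? xs))) (cong₂ _+_ (∑-𝟙 a 1) (∑-∈ u)))
      where
      split : ∀ x → 𝟙 (x ∈? (a ∷ xs)) ≡ 𝟙 (x ≟ a) * 1 + 𝟙 (x ∈? xs)
      split x with x ≟ a | x ∈? xs
      ... | yes refl | yes x∈ = contradiction x∈ (Unique[x∷xs]⇒x∉xs (a∉ ∷ u))
      ... | yes refl | no  _  = refl
      ... | no  _    | yes x∈ = refl
      ... | no  x≢a  | no  x∉ = refl

    ∑-∉ : ∀ {xs : List (Fin m)} f → Unique xs → f + length xs ≡ m →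
          ∑[ x < m ] 𝟙 (¬? (x ∈? xs)) ≡ f
    ∑-∉ {xs} f u eq = ℕ.+-cancelʳ-≡ (length xs) (∑[ x < m ] 𝟙 (¬? (x ∈? xs))) f (trans (cong ((∑[ x < m ] 𝟙 (¬? (x ∈? xs))) +_) (sym (∑-∈ u)))
      (trans (sym (∑-distrib-+ {m} (λ x → 𝟙 (¬? (x ∈? xs))) (λ x → 𝟙 (x ∈? xs))))
        (trans (trans (sum-cong-≗ {m} split) (ones m)) (sym eq))))
      where
      split : ∀ x → 𝟙 (¬? (x ∈? xs)) + 𝟙 (x ∈? xs) ≡ 1
      split x with x ∈? xs
      ... | yes _ = refl
      ... | no  _ = refl
      ones : ∀ n → ∑[ x < n ] 1 ≡ n
      ones zero    = refl
      ones (suc n) = cong suc (ones n)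

    ∑-fresh : ∀ {xs : List (Fin m)} f (g : Fin m → ℕ) c → Unique xs → f + length xs ≡ m →
              (∀ x → x ∉ xs → g x ≡ c) → ∑[ x < m ] (𝟙 (¬? (x ∈? xs)) * g x) ≡ f * c
    ∑-fresh {xs} f g c u eq p = trans (sum-cong-≗ {m} same)
      (trans (sym (*-distribʳ-sum {m} c λ x → 𝟙 (¬? (x ∈? xs)))) (cong (_* c) (∑-∉ f u eq)))
      where
      same : ∀ x → 𝟙 (¬? (x ∈? xs)) * g x ≡ 𝟙 (¬? (x ∈? xs)) * c
      same x with x ∈? xs
      ... | yes _  = refl
      ... | no  x∉ = cong (_+ 0) (p x x∉)

    covered : ∀ {xs : List (Fin m)} → Unique xs → length xs ≡ m → ∀ x → x ∈ xs
    covered {xs} u eq x with x ∈? xs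
    ... | yes x∈ = x∈
    ... | no  x∉ = contradiction (trans (sym (𝟙-yes (¬? (x ∈? xs)) x∉)) (ℕ.n≤0⇒n≡0 (ℕ.≤-trans
        (single-≤ x λ y → 𝟙 (¬? (y ∈? xs))) (ℕ.≤-reflexive (∑-∉ 0 u eq))))) λ ()
      where
      single-≤ : ∀ {n} (x : Fin n) (f : Fin n → ℕ) → f x ≤ sum f
      single-≤ zero    f = ℕ.m≤m+n _ _
      single-≤ (suc x) f = ℕ.≤-trans (single-≤ x (f ∘ suc)) (ℕ.m≤n+m _ _)

    not-covering : ∀ {xs : List (Fin m)} f → Unique xs → suc f + length xs ≡ m → ¬ (∀ x → x ∈ xs)
    not-covering {xs} f u eq cov = contradiction
      (trans (sym (∑-∉ (suc f) u eq)) (∑-zero {m} λ x → 𝟙-no (¬? (x ∈? xs)) λ x∉ → x∉ (cov x))) λ ()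

    private
      size-↭ : ∀ {xs ys : List (Fin m)} f → xs ↭ ys → f + length xs ≡ m → f + length ys ≡ m
      size-↭ f p eq = trans (cong (f +_) (sym (Perm.↭-length p))) eq

      size-new : ∀ {x : Fin m} {xs} f → suc f + length xs ≡ m → f + length (x ∷ xs) ≡ m
      size-new {xs = xs} f eq = trans (ℕ.+-suc f (length xs)) eq

      unique-new : ∀ {x : Fin m} {xs} → x ∉ xs → Unique xs → Unique (x ∷ xs)
      unique-new {x} x∉ u = All.tabulate (λ y∈ x≡y → x∉ (subst (_∈ _) (sym x≡y) y∈)) ∷ u

    -- Each of the f unseen labels costs a step down and a step up, and each level of the stack one
    -- more step up.
    H-short : ∀ n f u P st → Unique (labels u P st) → f + length (labels u P st) ≡ m →
              n < steps f (length st) → H n u P st ≡ 0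
    H-short zero    (suc f) u P [] uq sz n<s = 𝟙-no (covering? (labels u P [])) (not-covering f uq sz)
    H-short zero    f u P (_ ∷ _) uq sz n<s = refl
    H-short (suc n) f u P st uq sz n<s = trans (H-suc n u P st) (cong₂ _+_ (above st uq sz n<s)
      (cong₂ _+_ (sumPicks-zero P below) (trans (fresh f sz n<s) (ℕ.*-zeroʳ f))))
      where
      above : ∀ st → Unique (labels u P st) → f + length (labels u P st) ≡ m →
              suc n < steps f (length st) → HUp n u P st ≡ 0
      above []             uq sz n<s = refl
      above ((p , Q) ∷ st) uq sz n<s = H-short n f p (node u P Q) st
        (Unique-resp-↭ (labels-parent u P p Q st) uq) (size-↭ f (labels-parent u P p Q st) sz)
        (ℕ.≤-pred (subst (suc n <_) (steps-suc f (length st)) n<s))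
      below : ∀ {a P′ Q′} → Pick a P′ Q′ P → H n a P′ ((u , Q′) ∷ st) ≡ 0
      below {a} {P′} {Q′} pick = H-short n f a P′ ((u , Q′) ∷ st)
        (Unique-resp-↭ (labels-child u st pick) uq) (size-↭ f (labels-child u st pick) sz)
        (subst (n <_) (sym (steps-suc f (length st))) (ℕ.<-trans (ℕ.<-trans (ℕ.n<1+n n) n<s) (ℕ.n<1+n _)))
      fresh : ∀ f → f + length (labels u P st) ≡ m → suc n < steps f (length st) →
              ∑[ x < m ] (𝟙 (¬? (x ∈? labels u P st)) * H n x ∅ ((u , P) ∷ st)) ≡ f * 0
      fresh zero    sz n<s = ∑-fresh 0 _ 0 uq sz λ x x∉ → contradiction (covered uq sz x) x∉
      fresh (suc f) sz n<s = ∑-fresh (suc f) _ 0 uq sz λ x x∉ →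
        H-short n f x ∅ ((u , P) ∷ st) (unique-new x∉ uq) (size-new {x} {labels u P st} f sz)
          (subst (n <_) (sym (steps-suc f (length st))) (ℕ.≤-pred n<s))

    -- Labels offer a choice only when a new vertex is entered: f unseen labels the first time, f -
    -- 1 the next, together f!. The condition on n says that of the i + f steps down, f find the
    -- unseen labels and i lead to visited children.
    H-returning : ∀ n i f u P st → Unique (labels u P st) → f + length (labels u P st) ≡ m →
                  n ≡ steps (i + f) (length st) →
                  H n u P st ≡ f ! * returning n i (shapeF P) (shapeS st)
    H-returning zero zero zero u P [] uq sz eq = 𝟙-yes (covering? (labels u P [])) (covered uq sz)
    H-returning (suc n) i f u P st uq sz eq = trans (H-suc n u P st) (trans
      (cong₂ _+_ (above st uq sz eq) (cong₂ _+_ (below i eq) (fresh f sz eq)))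
      (solve 4 (λ c a b d → c :* a :+ (c :* b :+ c :* d) := c :* (a :+ (b :+ d))) refl
        (f !) (returningUp n i (shapeF P) (shapeS st)) (returningDown n i (shapeF P) (shapeS st))
        (returning n i ∅ (shapeF P ∷ shapeS st))))
      where
      open +-*-Solver using (solve; _:+_; _:*_; _:=_)
      length-shapeS : ∀ (st : Stack (Fin m)) → length (shapeS st) ≡ length st
      length-shapeS []       = refl
      length-shapeS (_ ∷ st) = cong suc (length-shapeS st)
      above : ∀ st → Unique (labels u P st) → f + length (labels u P st) ≡ m →
              suc n ≡ steps (i + f) (length st) →
              HUp n u P st ≡ f ! * returningUp n i (shapeF P) (shapeS st)
      above []             uq sz eq = sym (ℕ.*-zeroʳ (f !))
      above ((p , Q) ∷ st) uq sz eq = H-returning n i f p (node u P Q) st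
        (Unique-resp-↭ (labels-parent u P p Q st) uq) (size-↭ f (labels-parent u P p Q st) sz)
        (ℕ.suc-injective (trans eq (steps-suc (i + f) (length st))))
      below : ∀ i → suc n ≡ steps (i + f) (length st) →
              sumPicks _+_ 0 P (λ a P′ Q′ → H n a P′ ((u , Q′) ∷ st)) ≡
              f ! * returningDown n i (shapeF P) (shapeS st)
      -- With i = 0 every step down has to find an unseen label. After a step to a visited child the
      -- remaining steps are two short of what `f` labels need.
      below zero eq = trans (sumPicks-zero P λ {a} {P′} {Q′} pick → H-short n f a P′ ((u , Q′) ∷ st)
          (Unique-resp-↭ (labels-child u st pick) uq) (size-↭ f (labels-child u st pick) sz)
          (subst (n <_) (trans (cong suc eq) (sym (steps-suc f (length st)))) (ℕ.m≤n+m (suc n) 1)))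
        (sym (ℕ.*-zeroʳ (f !)))
      below (suc i) eq = trans
        (sumPicks-cong P λ {a} {P′} {Q′} pick → H-returning n i f a P′ ((u , Q′) ∷ st)
          (Unique-resp-↭ (labels-child u st pick) uq) (size-↭ f (labels-child u st pick) sz)
          (trans (ℕ.suc-injective eq) (sym (steps-suc (i + f) (length st)))))
        (trans (sumPicks-*ˡ (f !) P λ _ P′ Q′ → returning n i (shapeF P′) (shapeF Q′ ∷ shapeS st))
          (cong (f ! *_) (sym (sumPicks-shape P λ _ P′ Q′ → returning n i P′ (Q′ ∷ shapeS st)))))
      fresh : ∀ f → f + length (labels u P st) ≡ m → suc n ≡ steps (i + f) (length st) →
              ∑[ x < m ] (𝟙 (¬? (x ∈? labels u P st)) * H n x ∅ ((u , P) ∷ st)) ≡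
              f ! * returning n i ∅ (shapeF P ∷ shapeS st)
      -- No label is left on the labelled side; on the unlabelled side a new vertex would leave too
      -- few steps for the i visits still due and the way back.
      fresh zero sz eq = trans (∑-fresh 0 _ 0 uq sz λ x x∉ → contradiction (covered uq sz x) x∉)
        (sym (trans (ℕ.*-identityˡ _) (returning-short n i ∅ (shapeF P ∷ shapeS st)
          (subst (n <_) (trans (cong suc eq)
              (trans (cong (λ j → suc (steps j (length st))) (ℕ.+-identityʳ i))
                (trans (sym (steps-suc i (length st))) (cong (λ d → steps i (suc d)) (sym (length-shapeS st))))))
            (ℕ.m≤n+m (suc n) 1)))))
      fresh (suc f) sz eq = trans
        (∑-fresh (suc f) _ (f ! * returning n i ∅ (shapeF P ∷ shapeS st)) uq sz λ x x∉ →
          H-returning n i f x ∅ ((u , P) ∷ st) (unique-new x∉ uq) (size-new {x} {labels u P st} f sz)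
            (ℕ.suc-injective (trans eq (trans (cong (λ j → steps j (length st)) (ℕ.+-suc i f))
              (cong suc (sym (steps-suc (i + f) (length st))))))))
        (sym (ℕ.*-assoc (suc f) (f !) _))

-- Step-by-step exploration agrees with the graph-theoretic notion of a tree walk.

module TreeWalks where

  open import Defs using (next; next-inject₁; IsCycle; IsTree; WalkGraph; IsTreeWalk; WalkGraph-connected; isTreeWalk?; treeWalkCount)
  open UmbralCalculus using (Forest; ∅; node; sumPicks; steps)
  open WalkCounting
  open import Data.Bool.Base using (if_then_else_)
  open import Data.Fin.Base using (Fin; zero; suc; inject₁; fromℕ; finToFun; combine; _↑ˡ_; _↑ʳ_; toℕ)
  open import Data.Fin.Properties using (_≟_; remQuot-combine; toℕ-fromℕ; toℕ-inject₁)
  open import Data.Fin.Relation.Unary.Top using (view; view-fromℕ; ‵fromℕ; ‵inject₁)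
  open import Data.List.Base using (List; []; _∷_; _++_; _∷ʳ_; _ʳ++_; length; [_]; lookup; tabulate; filter)
  open import Data.List.Membership.Propositional using (_∈_; _∉_)
  open import Data.List.Membership.Propositional.Properties using (∈-++⁻; ∈-++⁺ˡ; ∈-++⁺ʳ; ∈-tabulate⁺; ∈-tabulate⁻; ∈-lookup)
  open import Data.List.Relation.Binary.Permutation.Propositional
    using (_↭_; ↭-refl; ↭-sym; ↭-trans)
  import Data.List.Relation.Binary.Permutation.Propositional.Properties as Perm
  open import Data.List.Relation.Unary.All as All using (All; []; _∷_)
  open import Data.List.Relation.Unary.Any using (here; there)
  open import Data.List.Relation.Unary.Any.Properties using (reverseAcc⁺; reverseAcc⁻)
  open import Data.List.Relation.Unary.AllPairs using ([]; _∷_)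
  open import Data.List.Relation.Unary.Unique.Propositional using (Unique)
  open import Data.List.Relation.Unary.Unique.Propositional.Properties using (Unique[x∷xs]⇒x∉xs)
  open import Data.Nat.Base using (ℕ; zero; suc; _+_; _*_; _^_; _!; _<_; _≤_; z≤n; s≤s)
  import Data.Nat.Properties as ℕ
  open import Data.Product.Base using (_×_; _,_; proj₁; proj₂; ∃; ∃₂)
  open import Data.Sum.Base using (_⊎_; inj₁; inj₂; swap; [_,_]′)
  open import Function.Base using (_∘_; id)
  open import Relation.Binary.PropositionalEquality
    using (_≡_; _≢_; refl; sym; trans; cong; cong₂; subst; subst₂; module ≡-Reasoning)
  open import Relation.Binary.Construct.Closure.ReflexiveTransitive using (Star; ε; _◅_; gmap)
  open import Relation.Nullary using (¬_; Dec; does; yes; no; ¬?; contradiction)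
  open import Algebra.Properties.Semiring.Sum ℕ.+-*-semiring
    using (sum; sum-syntax; sum-cong-≗)

  module _ {A : Set} where

    data Consec (a b : A) : List A → Set where
      here  : ∀ {l} → Consec a b (a ∷ b ∷ l)
      there : ∀ {x l} → Consec a b l → Consec a b (x ∷ l)

    Adj : List A → A → A → Set
    Adj l a b = Consec a b l ⊎ Consec b a l

    Adj-there : ∀ {x l a b} → Adj l a b → Adj (x ∷ l) a b
    Adj-there (inj₁ c) = inj₁ (there c)
    Adj-there (inj₂ c) = inj₂ (there c)

    Consec-∈ˡ : ∀ {a b l} → Consec a b l → a ∈ l
    Consec-∈ˡ here      = here refl
    Consec-∈ˡ (there c) = there (Consec-∈ˡ c)

    Consec-∈ʳ : ∀ {a b l} → Consec a b l → b ∈ l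
    Consec-∈ʳ here      = there (here refl)
    Consec-∈ʳ (there c) = there (Consec-∈ʳ c)

    Consec-ʳ++⁺ʳ : ∀ {a b l} ws → Consec a b l → Consec a b (ws ʳ++ l)
    Consec-ʳ++⁺ʳ []       c = c
    Consec-ʳ++⁺ʳ (w ∷ ws) c = Consec-ʳ++⁺ʳ ws (there c)

    Consec-ʳ++⁺ˡ : ∀ {a b l ws} → Consec b a ws → Consec a b (ws ʳ++ l)
    Consec-ʳ++⁺ˡ (here {ws}) = Consec-ʳ++⁺ʳ ws here
    Consec-ʳ++⁺ˡ (there c)   = Consec-ʳ++⁺ˡ c

    Adj-ʳ++⁺ : ∀ {a b l ws} → Adj ws a b → Adj (ws ʳ++ l) a b
    Adj-ʳ++⁺ (inj₁ c) = inj₂ (Consec-ʳ++⁺ˡ c)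
    Adj-ʳ++⁺ (inj₂ c) = inj₁ (Consec-ʳ++⁺ˡ c)

    Consec-ʳ++⁻ : ∀ {a b l} ws → Consec a b (ws ʳ++ l) → Consec b a ws ⊎
      (Consec a b l ⊎ (∃₂ λ ws′ l′ → ws ≡ a ∷ ws′ × l ≡ b ∷ l′))
    Consec-ʳ++⁻ []       c = inj₂ (inj₁ c)
    Consec-ʳ++⁻ (w ∷ ws) c with Consec-ʳ++⁻ ws c
    ... | inj₁ d                                = inj₁ (there d)
    ... | inj₂ (inj₁ here)                      = inj₂ (inj₂ (_ , _ , refl , refl))
    ... | inj₂ (inj₁ (there d))                 = inj₂ (inj₁ d)
    ... | inj₂ (inj₂ (_ , _ , refl , refl))     = inj₁ here

    Adj-reverse⁻ : ∀ {a b} ws → Adj (ws ʳ++ []) a b → Adj ws a b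
    Adj-reverse⁻ ws (inj₁ c) with Consec-ʳ++⁻ {l = []} ws c
    ... | inj₁ d = inj₂ d
    ... | inj₂ (inj₁ ())
    ... | inj₂ (inj₂ (_ , _ , _ , ()))
    Adj-reverse⁻ ws (inj₂ c) with Consec-ʳ++⁻ {l = []} ws c
    ... | inj₁ d = inj₁ d
    ... | inj₂ (inj₁ ())
    ... | inj₂ (inj₂ (_ , _ , _ , ()))

    prefix-connected : ∀ {u x} ws → x ∈ u ∷ ws → Star (Adj (u ∷ ws)) u x
    prefix-connected ws       (here refl) = ε
    prefix-connected (v ∷ ws) (there p)   =
      inj₁ here ◅ gmap id Adj-there (prefix-connected ws p)

    -- edges from parent to child
    edgesF : A → Forest A → List (A × A)
    edgesF u ∅            = []
    edgesF u (node a P Q) = (u , a) ∷ edgesF a P ++ edgesF u Q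

    edgesS : A → Stack A → List (A × A)
    edgesS u []             = []
    edgesS u ((p , Q) ∷ st) = (p , u) ∷ edgesF p Q ++ edgesS p st

    edges : A → Forest A → Stack A → List (A × A)
    edges u P st = edgesF u P ++ edgesS u st

    open import Algebra.Solver.CommutativeMonoid (Perm.++-commutativeMonoid {A = A × A})
      using (solve; _⊜_; _⊕_)

    edgesF-Pick : ∀ u {a P Q R} → Pick a P Q R → edgesF u R ↭ (u , a) ∷ edgesF a P ++ edgesF u Q
    edgesF-Pick u here = ↭-refl
    edgesF-Pick u (there {b} {P′} {Q} {Q′} p) = ↭-trans
      (Perm.++⁺ˡ ((u , b) ∷ edgesF b P′) (edgesF-Pick u p))
      (solve 5 (λ b p a x y → (b ⊕ p) ⊕ (a ⊕ x ⊕ y) ⊜ a ⊕ x ⊕ b ⊕ p ⊕ y) ↭-refl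
        [ (u , b) ] (edgesF b P′) [ _ ] (edgesF _ _) (edgesF u Q′))

    edges-child : ∀ {a P Q R} u st → Pick a P Q R → edges u R st ↭ edges a P ((u , Q) ∷ st)
    edges-child {a} {P} {Q} u st p = ↭-trans (Perm.++⁺ʳ (edgesS u st) (edgesF-Pick u p))
      (solve 4 (λ a x y s → (a ⊕ x ⊕ y) ⊕ s ⊜ x ⊕ a ⊕ y ⊕ s) ↭-refl
        [ (u , a) ] (edgesF a P) (edgesF u Q) (edgesS u st))

    edges-parent : ∀ u P p Q st → edges u P ((p , Q) ∷ st) ↭ edges p (node u P Q) st
    edges-parent u P p Q st =
      solve 4 (λ x a y s → x ⊕ a ⊕ y ⊕ s ⊜ (a ⊕ x ⊕ y) ⊕ s) ↭-refl
        (edgesF u P) [ (p , u) ] (edgesF p Q) (edgesS p st)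

    IsChild : A → Forest A → Set
    IsChild a R = ∃₂ λ P Q → Pick a P Q R

    data Parent (p : A) : Stack A → Set where
      parent : ∀ {Q st} → Parent p ((p , Q) ∷ st)

    edgesF-src : ∀ {a b} u P → (a , b) ∈ edgesF u P → (a ≡ u × IsChild b P) ⊎ a ∈ labelsF P
    edgesF-src u (node c P Q) (here refl) = inj₁ (refl , P , Q , here)
    edgesF-src u (node c P Q) (there e) with ∈-++⁻ (edgesF c P) e
    ... | inj₁ e′ with edgesF-src c P e′
    ...   | inj₁ (refl , _) = inj₂ (here refl)
    ...   | inj₂ a∈         = inj₂ (there (∈-++⁺ˡ a∈))
    edgesF-src u (node c P Q) (there e) | inj₂ e′ with edgesF-src u Q e′
    ...   | inj₁ (a≡u , _ , _ , p) = inj₁ (a≡u , _ , _ , there p)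
    ...   | inj₂ a∈                = inj₂ (there (∈-++⁺ʳ (labelsF P) a∈))

    edgesF-tgt : ∀ {a b} u P → (a , b) ∈ edgesF u P → b ∈ labelsF P
    edgesF-tgt u (node c P Q) (here refl) = here refl
    edgesF-tgt u (node c P Q) (there e) with ∈-++⁻ (edgesF c P) e
    ... | inj₁ e′ = there (∈-++⁺ˡ (edgesF-tgt c P e′))
    ... | inj₂ e′ = there (∈-++⁺ʳ (labelsF P) (edgesF-tgt u Q e′))

    edgesS-src : ∀ {a b} u st → (a , b) ∈ edgesS u st → a ∈ labelsS st
    edgesS-src u ((p , Q) ∷ st) (here refl) = here refl
    edgesS-src u ((p , Q) ∷ st) (there e) with ∈-++⁻ (edgesF p Q) e
    ... | inj₂ e′ = there (∈-++⁺ʳ (labelsF Q) (edgesS-src p st e′))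
    ... | inj₁ e′ with edgesF-src p Q e′
    ...   | inj₁ (refl , _) = here refl
    ...   | inj₂ a∈         = there (∈-++⁺ˡ a∈)

    edgesS-tgt : ∀ {a b} u st → (a , b) ∈ edgesS u st → (b ≡ u × Parent a st) ⊎ b ∈ labelsS st
    edgesS-tgt u ((p , Q) ∷ st) (here refl) = inj₁ (refl , parent)
    edgesS-tgt u ((p , Q) ∷ st) (there e) with ∈-++⁻ (edgesF p Q) e
    ... | inj₁ e′ = inj₂ (there (∈-++⁺ˡ (edgesF-tgt p Q e′)))
    ... | inj₂ e′ with edgesS-tgt p st e′
    ...   | inj₁ (refl , _) = inj₂ (here refl)
    ...   | inj₂ b∈         = inj₂ (there (∈-++⁺ʳ (labelsF Q) b∈))

    Joined : List (A × A) → A → A → Set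
    Joined es a b = (a , b) ∈ es ⊎ (b , a) ∈ es

    -- The labels are distinct, so `u` occurs neither inside the subtrees below it nor elsewhere on
    -- the stack, and only the edges to its children and to its parent contain it.
    Joined⇒neighbour : ∀ {x} u P st → Unique (labels u P st) → Joined (edges u P st) u x →
                       IsChild x P ⊎ Parent x st
    Joined⇒neighbour {x} u P st uq = [ down , up ]′
      where
      u∉ : u ∉ labelsF P ++ labelsS st
      u∉ = Unique[x∷xs]⇒x∉xs uq
      down : (u , x) ∈ edges u P st → IsChild x P ⊎ Parent x st
      down e with ∈-++⁻ (edgesF u P) e
      ... | inj₂ e′ = contradiction (∈-++⁺ʳ (labelsF P) (edgesS-src u st e′)) u∉
      ... | inj₁ e′ with edgesF-src u P e′
      ...   | inj₁ (_ , c) = inj₁ c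
      ...   | inj₂ u∈      = contradiction (∈-++⁺ˡ u∈) u∉
      up : (x , u) ∈ edges u P st → IsChild x P ⊎ Parent x st
      up e with ∈-++⁻ (edgesF u P) e
      ... | inj₁ e′ = contradiction (∈-++⁺ˡ (edgesF-tgt u P e′)) u∉
      ... | inj₂ e′ with edgesS-tgt u st e′
      ...   | inj₁ (_ , p) = inj₂ p
      ...   | inj₂ u∈      = contradiction (∈-++⁺ʳ (labelsF P) u∈) u∉

    data Path (E : A → A → Set) : A → A → List A → Set where
      stop : ∀ {a} → Path E a a [ a ]
      step : ∀ {a b c l} → E a c → Path E c b l → Path E a b (a ∷ l)

    Path-map : ∀ {E E′ : A → A → Set} {a b l} → (∀ {a b} → E a b → E′ a b) → Path E a b l → Path E′ a b l
    Path-map f stop       = stop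
    Path-map f (step e p) = step (f e) (Path-map f p)

    Path-nonempty : ∀ {E a b l} → Path E a b l → ∃₂ λ x l′ → l ≡ x ∷ l′
    Path-nonempty stop       = _ , _ , refl
    Path-nonempty (step _ _) = _ , _ , refl

    cut : ∀ {E a b c l} → Path E c b l → Unique l → a ∈ l → ∃ λ l′ → Path E a b l′ × Unique l′
    cut p          uq       (here refl) with p
    ... | stop     = _ , p , uq
    ... | step _ _ = _ , p , uq
    cut (step _ p) (_ ∷ uq) (there a∈) = cut p uq a∈

    lookup-injective : ∀ {l : List A} → Unique l → ∀ {i j} → lookup l i ≡ lookup l j → i ≡ j
    lookup-injective (_ ∷ uq) {zero}  {zero}  eq = refl
    lookup-injective (x∉ ∷ uq) {zero}  {suc j} eq = contradiction eq (All.lookup x∉ (∈-lookup _))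
    lookup-injective (x∉ ∷ uq) {suc i} {zero}  eq = contradiction (sym eq) (All.lookup x∉ (∈-lookup _))
    lookup-injective (_ ∷ uq) {suc i} {suc j} eq = cong suc (lookup-injective uq eq)

    path-last : ∀ {E a b x l} → Path E a b (x ∷ l) → lookup (x ∷ l) (fromℕ (length l)) ≡ b
    path-last stop                = refl
    path-last (step e p@stop)       = path-last p
    path-last (step e p@(step _ _)) = path-last p

    path-step : ∀ {E a b x l} → Path E a b (x ∷ l) → ∀ i →
                E (lookup (x ∷ l) (inject₁ i)) (lookup (x ∷ l) (suc i))
    path-step (step e stop)         zero    = e
    path-step (step e (step _ _))   zero    = e
    path-step (step e p@(step _ _)) (suc i) = path-step p i

  module _ {m : ℕ} where
    open import Data.List.Membership.DecPropositional (_≟_ {m}) using (_∈?_)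

    simplePath : ∀ {E : Fin m → Fin m → Set} {a b} → Star E a b → ∃ λ l → Path E a b l × Unique l
    simplePath ε = _ , stop , [] ∷ []
    simplePath {a = a} (e ◅ es) with simplePath es
    ... | l , p , uq with a ∈? l
    ...   | yes a∈ = cut p uq a∈
    ...   | no  a∉ = a ∷ l , step e p , All.tabulate (λ y∈ a≡y → a∉ (subst (_∈ l) (sym a≡y) y∈)) ∷ uq

    path-cycle : ∀ {E : Fin m → Fin m → Set} {a b x y z l} → Path E a b (x ∷ y ∷ z ∷ l) →
                 Unique (x ∷ y ∷ z ∷ l) → E b a → IsCycle E (lookup (x ∷ y ∷ z ∷ l))
    path-cycle {E} {a} {b} {x} {y} {z} {l} p uq e = record
      { long = s≤s (s≤s (s≤s z≤n)) ; distinct = lookup-injective uq ; adjacent = adj }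
      where
      head : ∀ {x l} → Path E a b (x ∷ l) → a ≡ x
      head stop       = refl
      head (step _ _) = refl
      adj : ∀ j → E (lookup (x ∷ y ∷ z ∷ l) j) (lookup (x ∷ y ∷ z ∷ l) (next j))
      adj j with view j
      ... | ‵fromℕ     = subst₂ E (sym (path-last p)) (head p) e
      ... | ‵inject₁ i = path-step p i

    record TreeList (l : List (Fin m)) : Set where
      field
        covers   : ∀ x → x ∈ l
        loopless : ∀ x → ¬ Adj l x x
        acyclic  : ∀ k (c : Fin k → Fin m) → ¬ IsCycle (Adj l) c

    -- Invariant of the exploration, with the history `ws` listed latest first. `depth` and
    -- `parentOf` certify acyclicity: an edge is oriented when it is discovered, and later
    -- discoveries do not disturb this.
    record Explored (ws ls : List (Fin m)) (es : List (Fin m × Fin m)) : Set where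
      field
        unique   : Unique ls
        visited⁺ : ∀ {x} → x ∈ ws → x ∈ ls
        visited⁻ : ∀ {x} → x ∈ ls → x ∈ ws
        joined   : ∀ {a b} → Adj ws a b → Joined es a b
        adjacent : ∀ {a b} → (a , b) ∈ es → Adj ws a b
        depth    : Fin m → ℕ
        parentOf : Fin m → Fin m
        oriented : ∀ {a b} → (a , b) ∈ es → depth a < depth b × parentOf b ≡ a

    open Explored

    Explored-move : ∀ {u x ws ls ls′ es es′} → Explored (u ∷ ws) ls es → ls ↭ ls′ → es ↭ es′ →
                    x ∈ ls → Joined es u x → Explored (x ∷ u ∷ ws) ls′ es′
    Explored-move I p q x∈ e = record
      { unique = Unique-resp-↭ p (unique I)
      ; visited⁺ = λ { (here refl) → Perm.∈-resp-↭ p x∈ ; (there y∈) → Perm.∈-resp-↭ p (visited⁺ I y∈) }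
      ; visited⁻ = λ y∈ → there (visited⁻ I (Perm.∈-resp-↭ (↭-sym p) y∈))
      ; joined = λ { (inj₁ here) → resp (swap e) ; (inj₂ here) → resp e
                   ; (inj₁ (there c)) → resp (joined I (inj₁ c)) ; (inj₂ (there c)) → resp (joined I (inj₂ c)) }
      ; adjacent = λ ab∈ → Adj-there (adjacent I (Perm.∈-resp-↭ (↭-sym q) ab∈))
      ; depth = depth I ; parentOf = parentOf I
      ; oriented = λ ab∈ → oriented I (Perm.∈-resp-↭ (↭-sym q) ab∈) }
      where
      resp : ∀ {a b} → Joined _ a b → Joined _ a b
      resp (inj₁ d) = inj₁ (Perm.∈-resp-↭ q d)
      resp (inj₂ d) = inj₂ (Perm.∈-resp-↭ q d)

    module _ {B : Set} (f : Fin m → B) (x : Fin m) (v : B) where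
      update : Fin m → B
      update y = if does (y ≟ x) then v else f y

      update-same : update x ≡ v
      update-same with x ≟ x
      ... | yes _  = refl
      ... | no x≢x = contradiction refl x≢x

      update-other : ∀ {y} → y ≢ x → update y ≡ f y
      update-other {y} y≢x with y ≟ x
      ... | yes y≡x = contradiction y≡x y≢x
      ... | no _    = refl

    Explored-new : ∀ {u x ws ls es} → Explored (u ∷ ws) ls es → x ∉ ls →
                   Explored (x ∷ u ∷ ws) (x ∷ ls) ((u , x) ∷ es)
    Explored-new {u} {x} {ws} {ls} {es} I x∉ = record
      { unique = All.tabulate (λ y∈ x≡y → x∉ (subst (_∈ ls) (sym x≡y) y∈)) ∷ unique I
      ; visited⁺ = λ { (here refl) → here refl ; (there y∈) → there (visited⁺ I y∈) }
      ; visited⁻ = λ { (here refl) → here refl ; (there y∈) → there (visited⁻ I y∈) }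
      ; joined = λ { (inj₁ here) → inj₂ (here refl) ; (inj₂ here) → inj₁ (here refl)
                   ; (inj₁ (there c)) → weaken (joined I (inj₁ c)) ; (inj₂ (there c)) → weaken (joined I (inj₂ c)) }
      ; adjacent = λ { (here refl) → inj₂ here ; (there ab∈) → Adj-there (adjacent I ab∈) }
      ; depth = update (depth I) x (suc (depth I u))
      ; parentOf = update (parentOf I) x u
      ; oriented = λ { (here refl) →
            subst₂ _<_ (sym (update-other (depth I) x _ u≢x)) (sym (update-same (depth I) x _)) (ℕ.n<1+n _)
          , update-same (parentOf I) x u
        ; (there ab∈) →
            subst₂ _<_ (sym (update-other (depth I) x _ (src≢x ab∈))) (sym (update-other (depth I) x _ (tgt≢x ab∈)))
              (proj₁ (oriented I ab∈))
          , trans (update-other (parentOf I) x u (tgt≢x ab∈)) (proj₂ (oriented I ab∈)) } }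
      where
      weaken : ∀ {a b} → Joined es a b → Joined ((u , x) ∷ es) a b
      weaken (inj₁ d) = inj₁ (there d)
      weaken (inj₂ d) = inj₂ (there d)
      ∈⇒≢ : ∀ {y} → y ∈ ls → y ≢ x
      ∈⇒≢ y∈ refl = x∉ y∈
      u≢x : u ≢ x
      u≢x = ∈⇒≢ (visited⁺ I (here refl))
      ends : ∀ {a b} → Adj (u ∷ ws) a b → a ∈ ls × b ∈ ls
      ends (inj₁ c) = visited⁺ I (Consec-∈ˡ c) , visited⁺ I (Consec-∈ʳ c)
      ends (inj₂ c) = visited⁺ I (Consec-∈ʳ c) , visited⁺ I (Consec-∈ˡ c)
      src≢x : ∀ {a b} → (a , b) ∈ es → a ≢ x
      src≢x ab∈ = ∈⇒≢ (proj₁ (ends (adjacent I ab∈)))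
      tgt≢x : ∀ {a b} → (a , b) ∈ es → b ≢ x
      tgt≢x ab∈ = ∈⇒≢ (proj₂ (ends (adjacent I ab∈)))

    argmax : ∀ {n} (f : Fin (suc n) → ℕ) → ∃ λ j → ∀ i → f i ≤ f j
    argmax {zero}  f = zero , λ { zero → ℕ.≤-refl }
    argmax {suc n} f with argmax (f ∘ suc)
    ... | j , p with ℕ.≤-total (f zero) (f (suc j))
    ...   | inj₁ q = suc j , λ { zero → q ; (suc i) → p i }
    ...   | inj₂ q = zero , λ { zero → ℕ.≤-refl ; (suc i) → ℕ.≤-trans (p i) q }

    next-surjective : ∀ {n} (j : Fin (suc n)) → ∃ λ i → next i ≡ j
    next-surjective {n} zero = fromℕ n , lemma
      where
      lemma : next (fromℕ n) ≡ zero
      lemma rewrite view-fromℕ n = refl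
    next-surjective (suc j) = inject₁ j , next-inject₁ j

    toℕ-next : ∀ {n} (i : Fin (suc n)) → toℕ (next i) ≡ suc (toℕ i) ⊎ (toℕ (next i) ≡ 0 × toℕ i ≡ n)
    toℕ-next i with view i
    ... | ‵fromℕ     = inj₂ (refl , toℕ-fromℕ _)
    ... | ‵inject₁ j = inj₁ (cong suc (sym (toℕ-inject₁ j)))

    next-next : ∀ {n} (i : Fin (suc (suc (suc n)))) → next (next i) ≢ i
    next-next i eq with toℕ-next i | toℕ-next (next i) | cong toℕ eq
    ... | inj₁ p | inj₁ q | e = ℕ.m≢1+n+m (toℕ i) {1} (trans (sym e) (trans q (cong suc p)))
    ... | inj₁ p | inj₂ (q , r) | e =
      contradiction (trans (sym r) (trans p (cong suc (trans (sym e) q)))) λ ()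
    ... | inj₂ (p , r) | inj₁ q | e =
      contradiction (trans (sym r) (trans (sym e) (trans q (cong suc p)))) λ ()
    ... | inj₂ (p , r) | inj₂ (_ , r′) | e = contradiction (trans (sym p) r′) λ ()

    -- Both neighbours of a deepest vertex on a cycle would have to be its parent, hence equal,
    -- which `next-next` excludes for length at least three.
    oriented-acyclic : ∀ {E : Fin m → Fin m → Set} (depth : Fin m → ℕ) (parentOf : Fin m → Fin m) →
      (∀ {a b} → E a b → (depth a < depth b × parentOf b ≡ a) ⊎ (depth b < depth a × parentOf a ≡ b)) →
      ∀ k (c : Fin k → Fin m) → ¬ IsCycle E c
    oriented-acyclic depth parentOf orient k c cyc with IsCycle.long cyc
    ... | s≤s (s≤s (s≤s _)) with argmax (depth ∘ c)
    ...   | j , max with next-surjective j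
    ...     | i , refl with orient (IsCycle.adjacent cyc i) | orient (IsCycle.adjacent cyc (next i))
    ... | inj₂ (lt , _) | _             = contradiction lt (ℕ.≤⇒≯ (max i))
    ... | inj₁ _        | inj₁ (lt , _) = contradiction lt (ℕ.≤⇒≯ (max (next (next i))))
    ... | inj₁ (_ , p)  | inj₂ (_ , q)  =
      contradiction (IsCycle.distinct cyc (trans (sym q) p)) (next-next i)

    oriented-Adj : ∀ {ws ls es} (I : Explored ws ls es) {a b} → Adj ws a b →
      (depth I a < depth I b × parentOf I b ≡ a) ⊎ (depth I b < depth I a × parentOf I a ≡ b)
    oriented-Adj I e with joined I e
    ... | inj₁ d = inj₁ (oriented I d)
    ... | inj₂ d = inj₂ (oriented I d)

    IsCycle-map : ∀ {E E′ : Fin m → Fin m → Set} {k} {c : Fin k → Fin m} →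
                  (∀ {a b} → E a b → E′ a b) → IsCycle E c → IsCycle E′ c
    IsCycle-map f r = record
      { long = IsCycle.long r ; distinct = IsCycle.distinct r ; adjacent = λ j → f (IsCycle.adjacent r j) }

    Explored-TreeList : ∀ {ws ls es} → Explored ws ls es → (∀ x → x ∈ ls) → TreeList (ws ʳ++ [])
    Explored-TreeList {ws} I cov = record
      { covers = λ x → reverseAcc⁺ [] ws (inj₂ (visited⁻ I (cov x)))
      ; loopless = λ x e → [ irrefl , irrefl ]′ (oriented-Adj I (Adj-reverse⁻ ws e))
      ; acyclic = λ k c cyc → oriented-acyclic (depth I) (parentOf I) (oriented-Adj I) k c
          (IsCycle-map (Adj-reverse⁻ ws) cyc) }
      where
      irrefl : ∀ {n} {B : Set} → n < n × B → _
      irrefl (lt , _) = ℕ.<-irrefl refl lt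

    -- The history connects `u` to `x`, and a simple path between them is closed to a cycle by the
    -- new edge. A path of one vertex would make that edge a loop, and a path of two vertices would
    -- make it an old edge.
    chord⇒¬TreeList : ∀ {u x ws ls es} l → Explored (u ∷ ws) ls es → x ∈ ls → ¬ Adj (u ∷ ws) u x →
                      ¬ TreeList ((u ∷ ws) ʳ++ (x ∷ l))
    chord⇒¬TreeList {u} {x} {ws} l I x∈ ¬e T
      with simplePath (prefix-connected ws (visited⁻ I x∈))
    ... | _ , stop , _ = TreeList.loopless T u (inj₁ (Consec-ʳ++⁺ʳ ws here))
    ... | _ , step e stop , _ = ¬e e
    ... | _ , p@(step _ (step _ q)) , uq with Path-nonempty q
    ...   | _ , _ , refl = TreeList.acyclic T _ _ (path-cycle
      (Path-map (Adj-ʳ++⁺ {ws = u ∷ ws}) p) uq (inj₂ (Consec-ʳ++⁺ʳ ws here)))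

    rootOf : Fin m → Stack (Fin m) → Fin m
    rootOf u []             = u
    rootOf u ((p , Q) ∷ st) = rootOf p st

    endOf : Fin m → List (Fin m) → Fin m
    endOf u []      = u
    endOf u (x ∷ l) = endOf x l

    rootOf-∈ : ∀ u p (Q : Forest (Fin m)) st → rootOf u ((p , Q) ∷ st) ∈ labelsS ((p , Q) ∷ st)
    rootOf-∈ u p Q []             = here refl
    rootOf-∈ u p Q ((p′ , Q′) ∷ st) = there (∈-++⁺ʳ (labelsF Q) (rootOf-∈ p p′ Q′ st))

    Pick-∈ : ∀ {x : Fin m} {P Q R} → Pick x P Q R → x ∈ labelsF R
    Pick-∈ pick = Perm.∈-resp-↭ (↭-sym (labelsF-Pick pick)) (here refl)

    Parent-∈ : ∀ {x : Fin m} {st} → Parent x st → x ∈ labelsS st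
    Parent-∈ parent = here refl

    Pick-edge : ∀ {x P Q R} (u : Fin m) st → Pick x P Q R → (u , x) ∈ edges u R st
    Pick-edge u st pick = Perm.∈-resp-↭ (↭-sym (Perm.++⁺ʳ (edgesS u st) (edgesF-Pick u pick))) (here refl)

    isChild? : ∀ (x : Fin m) R → Dec (IsChild x R)
    isChild? x ∅ = no λ { (_ , _ , ()) }
    isChild? x (node a P Q) with x ≟ a | isChild? x Q
    ... | yes refl | _               = yes (P , Q , here)
    ... | no _     | yes (_ , _ , p) = yes (_ , _ , there p)
    ... | no x≢a   | no ¬c           = no λ { (_ , _ , here) → x≢a refl ; (_ , _ , there p) → ¬c (_ , _ , p) }

    isParent? : ∀ (x : Fin m) st → Dec (Parent x st)
    isParent? x [] = no λ ()
    isParent? x ((p , Q) ∷ st) with x ≟ p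
    ... | yes refl = yes parent
    ... | no x≢p   = no λ { parent → x≢p refl }

    private
      Children : Fin m → Forest (Fin m) → (Fin m → Forest (Fin m) → Forest (Fin m) → ℕ) → ℕ
      Children x R g = sumPicks _+_ 0 R λ a P Q → 𝟙 (x ≟ a) * g a P Q

    Children-none : ∀ {x} R g → ¬ IsChild x R → Children x R g ≡ 0
    Children-none {x} R g ¬c = sumPicks-zero R λ {a} {P} {Q} pick →
      cong (_* g a P Q) (𝟙-no (x ≟ a) λ { refl → ¬c (_ , _ , pick) })

    Children-one : ∀ {x P Q R} g → Unique (labelsF R) → Pick x P Q R → Children x R g ≡ g x P Q
    Children-one {x} {P} {Q} g uq here = trans (cong₂ _+_
        (trans (cong (_* g x P Q) (𝟙-yes (x ≟ x) refl)) (ℕ.*-identityˡ _))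
        (Children-none Q _ λ { (_ , _ , pick) →
          Unique[x∷xs]⇒x∉xs uq (∈-++⁺ʳ (labelsF P) (Pick-∈ pick)) }))
      (ℕ.+-identityʳ _)
    Children-one {x} g uq@(_ ∷ uq′) (there {b} {P′} {Q} pick) = cong₂ _+_
      (cong (_* g b P′ Q) (𝟙-no (x ≟ b) λ { refl →
        Unique[x∷xs]⇒x∉xs uq (∈-++⁺ʳ (labelsF P′) (Pick-∈ pick)) }))
      (Children-one _ (unique-++ʳ (labelsF P′) uq′) pick)
      where
      unique-++ʳ : ∀ (xs : List (Fin m)) {ys} → Unique (xs ++ ys) → Unique ys
      unique-++ʳ []       u       = u
      unique-++ʳ (_ ∷ xs) (_ ∷ u) = unique-++ʳ xs u

    open Count m hiding (covered)

    Indicates : Set → ℕ → Set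
    Indicates T n = (T → n ≡ 1) × (¬ T → n ≡ 0)

    followUp-none : ∀ {u P x} st l → ¬ Parent x st → followUp u P st x l ≡ 0
    followUp-none []             l ¬p = refl
    followUp-none {x = x} ((p , Q) ∷ st) l ¬p = cong (_* follow p _ st l) (𝟙-no (x ≟ p) λ { refl → ¬p parent })

    child-∈ : ∀ {x} u P st → IsChild x P → x ∈ labels u P st
    child-∈ u P st (_ , _ , pick) = there (∈-++⁺ˡ (Pick-∈ pick))

    parent-∈ : ∀ {x} u P st → Parent x st → x ∈ labels u P st
    parent-∈ u P st p = there (∈-++⁺ʳ (labelsF P) (Parent-∈ p))

    unique-++ : ∀ (xs : List (Fin m)) {ys} → Unique (xs ++ ys) →
                Unique xs × (∀ {x} → x ∈ xs → x ∉ ys)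
    unique-++ []       u        = [] , λ ()
    unique-++ (x ∷ xs) uq@(x∉ ∷ u) with unique-++ xs u
    ... | uxs , dis = All.tabulate (λ y∈ → All.lookup x∉ (∈-++⁺ˡ y∈)) ∷ uxs ,
      λ { (here refl) y∈ → Unique[x∷xs]⇒x∉xs uq (∈-++⁺ʳ xs y∈) ; (there x∈) → dis x∈ }

    new-none : ∀ {x ls} n → x ∈ ls → 𝟙 (¬? (x ∈? ls)) * n ≡ 0
    new-none {x} {ls} n x∈ = cong (_* n) (𝟙-no (¬? (x ∈? ls)) λ x∉ → x∉ x∈)

    new-one : ∀ {x ls} n → x ∉ ls → 𝟙 (¬? (x ∈? ls)) * n ≡ n
    new-one {x} {ls} n x∉ = trans (cong (_* n) (𝟙-yes (¬? (x ∈? ls)) x∉)) (ℕ.*-identityˡ n)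

    -- Distinct labels leave at most one nonzero summand of `follow` for each letter; if no move
    -- fits, the step is a chord. The hypothesis on the end is essential: `follow` rejects a list
    -- that stops below the root, although its graph may well be a tree.
    follow-indicates : ∀ l {ws u} P st → Explored (u ∷ ws) (labels u P st) (edges u P st) →
      endOf u l ≡ rootOf u st → Indicates (TreeList ((u ∷ ws) ʳ++ l)) (follow u P st l)
    follow-indicates [] {ws} {u} P ((p , Q) ∷ st) I eq =
      contradiction (subst (_∈ labelsS ((p , Q) ∷ st)) (sym eq) (rootOf-∈ u p Q st))
        (λ u∈ → Unique[x∷xs]⇒x∉xs (unique I) (∈-++⁺ʳ (labelsF P) u∈))
    follow-indicates [] {ws} {u} P [] I eq =
      (λ T → 𝟙-yes (covering? (labels u P [])) λ x →
        [ (λ ()) , visited⁺ I ]′ (reverseAcc⁻ [] (u ∷ ws) (TreeList.covers T x))) ,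
      (λ ¬T → 𝟙-no (covering? (labels u P [])) λ cov → ¬T (Explored-TreeList I cov))
    follow-indicates (x ∷ l) {ws} {u} P st I eq with x ∈? labels u P st
    ... | no x∉ = subst (Indicates _) (sym (cong₂ _+_
        (followUp-none {u} {P} st l λ p → x∉ (parent-∈ u P st p))
        (cong₂ _+_ (Children-none P _ λ c → x∉ (child-∈ u P st c)) (new-one _ x∉))))
      (follow-indicates l ∅ ((u , P) ∷ st) (Explored-new I x∉) eq)
    ... | yes x∈ with isChild? x P
    ...   | yes (P′ , Q′ , pick) = subst (Indicates _) (sym (trans (cong₂ _+_
        (followUp-none {u} {P} st l λ p → proj₂ uq (Pick-∈ pick) (Parent-∈ p))
        (cong₂ _+_ (Children-one (λ a P″ Q″ → follow a P″ ((u , Q″) ∷ st) l) (proj₁ uq) pick) (new-none _ x∈)))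
        (ℕ.+-identityʳ _)))
      (follow-indicates l P′ ((u , Q′) ∷ st)
        (Explored-move I (labels-child u st pick) (edges-child u st pick) x∈ (inj₁ (Pick-edge u st pick))) eq)
      where
      uq : Unique (labelsF P) × (∀ {y} → y ∈ labelsF P → y ∉ labelsS st)
      uq with _ ∷ v ← unique I = unique-++ (labelsF P) v
    ...   | no ¬c with isParent? x st
    ...     | yes (parent {Q} {st′}) = subst (Indicates _) (sym (trans (cong₂ _+_
        (trans (cong (_* follow x (node u P Q) st′ l) (𝟙-yes (x ≟ x) refl)) (ℕ.*-identityˡ _))
        (cong₂ _+_ (Children-none P _ ¬c) (new-none _ x∈))) (ℕ.+-identityʳ _)))
      (follow-indicates l (node u P Q) st′
        (Explored-move I (labels-parent u P x Q st′) (edges-parent u P x Q st′) x∈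
          (inj₂ (∈-++⁺ʳ (edgesF u P) (here refl)))) eq)
    ...     | no ¬p = (λ T → contradiction T (chord⇒¬TreeList l I x∈ λ e →
          [ ¬c , ¬p ]′ (Joined⇒neighbour u P st (unique I) (joined I e)))) ,
      λ _ → cong₂ _+_ (followUp-none {u} {P} st l ¬p) (cong₂ _+_ (Children-none P _ ¬c) (new-none _ x∈))

    Explored-start : ∀ r → Explored [ r ] (labels r ∅ []) (edges r ∅ [])
    Explored-start r = record
      { unique = [] ∷ [] ; visited⁺ = id ; visited⁻ = id
      ; joined = λ { (inj₁ (there ())) ; (inj₂ (there ())) } ; adjacent = λ ()
      ; depth = λ _ → 0 ; parentOf = id ; oriented = λ () }

    follow-elsewhere : ∀ l u P st → endOf u l ≢ rootOf u st → follow u P st l ≡ 0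
    follow-elsewhere []      u P []       ne = contradiction refl ne
    follow-elsewhere []      u P (_ ∷ st) ne = refl
    follow-elsewhere (x ∷ l) u P st       ne = cong₂ _+_ (above st ne) (cong₂ _+_
      (sumPicks-zero P λ {a} {P′} {Q′} _ → weighted (x ≟ a) λ { refl →
        follow-elsewhere l a P′ ((u , Q′) ∷ st) ne })
      (weighted (¬? (x ∈? labels u P st)) λ _ → follow-elsewhere l x ∅ ((u , P) ∷ st) ne))
      where
      weighted : ∀ {P : Set} (d : Dec P) {n} → (P → n ≡ 0) → 𝟙 d * n ≡ 0
      weighted (yes p) {n} f = trans (ℕ.*-identityˡ n) (f p)
      weighted (no _)      f = refl
      above : ∀ st → endOf x l ≢ rootOf u st → followUp u P st x l ≡ 0
      above []             ne = refl
      above ((p , Q) ∷ st) ne = weighted (x ≟ p) λ { refl → follow-elsewhere l p (node u P Q) st ne }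

    endOf-∷ʳ : ∀ u l (x : Fin m) → endOf u (l ∷ʳ x) ≡ x
    endOf-∷ʳ u []      x = refl
    endOf-∷ʳ u (y ∷ l) x = endOf-∷ʳ y l x

    countLists-∷ʳ : ∀ n f → countLists (suc n) f ≡ countLists n λ l → ∑[ x < m ] f (l ∷ʳ x)
    countLists-∷ʳ zero    f = refl
    countLists-∷ʳ (suc n) f = sum-cong-≗ {m} λ x → countLists-∷ʳ n λ l → f (x ∷ l)

    -- Lists that do not end at the root contribute nothing, so the last letter is forced.
    H-closed : ∀ n u P st →
      H (suc n) u P st ≡ countLists n λ l → follow u P st (l ∷ʳ rootOf u st)
    H-closed n u P st = trans (countLists-∷ʳ n (follow u P st)) (countLists-cong n λ l →
      trans (sum-cong-≗ {m} λ x → only x l) (∑-𝟙 (rootOf u st) (follow u P st (l ∷ʳ rootOf u st))))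
      where
      only : ∀ x l → follow u P st (l ∷ʳ x) ≡ 𝟙 (x ≟ rootOf u st) * follow u P st (l ∷ʳ rootOf u st)
      only x l with x ≟ rootOf u st
      ... | yes refl = sym (ℕ.*-identityˡ _)
      ... | no x≢r   = follow-elsewhere (l ∷ʳ x) u P st λ e → x≢r (trans (sym (endOf-∷ʳ u l x)) e)

    -- Repeating the first vertex at the end makes cyclic neighbours consecutive.
    closed : ∀ {L} → (Fin (suc L) → Fin m) → List (Fin m)
    closed v = tabulate v ∷ʳ v zero

    Consec-tabulate⁻ : ∀ {L a b c} (v : Fin (suc L) → Fin m) → Consec a b (tabulate v ∷ʳ c) →
      (∃ λ i → v (inject₁ i) ≡ a × v (suc i) ≡ b) ⊎ (v (fromℕ L) ≡ a × c ≡ b)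
    Consec-tabulate⁻ {zero}  v here      = inj₂ (refl , refl)
    Consec-tabulate⁻ {zero}  v (there (there ()))
    Consec-tabulate⁻ {suc L} v here      = inj₁ (zero , refl , refl)
    Consec-tabulate⁻ {suc L} v (there c) with Consec-tabulate⁻ (v ∘ suc) c
    ... | inj₁ (i , p) = inj₁ (suc i , p)
    ... | inj₂ p       = inj₂ p

    Consec-tabulate-inner : ∀ {L c} (v : Fin (suc L) → Fin m) i →
      Consec (v (inject₁ i)) (v (suc i)) (tabulate v ∷ʳ c)
    Consec-tabulate-inner v zero    = here
    Consec-tabulate-inner v (suc i) = there (Consec-tabulate-inner (v ∘ suc) i)

    Consec-tabulate-last : ∀ L {c} (v : Fin (suc L) → Fin m) →
      Consec (v (fromℕ L)) c (tabulate v ∷ʳ c)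
    Consec-tabulate-last zero    v = here
    Consec-tabulate-last (suc L) v = there (Consec-tabulate-last L (v ∘ suc))

    next-fromℕ : ∀ n → next (fromℕ n) ≡ zero
    next-fromℕ n rewrite view-fromℕ n = refl

    module _ {L} (v : Fin (suc L) → Fin m) where

      Consec-next : ∀ j → Consec (v j) (v (next j)) (closed v)
      Consec-next j with view j
      ... | ‵fromℕ     = Consec-tabulate-last L v
      ... | ‵inject₁ i = Consec-tabulate-inner v i

      Consec⇒next : ∀ {a b} → Consec a b (closed v) → ∃ λ j → v j ≡ a × v (next j) ≡ b
      Consec⇒next c with Consec-tabulate⁻ v c
      ... | inj₁ (i , p , q) = inject₁ i , p , trans (cong v (next-inject₁ i)) q
      ... | inj₂ (p , q)     = fromℕ L , p , trans (cong v (next-fromℕ L)) q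

      WalkGraph⇒Adj : ∀ {a b} → WalkGraph v a b → Adj (closed v) a b
      WalkGraph⇒Adj (j , inj₁ (refl , refl)) = inj₁ (Consec-next j)
      WalkGraph⇒Adj (j , inj₂ (refl , refl)) = inj₂ (Consec-next j)

      Adj⇒WalkGraph : ∀ {a b} → Adj (closed v) a b → WalkGraph v a b
      Adj⇒WalkGraph (inj₁ c) with j , p ← Consec⇒next c = j , inj₁ p
      Adj⇒WalkGraph (inj₂ c) with j , p ← Consec⇒next c = j , inj₂ p

      IsTreeWalk⇒TreeList : IsTreeWalk v → TreeList (closed v)
      IsTreeWalk⇒TreeList T = record
        { covers = λ x → let j , p = IsTreeWalk.covers T x in
            subst (_∈ closed v) p (∈-++⁺ˡ (∈-tabulate⁺ {f = v} j))
        ; loopless = λ x e → IsTree.loopless tree x (Adj⇒WalkGraph e)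
        ; acyclic = λ k c cyc → IsTree.acyclic tree k c (IsCycle-map Adj⇒WalkGraph cyc) }
        where open IsTreeWalk T using (tree)

      TreeList⇒IsTreeWalk : TreeList (closed v) → IsTreeWalk v
      TreeList⇒IsTreeWalk T = record
        { covers = cov
        ; tree = record
          { nonempty = v zero
          ; loopless = λ x e → TreeList.loopless T x (WalkGraph⇒Adj e)
          ; connected = WalkGraph-connected v cov
          ; acyclic = λ k c cyc → TreeList.acyclic T k c (IsCycle-map WalkGraph⇒Adj cyc) } }
        where
        cov : ∀ x → ∃ λ j → v j ≡ x
        cov x with ∈-++⁻ (tabulate v) (TreeList.covers T x)
        ... | inj₁ x∈          = let j , p = ∈-tabulate⁻ {f = v} x∈ in j , sym p
        ... | inj₂ (here refl) = zero , refl

    treeWeight : List (Fin m) → ℕ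
    treeWeight []      = 0
    treeWeight (x ∷ l) = follow x ∅ [] (l ∷ʳ x)

    isTreeWalk-weight : ∀ {L} (v : Fin (suc L) → Fin m) →
                        𝟙 (isTreeWalk? v) ≡ treeWeight (tabulate v)
    isTreeWalk-weight v = by (isTreeWalk? v)
      where
      ind : Indicates (TreeList (closed v)) (treeWeight (tabulate v))
      ind = follow-indicates (tabulate (v ∘ suc) ∷ʳ v zero) ∅ [] (Explored-start (v zero))
        (endOf-∷ʳ (v zero) (tabulate (v ∘ suc)) (v zero))
      by : (d : Dec (IsTreeWalk v)) → 𝟙 d ≡ treeWeight (tabulate v)
      by (yes T) = sym (proj₁ ind (IsTreeWalk⇒TreeList v T))
      by (no ¬T) = sym (proj₂ ind λ T → ¬T (TreeList⇒IsTreeWalk v T))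

  length-filter : ∀ {A : Set} {P : A → Set} (P? : ∀ a → Dec (P a)) n (f : Fin n → A) →
                  length (filter P? (tabulate f)) ≡ ∑[ i < n ] 𝟙 (P? (f i))
  length-filter P? zero    f = refl
  length-filter P? (suc n) f with P? (f zero)
  ... | yes _ = cong suc (length-filter P? n (f ∘ suc))
  ... | no _  = length-filter P? n (f ∘ suc)

  ∑-++ : ∀ k n (f : Fin (k + n) → ℕ) → sum f ≡ ∑[ i < k ] f (i ↑ˡ n) + ∑[ j < n ] f (k ↑ʳ j)
  ∑-++ zero    n f = refl
  ∑-++ (suc k) n f = trans (cong (f zero +_) (∑-++ k n (f ∘ suc))) (sym (ℕ.+-assoc (f zero) _ _))

  ∑-combine : ∀ k n (f : Fin (k * n) → ℕ) → sum f ≡ ∑[ i < k ] ∑[ j < n ] f (combine i j)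
  ∑-combine zero    n f = refl
  ∑-combine (suc k) n f = trans (∑-++ n (k * n) f) (cong (∑[ j < n ] f (j ↑ˡ (k * n)) +_)
    (∑-combine k n λ j → f (n ↑ʳ j)))

  module _ (m : ℕ) where
    open Count m

    ∑-finToFun : ∀ n (f : List (Fin m) → ℕ) →
      ∑[ a < m ^ n ] f (tabulate (finToFun {m} {n} a)) ≡ countLists n f
    ∑-finToFun zero    f = ℕ.+-identityʳ (f [])
    ∑-finToFun (suc n) f = trans (∑-combine m (m ^ n) g) (sum-cong-≗ {m} λ x →
      trans (sum-cong-≗ {m ^ n} λ a → cong₂ (λ q r → f (q ∷ tabulate (finToFun {m} {n} r)))
          (cong proj₁ (remQuot-combine x a)) (cong proj₂ (remQuot-combine x a)))
        (∑-finToFun n λ l → f (x ∷ l)))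
      where
      g : Fin (m ^ suc n) → ℕ
      g a = f (tabulate (finToFun {m} {suc n} a))

  -- There are m choices for the start, and the other f = m - 1 labels contribute f!; together m!,
  -- the denominator in the moment formula.
  treeWalkCount-returning : ∀ m i f L n → n ≡ suc L → n ≡ steps (i + f) 0 → m ≡ suc f →
                            treeWalkCount m n ≡ m ! * returning n i ∅ []
  treeWalkCount-returning m i f L _ refl eq refl = begin
    treeWalkCount m (suc L)
      ≡⟨ length-filter (λ a → isTreeWalk? (finToFun {m} {suc L} a)) (m ^ suc L) id ⟩
    ∑[ a < m ^ suc L ] 𝟙 (isTreeWalk? (finToFun {m} {suc L} a))
      ≡⟨ sum-cong-≗ {m ^ suc L} (λ a → isTreeWalk-weight (finToFun {m} {suc L} a)) ⟩
    ∑[ a < m ^ suc L ] treeWeight (tabulate (finToFun {m} {suc L} a))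
      ≡⟨ ∑-finToFun m (suc L) treeWeight ⟩
    ∑[ x < m ] countLists L (λ l → follow x ∅ [] (l ∷ʳ x))
      ≡⟨ sum-cong-≗ {m} (λ x → trans (sym (H-closed L x ∅ []))
           (H-returning (suc L) i f x ∅ [] ([] ∷ []) (ℕ.+-comm f 1) eq)) ⟩
    ∑[ x < m ] (f ! * returning (suc L) i ∅ [])
      ≡⟨ constant m _ ⟩
    m * (f ! * returning (suc L) i ∅ [])
      ≡⟨ sym (ℕ.*-assoc m (f !) _) ⟩
    m ! * returning (suc L) i ∅ [] ∎
    where
    open ≡-Reasoning
    open Count m
    constant : ∀ n c → ∑[ x < n ] c ≡ n * c
    constant zero    c = refl
    constant (suc n) c = cong (c +_) (constant n c)

-- Specialisation to rational power series, and comparison with the moments.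

module Coefficients where

  open import Defs
  open SeriesRing
  open UmbralCalculus
  open SingularExpansion
  open WalkCounting using (returning; returningUp; returningDown; returning-short)
  open TreeWalks using (treeWalkCount-returning)
  open import Data.Fin.Base using (Fin; zero; suc; toℕ)
  open import Data.Fin.Properties using (toℕ≤pred[n])
  open import Data.Integer.Base as ℤ using (+_)
  open import Data.List.Base using (List; []; _∷_)
  open import Data.Nat.Base as ℕ using (ℕ; zero; suc; _∸_; _<_; _≤_; z≤n; s≤s; _!)
  import Data.Nat.Properties as ℕ
  open import Data.Product.Base using (∃; _,_; proj₁; proj₂)
  open import Data.Rational.Base as ℚ using (ℚ; 0ℚ; 1ℚ; ½; _+_; _*_; _-_; -_; _/_)
  import Data.Rational.Properties as ℚ
  open import Data.Rational.Unnormalised.Base as ℚᵘ using (mkℚᵘ; *≡*)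
  import Data.Rational.Unnormalised.Properties as ℚᵘ
  open import Data.Sum.Base using (inj₁; inj₂)
  import Data.Integer.Properties as ℤ
  open import Data.Rational.Solver using (module +-*-Solver)
  open import Data.Unit.Base using (⊤; tt)
  open import Function.Base using (_∘_)
  open import Level using (0ℓ)
  open import Relation.Binary.PropositionalEquality
    using (_≡_; _≢_; refl; sym; trans; cong; cong₂; subst; _≗_; module ≡-Reasoning)
  open import Relation.Nullary using (contradiction)
  import Algebra.Properties.Semiring.Sum
  import Relation.Binary.Reasoning.Setoid
  open import Algebra.Bundles using (CommutativeRing)
  open import Algebra.Solver.Ring.AlmostCommutativeRing using (fromCommutativeRing; _-Raw-AlmostCommutative⟶_)
  open import Algebra.Properties.Semiring.Sum (CommutativeRing.semiring ℚ.+-*-commutativeRing)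
    using (sum; sum⁺-syntax; sum-cong-≗; ∑-comm)

  module Q = Series ℚ.+-*-commutativeRing

  psRing : CommutativeRing 0ℓ 0ℓ
  psRing = Q.ringWithUnit 1ₚ *ₚ-identityˡ

  module P = CommutativeRing psRing

  const-*ₚ : ∀ a f → const a *ₚ f ≗ a ·ₚ f
  const-*ₚ a f n = trans (Q.⊛-cong {const a} {Q.constₛ a} {f} {f} const≗ (λ _ → refl) n) (Q.constₛ-⊛ a f n)
    where
    const≗ : const a ≗ Q.constₛ a
    const≗ zero    = refl
    const≗ (suc _) = refl

  const-morphism : CommutativeRing.rawRing ℚ.+-*-commutativeRing -Raw-AlmostCommutative⟶
                   fromCommutativeRing psRing
  const-morphism = record
    { ⟦_⟧ = const
    ; +-homo = λ { a b zero → refl ; a b (suc n) → refl }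
    ; *-homo = λ { a b zero → sym (const-*ₚ a (const b) 0)
                 ; a b (suc n) → sym (trans (const-*ₚ a (const b) (suc n)) (ℚ.*-zeroʳ a)) }
    ; -‿homo = λ { a zero → refl ; a (suc n) → refl }
    ; 0-homo = λ { zero → refl ; (suc n) → refl }
    ; 1-homo = λ n → refl }

  module A = Alg psRing const-morphism

  X-*ₚ : ∀ f → X *ₚ f ≗ Q.shift f
  X-*ₚ f n = trans (Q.⊛-cong {X} {Q.shift 1ₚ} {f} {f} X≗ (λ _ → refl) n)
    (trans (Q.shift-⊛ 1ₚ f n) (Q.shift-cong (*ₚ-identityˡ f) n))
    where
    X≗ : X ≗ Q.shift 1ₚ
    X≗ zero    = refl
    X≗ (suc _) = refl

  X-cancel : ∀ f g → X *ₚ f ≗ X *ₚ g → f ≗ g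
  X-cancel f g p n = trans (sym (X-*ₚ f (suc n))) (trans (p (suc n)) (X-*ₚ g (suc n)))

  fixed-unique : ∀ f g → f ≗ 1ₚ +ₚ X *ₚ (f *ₚ f) → g ≗ 1ₚ +ₚ X *ₚ (g *ₚ g) → f ≗ g
  fixed-unique f g p q n = agree (suc n) n ℕ.≤-refl
    where
    agree : ∀ n → f ≈[ n ] g
    agree zero    k ()
    agree (suc n) k k<n = trans (p k) (trans (cong (λ v → 1ₚ k + v)
      (*ₚ-contrʳ {f *ₚ f} {g *ₚ g} X n refl (Q.⊛-cong[] {f} {g} {f} {g} (agree n) (agree n)) k k<n)) (sym (q k)))

  -- The closed form says 1 - 2 z C = √(1 - 4 z). Squaring this leaves the quadratic equation times
  -- 4 z, and both factors can be cancelled for rational power series.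
  C-fixed : C ≗ 1ₚ +ₚ X *ₚ (C *ₚ C)
  C-fixed = X-cancel C (1ₚ +ₚ X *ₚ (C *ₚ C)) λ n → four-cancel (trans (sym (const-*ₚ A.4ℚ (X *ₚ C) n))
      (trans (A.quadratic X C s square root n) (const-*ₚ A.4ℚ (X *ₚ (1ₚ +ₚ X *ₚ (C *ₚ C))) n)))
    where
    4X s : PowerSeries
    4X = (+ 4 / 1) ·ₚ X
    s = sqrt (1ₚ -ₚ 4X)
    four-cancel : ∀ {a b} → A.4ℚ * a ≡ A.4ℚ * b → a ≡ b
    four-cancel {a} {b} e = trans (quarter a) (trans (cong ((½ * ½) *_) e) (sym (quarter b)))
      where
      open +-*-Solver using (solve; con; _:*_; _:=_)
      quarter : ∀ a → a ≡ (½ * ½) * (A.4ℚ * a)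
      quarter = solve 1 (λ a → a := con (½ * ½) :* (con A.4ℚ :* a)) refl
    square : s *ₚ s ≗ 1ₚ -ₚ const A.4ℚ *ₚ X
    square n = trans (sqrt-square (1ₚ -ₚ 4X) refl n) (cong (λ v → 1ₚ n - v) (sym (const-*ₚ A.4ℚ X n)))
    root : s ≗ 1ₚ -ₚ const A.2ℚ *ₚ (X *ₚ C)
    root zero    = sym (cong (λ v → 1ℚ - v)
      (trans (const-*ₚ A.2ℚ (X *ₚ C) 0) (trans (cong (A.2ℚ *_) (X-*ₚ C 0)) (ℚ.*-zeroʳ A.2ℚ))))
    root (suc n) = trans (half (1ₚ (suc n)) (s (suc n)))
      (cong (λ v → 1ₚ (suc n) - v) (sym (trans (const-*ₚ A.2ℚ (X *ₚ C) (suc n))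
        (cong (A.2ℚ *_) (X-*ₚ C (suc n))))))
      where
      open +-*-Solver using (solve; con; _:*_; _:-_; _:=_)
      half : ∀ a b → b ≡ a - A.2ℚ * (½ * (a - b))
      half = solve 2 (λ a b → b := a :- con A.2ℚ :* (con ½ :* (a :- b))) refl

  ⟨⟩-+ : ∀ Q R f → ∃ λ S → Q ⟨ f ⟩ +ₚ R ⟨ f ⟩ ≗ S ⟨ f ⟩
  ⟨⟩-+ []      R       f = R , P.+-identityˡ (R ⟨ f ⟩)
  ⟨⟩-+ (a ∷ Q) []      f = a ∷ Q , P.+-identityʳ ((a ∷ Q) ⟨ f ⟩)
  ⟨⟩-+ (a ∷ Q) (b ∷ R) f with ⟨⟩-+ Q R f
  ... | S , e = (a + b) ∷ S , λ n → trans (interchange (const a n) _ (const b n) _)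
    (cong₂ _+_ (const-+ n) (trans (sym (*ₚ-distribˡ-+ f (Q ⟨ f ⟩) (R ⟨ f ⟩) n)) (P.*-congˡ {f} e n)))
    where
    open import Algebra.Properties.CommutativeSemigroup
      (CommutativeRing.+-commutativeSemigroup ℚ.+-*-commutativeRing) using (interchange)
    const-+ : ∀ n → const a n + const b n ≡ const (a + b) n
    const-+ zero    = refl
    const-+ (suc n) = refl

  ⟨⟩-scale : ∀ a Q f → ∃ λ S → a ·ₚ Q ⟨ f ⟩ ≗ S ⟨ f ⟩
  ⟨⟩-scale a []      f = [] , λ _ → ℚ.*-zeroʳ a
  ⟨⟩-scale a (b ∷ Q) f with ⟨⟩-scale a Q f
  ... | S , e = (a * b) ∷ S , λ n → trans (ℚ.*-distribˡ-+ a (const b n) _) (cong₂ _+_ (const-* n)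
    (trans (cong (a *_) (P.*-comm f (Q ⟨ f ⟩) n)) (trans (sym (Q.scale-⊛ a (Q ⟨ f ⟩) f n))
      (trans (Q.⊛-cong {a ·ₚ Q ⟨ f ⟩} {S ⟨ f ⟩} {f} {f} e (λ _ → refl) n) (P.*-comm (S ⟨ f ⟩) f n)))))
    where
    const-* : ∀ n → a * const b n ≡ const (a * b) n
    const-* zero    = refl
    const-* (suc n) = ℚ.*-zeroʳ a

  ⟨⟩-* : ∀ Q R f → ∃ λ S → Q ⟨ f ⟩ *ₚ R ⟨ f ⟩ ≗ S ⟨ f ⟩
  ⟨⟩-* []      R f = [] , P.zeroˡ (R ⟨ f ⟩)
  ⟨⟩-* (a ∷ Q) R f =
    let S , e  = ⟨⟩-scale a R f
        T , e′ = ⟨⟩-* Q R f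
        -- Horner: (a + f Q) R = a R + f (Q R), and prepending the coefficient 0 multiplies by f.
        U , e″ = ⟨⟩-+ S (0ℚ ∷ T) f
    in U , λ n → trans (*ₚ-distribʳ-+ (const a) (f *ₚ Q ⟨ f ⟩) (R ⟨ f ⟩) n)
      (trans (cong₂ _+_ (trans (const-*ₚ a (R ⟨ f ⟩) n) (e n))
          (trans (P.*-assoc f (Q ⟨ f ⟩) (R ⟨ f ⟩) n) (trans (P.*-congˡ {f} e′ n) (sym (shifted T n)))))
        (e″ n))
    where
    shifted : ∀ T → (0ℚ ∷ T) ⟨ f ⟩ ≗ f *ₚ T ⟨ f ⟩
    shifted T zero    = ℚ.+-identityˡ _
    shifted T (suc n) = ℚ.+-identityˡ _

  ^-≗ : ∀ f n → f A.^ n ≡ f ^ₚ n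
  ^-≗ f zero    = refl
  ^-≗ f (suc n) = cong (f *ₚ_) (^-≗ f n)

  ^ₚ-head : ∀ f n → f 0 ≡ 1ℚ → (f ^ₚ n) 0 ≡ 1ℚ
  ^ₚ-head f zero    p = refl
  ^ₚ-head f (suc n) p = trans (ℚ.+-identityʳ _) (trans (cong₂ _*_ p (^ₚ-head f n p)) (ℚ.*-identityˡ 1ℚ))

  recip-cancel : ∀ v f → v 0 ≡ 1ℚ → (v *ₚ f) *ₚ recip v ≗ f
  recip-cancel v f v0 n = trans (Q.⊛-cong {v *ₚ f} {f *ₚ v} {recip v} {recip v} (P.*-comm v f) (λ _ → refl) n)
    (trans (P.*-assoc f v (recip v) n) (trans (P.*-congˡ {f} (recip-inverse v v0) n) (*ₚ-identityʳ f n)))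

  x̂ ŷ : PowerSeries
  ŷ = 1ₚ -ₚ X
  x̂ = X *ₚ ŷ

  module S = Series psRing
  module U = Umbral psRing x̂ ŷ

  transpose : S.Ser → S.Ser
  transpose f i l = f l i

  -- The coefficient of xⁱ zˡ in a product is a double sum, in which the order of summation is
  -- exchanged.
  transpose-⊛ : ∀ f g → transpose (f S.⊛ g) S.≋ transpose f S.⊛ transpose g
  transpose-⊛ f g i l = trans (sum-coeff (suc l) (λ k → f (toℕ k) *ₚ g (l ∸ toℕ k)) i)
    (trans (∑-comm {suc l} {suc i} λ k j → f (toℕ k) (toℕ j) * g (l ∸ toℕ k) (i ∸ toℕ j))
      (sym (sum-coeff (suc i) (λ j → transpose f (toℕ j) *ₚ transpose g (i ∸ toℕ j)) l)))
    where
    open Algebra.Properties.Semiring.Sum P.semiring using () renaming (sum to sumₚ)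
    sum-coeff : ∀ n (h : Fin n → PowerSeries) i → sumₚ h i ≡ sum λ k → h k i
    sum-coeff zero    h i = refl
    sum-coeff (suc n) h i = cong (λ v → h zero i + v) (sum-coeff n (h ∘ suc) i)

  ŷ-coeff-zero : ∀ f → (ŷ *ₚ f) 0 ≡ f 0
  ŷ-coeff-zero f = trans (ℚ.+-identityʳ _) (ℚ.*-identityˡ (f 0))

  ŷ-coeff-suc : ∀ f i → (ŷ *ₚ f) (suc i) ≡ f (suc i) - f i
  ŷ-coeff-suc f i = trans (*ₚ-distribʳ-+ 1ₚ (λ n → - X n) f (suc i))
    (cong₂ _+_ (*ₚ-identityˡ f (suc i))
      (trans (sym (-‿distribˡ-* X f (suc i))) (cong -_ (X-*ₚ f (suc i)))))
    where open import Algebra.Properties.Ring P.ring using (-‿distribˡ-*)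

  fromℕ : ℕ → ℚ
  fromℕ zero    = 0ℚ
  fromℕ (suc n) = 1ℚ + fromℕ n

  fromℕ-+ : ∀ m n → fromℕ (m ℕ.+ n) ≡ fromℕ m + fromℕ n
  fromℕ-+ zero    n = sym (ℚ.+-identityˡ (fromℕ n))
  fromℕ-+ (suc m) n = trans (cong (λ v → 1ℚ + v) (fromℕ-+ m n)) (sym (ℚ.+-assoc 1ℚ (fromℕ m) (fromℕ n)))

  open U.Walks X P.refl using (walks; walksUp; pow; β-walks)

  ∑-fromℕ : ∀ R (f : ⊤ → Forest ⊤ → Forest ⊤ → PowerSeries) (g : ⊤ → Forest ⊤ → Forest ⊤ → ℕ) i →
            (∀ a P Q → f a P Q i ≡ fromℕ (g a P Q)) → U.∑ᵣ R f i ≡ fromℕ (sumPicks ℕ._+_ 0 R g)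
  ∑-fromℕ ∅            f g i p = refl
  ∑-fromℕ (node a P Q) f g i p = trans
    (cong₂ _+_ (p a P Q) (∑-fromℕ Q _ (λ b P′ Q′ → g b P′ (node a P Q′)) i λ b P′ Q′ → p b P′ (node a P Q′)))
    (sym (fromℕ-+ (g a P Q) _))

  walks-returning : ∀ n i P st → walks n P st i ≡ fromℕ (returning n i P st)
  walks-returning zero zero    P []      = refl
  walks-returning zero (suc i) P []      = refl
  walks-returning zero zero    P (_ ∷ _) = refl
  walks-returning zero (suc i) P (_ ∷ _) = refl
  walks-returning (suc n) i P st = trans
    (cong₂ _+_ (above st) (cong₂ _+_ (below i) (walks-returning n i ∅ (P ∷ st))))
    (sym (trans (fromℕ-+ (returningUp n i P st) _)
      (cong (λ v → fromℕ (returningUp n i P st) + v) (fromℕ-+ (returningDown n i P st) _))))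
    where
    children : ⊤ → Forest ⊤ → Forest ⊤ → PowerSeries
    children _ P′ Q′ = walks n P′ (Q′ ∷ st)
    above : ∀ st → walksUp n P st i ≡ fromℕ (returningUp n i P st)
    above []       = refl
    above (Q ∷ st) = walks-returning n i (node tt P Q) st
    below : ∀ i → (X *ₚ U.∑ᵣ P children) i ≡ fromℕ (returningDown n i P st)
    below zero    = X-*ₚ (U.∑ᵣ P children) 0
    below (suc i) = trans (X-*ₚ (U.∑ᵣ P children) (suc i))
      (∑-fromℕ P children _ i λ _ P′ Q′ → walks-returning n i P′ (Q′ ∷ st))

  -- The system for β with the roles of x and z exchanged, and its solution as quotients of
  -- polynomials in t.

  module Algebraic (c : PowerSeries) (c-fixed : c ≗ 1ₚ +ₚ X *ₚ (c *ₚ c)) where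

    module Fl = A.Filtration X c c-fixed

    T : PowerSeries
    T = X *ₚ c ^ₚ 2

    polynomial : ∀ {f} → Fl.IsPoly f → ∃ λ Q → f ≗ Q ⟨ T ⟩
    polynomial (Fl.const a) = a ∷ [] , λ n → sym (trans (cong (λ v → const a n + v) (P.zeroʳ T n)) (ℚ.+-identityʳ _))
    polynomial Fl.var = 0ℚ ∷ 1ℚ ∷ [] , λ n → sym (trans (cong₂ _+_ (0≗ n) (P.*-congˡ {T} one n))
        (trans (ℚ.+-identityˡ _) (*ₚ-identityʳ T n)))
      where
      0≗ : const 0ℚ ≗ 0ₚ
      0≗ zero    = refl
      0≗ (suc n) = refl
      one : const 1ℚ +ₚ T *ₚ 0ₚ ≗ 1ₚ
      one n = trans (cong (λ v → 1ₚ n + v) (P.zeroʳ T n)) (ℚ.+-identityʳ _)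
    polynomial (Fl.add p q) =
      let Q , e  = polynomial p
          R , e′ = polynomial q
          S , e″ = ⟨⟩-+ Q R T
      in S , λ n → trans (cong₂ _+_ (e n) (e′ n)) (e″ n)
    polynomial (Fl.mul {f} {g} p q) =
      let Q , e  = polynomial p
          R , e′ = polynomial q
          S , e″ = ⟨⟩-* Q R T
      in S , λ n → trans (Q.⊛-cong {f} {Q ⟨ T ⟩} {g} {R ⟨ T ⟩} e e′ n) (e″ n)
    polynomial (Fl.resp e p) =
      let Q , e′ = polynomial p
      in Q , λ n → trans (sym (e n)) (e′ n)

    u : PowerSeries
    u = 1ₚ -ₚ T

    T-head : T 0 ≡ 0ℚ
    T-head = X-*ₚ (c ^ₚ 2) 0

    u-head : u 0 ≡ 1ℚ
    u-head = cong (λ v → 1ℚ - v) T-head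

    u-cancel : ∀ {f g} → u *ₚ f ≗ u *ₚ g → f ≗ g
    u-cancel {f} {g} e n = trans (sym (recip-cancel u f u-head n))
      (trans (Q.⊛-cong {u *ₚ f} {u *ₚ g} {recip u} {recip u} e (λ _ → refl) n) (recip-cancel u g u-head n))

    c¹ : ∀ f → c A.^ 1 *ₚ f ≗ c *ₚ f
    c¹ f = Q.⊛-cong {c *ₚ 1ₚ} {c} {f} {f} (*ₚ-identityʳ c) (λ _ → refl)

    -- With k = i ∸ 2 and d = i ∸ 1 the exponent is 2 i ∸ 3.
    G-rational : ∀ {k f} d → Fl.G 1 k f →
                 ∃ λ Q → f ≗ c *ₚ (Q ⟨ T ⟩ *ₚ recip (u ^ₚ (d ℕ.+ k)))
    G-rational {k} {f} d (Fl.frac q pq e) = Q , λ n → begin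
      f n
        ≡⟨ sym (recip-cancel v f (^ₚ-head u (d ℕ.+ k) u-head) n) ⟩
      ((v *ₚ f) *ₚ recip v) n
        ≡⟨ Q.⊛-cong {v *ₚ f} {c *ₚ Q ⟨ T ⟩} {recip v} {recip v} cleared (λ _ → refl) n ⟩
      ((c *ₚ Q ⟨ T ⟩) *ₚ recip v) n
        ≡⟨ P.*-assoc c (Q ⟨ T ⟩) (recip v) n ⟩
      (c *ₚ (Q ⟨ T ⟩ *ₚ recip v)) n ∎
      where
      quotient : ∃ λ Q → q *ₚ u A.^ d ≗ Q ⟨ T ⟩
      quotient = polynomial (Fl.mul pq (Fl.IsPoly-^ Fl.IsPoly-u d))
      Q = proj₁ quotient
      e′ = proj₂ quotient
      open ≡-Reasoning
      v = u ^ₚ (d ℕ.+ k)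
      cleared : v *ₚ f ≗ c *ₚ Q ⟨ T ⟩
      cleared n = begin
        (v *ₚ f) n
          ≡⟨ cong (λ w → (w *ₚ f) n) (sym (^-≗ u (d ℕ.+ k))) ⟩
        (u A.^ (d ℕ.+ k) *ₚ f) n
          ≡⟨ Q.⊛-cong {u A.^ (d ℕ.+ k)} {u A.^ d *ₚ u A.^ k} {f} {f} (A.^-+ u d k) (λ _ → refl) n ⟩
        ((u A.^ d *ₚ u A.^ k) *ₚ f) n
          ≡⟨ P.*-assoc (u A.^ d) (u A.^ k) f n ⟩
        (u A.^ d *ₚ (u A.^ k *ₚ f)) n
          ≡⟨ P.*-congˡ {u A.^ d} (λ n → trans (e n) (c¹ q n)) n ⟩
        (u A.^ d *ₚ (c *ₚ q)) n
          ≡⟨ P.*-comm (u A.^ d) (c *ₚ q) n ⟩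
        ((c *ₚ q) *ₚ u A.^ d) n
          ≡⟨ P.*-assoc c q (u A.^ d) n ⟩
        (c *ₚ (q *ₚ u A.^ d)) n
          ≡⟨ P.*-congˡ {c} e′ n ⟩
        (c *ₚ Q ⟨ T ⟩) n ∎

    G-polynomial : ∀ {f} → Fl.G 1 0 f → ∃ λ Q → f ≗ c *ₚ Q ⟨ T ⟩
    G-polynomial {f} (Fl.frac q pq e) =
      let Q , e′ = polynomial pq
      in Q , λ n → trans (sym (*ₚ-identityˡ f n)) (trans (e n) (trans (c¹ q n) (P.*-congˡ {c} e′ n)))

    ŷ-δ : ∀ w l i → (ŷ *ₚ w l) i ≡ Fl.δ (transpose w) i l
    ŷ-δ w l zero    = ŷ-coeff-zero (w l)
    ŷ-δ w l (suc i) = ŷ-coeff-suc (w l) i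

    transpose-Y : ∀ w → transpose (U.Y S.⊛ w) S.≋ λ i → X *ₚ Fl.δ (transpose w) i
    transpose-Y w i l = trans (S.shift-const-⊛ ŷ w l i) (trans (lemma l) (sym (X-*ₚ (Fl.δ (transpose w) i) l)))
      where
      lemma : ∀ l → S.shift (S.scale ŷ w) l i ≡ Q.shift (Fl.δ (transpose w) i) l
      lemma zero    = refl
      lemma (suc l) = ŷ-δ w l i

    transpose-X : ∀ w → transpose (U.X S.⊛ w) S.≋ Fl.ξ (transpose w)
    transpose-X w i l = trans (S.shift-const-⊛ x̂ w l i) (lemma i l)
      where
      factored : ∀ l → x̂ *ₚ w l ≗ Q.shift (ŷ *ₚ w l)
      factored l i = trans (P.*-assoc X ŷ (w l) i) (X-*ₚ (ŷ *ₚ w l) i)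
      lemma : ∀ i l → S.shift (S.scale x̂ w) l i ≡ Fl.ξ (transpose w) i l
      lemma zero    zero    = refl
      lemma zero    (suc l) = factored l 0
      lemma (suc i) zero    = sym (X-*ₚ (Fl.δ (transpose w) i) 0)
      lemma (suc i) (suc l) = trans (factored l (suc i))
        (trans (ŷ-δ w l i) (sym (X-*ₚ (Fl.δ (transpose w) i) (suc l))))

    transpose-1 : transpose (S.constₛ 1ₚ) S.≋ S.constₛ 1ₚ
    transpose-1 zero    zero    = refl
    transpose-1 zero    (suc l) = refl
    transpose-1 (suc i) zero    = refl
    transpose-1 (suc i) (suc l) = refl

    module Fam = Fl.System S.Ser transpose U._▷_
      (λ P g i l → trans (U.▷-zero P g l i) (cong₂ _+_ (transpose-⊛ (P 0) (g 0) i l)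
        (transpose-X (((P ∘ suc) U.▷ (g ∘ suc)) 0) i l)))
      (λ P g n i l → trans (U.▷-suc P g n l i) (cong (λ v → (P U.▷ (g ∘ suc)) n l i + v)
        (transpose-X (((P ∘ suc) U.▷ (g ∘ suc)) (suc n)) i l)))
      U.β
      (λ i l → trans (U.β-zero l i) (cong₂ _+_ (transpose-1 i l) (transpose-Y ((U.β U.▷ U.β) 0) i l)))
      (λ a i l → trans (U.β-suc a l i) (cong (λ v → U.β a l i + v) (transpose-Y ((U.β U.▷ U.β) (suc a)) i l)))

    module Sol = Fam.Solution (λ {f} e → fixed-unique f c e c-fixed) u-cancel

    β-polynomial : ∀ i → i ≤ 2 → ∃ λ Q → transpose (U.β 0) i ≗ c *ₚ Q ⟨ T ⟩
    β-polynomial 0 _ = G-polynomial (Sol.leading 0)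
    β-polynomial 1 _ = G-polynomial (Sol.leading 1)
    β-polynomial 2 _ = G-polynomial (Sol.leading 2)
    β-polynomial (suc (suc (suc i))) (s≤s (s≤s ()))

    β-rational : ∀ i → 3 ≤ i →
      ∃ λ Q → transpose (U.β 0) i ≗ c *ₚ (Q ⟨ T ⟩ *ₚ recip (u ^ₚ (2 ℕ.* i ∸ 3)))
    β-rational (suc (suc (suc j))) (s≤s (s≤s (s≤s _))) = subst
      (λ e → ∃ λ Q → transpose (U.β 0) (3 ℕ.+ j) ≗ c *ₚ (Q ⟨ T ⟩ *ₚ recip (u ^ₚ e)))
      exponent (G-rational (2 ℕ.+ j) (Sol.leading (3 ℕ.+ j)))
      where
      exponent : (2 ℕ.+ j) ℕ.+ (1 ℕ.+ j) ≡ 2 ℕ.* (3 ℕ.+ j) ∸ 3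
      exponent = trans (ℕ.+-comm (2 ℕ.+ j) (1 ℕ.+ j)) (trans (cong suc (ℕ.+-suc j (suc j)))
        (trans (cong (λ k → suc (suc k)) (ℕ.+-suc j j)) (sym (trans
          (ℕ.+-suc j (suc (suc (j ℕ.+ 0)))) (cong suc (trans (ℕ.+-suc j (suc (j ℕ.+ 0)))
            (cong suc (trans (ℕ.+-suc j (j ℕ.+ 0)) (cong (λ k → suc (j ℕ.+ k)) (ℕ.+-identityʳ j))))))))))

  -- The even moments as generating polynomials of walks.

  fromℕ-/ : ∀ n → fromℕ n ≡ + n / 1
  fromℕ-/ zero    = refl
  fromℕ-/ (suc n) = trans (cong (λ v → 1ℚ + v) (fromℕ-/ n)) (ℚ.toℚᵘ-injective (begin
    ℚ.toℚᵘ (1ℚ + + n / 1)            ≈⟨ ℚ.toℚᵘ-homo-+ 1ℚ (+ n / 1) ⟩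
    ℚ.toℚᵘ 1ℚ ℚᵘ.+ ℚ.toℚᵘ (+ n / 1)  ≈⟨ ℚᵘ.+-congʳ (ℚ.toℚᵘ 1ℚ) (ℚ.toℚᵘ-fromℚᵘ (mkℚᵘ (+ n) 0)) ⟩
    ℚ.toℚᵘ 1ℚ ℚᵘ.+ mkℚᵘ (+ n) 0      ≈⟨ *≡* (cong (ℤ._* + 1) (cong (λ v → + 1 ℤ.+ v) (ℤ.*-identityʳ (+ n)))) ⟩
    mkℚᵘ (+ suc n) 0                 ≈⟨ ℚᵘ.≃-sym (ℚ.toℚᵘ-fromℚᵘ (mkℚᵘ (+ suc n) 0)) ⟩
    ℚ.toℚᵘ (+ suc n / 1)             ∎))
    where open Relation.Binary.Reasoning.Setoid ℚᵘ.≃-setoid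

  multiple-/ : ∀ d r .{{_ : ℕ.NonZero d}} → (+ (d ℕ.* r)) / d ≡ fromℕ r
  multiple-/ (suc d) r = trans (ℚ.fromℚᵘ-cong {mkℚᵘ (+ (suc d ℕ.* r)) d} {mkℚᵘ (+ r) 0} (*≡* (trans
    (ℤ.*-identityʳ _) (trans (cong +_ (ℕ.*-comm (suc d) r)) (ℤ.pos-* r (suc d)))))) (sym (fromℕ-/ r))

  steps-2* : ∀ l → steps l 0 ≡ 2 ℕ.* l
  steps-2* zero    = refl
  steps-2* (suc l) = trans (cong (λ n → suc (suc n)) (steps-2* l)) (cong suc (sym (ℕ.+-suc l (l ℕ.+ 0))))

  steps-mono : ∀ {i j} → i < j → steps i 0 < steps j 0
  steps-mono {zero}  {suc j} _         = s≤s z≤n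
  steps-mono {suc i} {suc j} (s≤s i<j) = s≤s (s≤s (steps-mono i<j))

  -- With j + 1 vertices, j of the l steps down find a new vertex, so l - j lead to visited
  -- children. For j = 0 and l > 0 both sides vanish: the first step from the root always finds a
  -- new vertex.
  w-returning : ∀ l j → j ≤ l → w (suc j) (2 ℕ.* l) ≡ suc j ! ℕ.* returning (steps l 0) (l ∸ j) ∅ []
  w-returning zero    zero    _    = refl
  w-returning (suc l) zero    _    = sym (trans (ℕ.+-identityʳ _)
    (returning-short (suc (steps l 0)) (suc l) ∅ (∅ ∷ []) (subst (suc (steps l 0) <_)
      (cong (λ n → suc (suc n)) (sym (steps-suc l 0))) (ℕ.<-trans (ℕ.n<1+n _) (ℕ.n<1+n _)))))
  w-returning (suc l) (suc j) j≤l = trans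
    (treeWalkCount-returning (suc (suc j)) (l ∸ j) (suc j) (l ℕ.+ suc (l ℕ.+ 0)) (2 ℕ.* suc l) refl
      (trans (sym (steps-2* (suc l))) (cong (λ k → steps k 0) (sym total))) refl)
    (cong (λ n → suc (suc j) ! ℕ.* returning n (l ∸ j) ∅ []) (sym (steps-2* (suc l))))
    where
    total : l ∸ j ℕ.+ suc j ≡ suc l
    total = ℕ.m∸n+n≡m {suc l} {suc j} j≤l

  X^-same : ∀ k → (X ^ₚ k) k ≡ 1ℚ
  X^-same zero    = refl
  X^-same (suc k) = trans (X-*ₚ (X ^ₚ k) (suc k)) (X^-same k)

  X^-other : ∀ k ξ → k ≢ ξ → (X ^ₚ k) ξ ≡ 0ℚ
  X^-other zero    zero    k≢ξ = contradiction refl k≢ξ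
  X^-other zero    (suc ξ) k≢ξ = refl
  X^-other (suc k) zero    k≢ξ = X-*ₚ (X ^ₚ k) 0
  X^-other (suc k) (suc ξ) k≢ξ = trans (X-*ₚ (X ^ₚ k) (suc ξ)) (X^-other k ξ (k≢ξ ∘ cong suc))

  module _ (g : ℕ → ℚ) (ξ : ℕ) where

    monomials : ℕ → ℚ
    monomials l = ∑[ j ≤ l ] (g (l ∸ toℕ j) * (X ^ₚ (l ∸ toℕ j)) ξ)

    private
      term-other : ∀ k → k ≢ ξ → g k * (X ^ₚ k) ξ ≡ 0ℚ
      term-other k k≢ξ = trans (cong (λ v → g k * v) (X^-other k ξ k≢ξ)) (ℚ.*-zeroʳ (g k))

    monomials-beyond : ∀ l → l < ξ → monomials l ≡ 0ℚ
    monomials-beyond zero    l<ξ = trans (ℚ.+-identityʳ _) (term-other 0 (ℕ.<⇒≢ l<ξ))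
    monomials-beyond (suc l) l<ξ = trans (cong₂ _+_ (term-other (suc l) (ℕ.<⇒≢ l<ξ))
      (monomials-beyond l (ℕ.<-trans (ℕ.n<1+n l) l<ξ))) (ℚ.+-identityˡ 0ℚ)

    term-same : ∀ k → k ≡ ξ → g k * (X ^ₚ k) ξ ≡ g ξ
    term-same k refl = trans (cong (λ v → g k * v) (X^-same k)) (ℚ.*-identityʳ (g k))

    monomials-within : ∀ l → ξ ≤ l → monomials l ≡ g ξ
    monomials-within zero    ξ≤l = trans (ℚ.+-identityʳ _) (term-same 0 (sym (ℕ.n≤0⇒n≡0 ξ≤l)))
    monomials-within (suc l) ξ≤1+l with ℕ.m≤n⇒m<n∨m≡n ξ≤1+l
    ... | inj₁ (s≤s ξ≤l) = trans (cong₂ _+_ (term-other (suc l) (ℕ.>⇒≢ (s≤s ξ≤l))) (monomials-within l ξ≤l))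
      (ℚ.+-identityˡ (g ξ))
    ... | inj₂ ξ≡1+l = trans (cong₂ _+_ (term-same (suc l) (sym ξ≡1+l))
      (monomials-beyond l (ℕ.≤-reflexive (sym ξ≡1+l)))) (ℚ.+-identityʳ (g ξ))

  evenMoment-walks : ∀ l → evenMoment l ≗ walks (steps l 0) ∅ []
  evenMoment-walks l ξ = trans (sum-cong-≗ {suc l} coefficient) (trans total (sym (walks-returning (steps l 0) ξ ∅ [])))
    where
    g : ℕ → ℚ
    g k = fromℕ (returning (steps l 0) k ∅ [])
    coefficient : ∀ (j : Fin (suc l)) →
      (_/_ (+ w (suc (toℕ j)) (2 ℕ.* l)) (suc (toℕ j) !) {{suc (toℕ j) ℕ.!≢0}}) * (X ^ₚ (l ∸ toℕ j)) ξ ≡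
      g (l ∸ toℕ j) * (X ^ₚ (l ∸ toℕ j)) ξ
    coefficient j = cong (_* (X ^ₚ (l ∸ toℕ j)) ξ) (trans
      (cong (λ n → _/_ (+ n) (suc (toℕ j) !) {{suc (toℕ j) ℕ.!≢0}}) (w-returning l (toℕ j) (toℕ≤pred[n] j)))
      (multiple-/ (suc (toℕ j) !) (returning (steps l 0) (l ∸ toℕ j) ∅ []) {{suc (toℕ j) ℕ.!≢0}}))
    total : monomials g ξ l ≡ g ξ
    total with ℕ.≤-<-connex ξ l
    ... | inj₁ ξ≤l = monomials-within g ξ l ξ≤l
    -- No walk of 2 l steps back to its start makes more than l steps down, so orders beyond l
    -- vanish on the side of the walks too.
    ... | inj₂ l<ξ = trans (monomials-beyond g ξ l l<ξ)
      (sym (cong fromℕ (returning-short (steps l 0) ξ ∅ [] (steps-mono l<ξ))))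

  atSquare-steps : ∀ (a : PowerSeries₂) l → atSquare a (steps l 0) ≡ a l
  atSquare-steps a zero    = refl
  atSquare-steps a (suc l) = atSquare-steps (a ∘ suc) l

  p-ŷ : p *ₚ ŷ ≗ 1ₚ
  p-ŷ n = trans (P.*-comm p ŷ n) (geometric n)
    where
    geometric : ŷ *ₚ p ≗ 1ₚ
    geometric zero    = ŷ-coeff-zero p
    geometric (suc n) = ŷ-coeff-suc p n

  root-inverse : ∀ {r s q y} → s *ₚ r ≗ 1ₚ → s *ₚ s ≗ q → q *ₚ y ≗ 1ₚ → r *ₚ r ≗ y
  root-inverse {r} {s} {q} {y} sr ss qy = begin
    r *ₚ r                       ≈⟨ P.*-identityʳ (r *ₚ r) ⟨
    (r *ₚ r) *ₚ 1ₚ               ≈⟨ P.*-congˡ {r *ₚ r} qy ⟨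
    (r *ₚ r) *ₚ (q *ₚ y)         ≈⟨ P.*-congˡ {r *ₚ r} (P.*-congʳ {y} ss) ⟨
    (r *ₚ r) *ₚ ((s *ₚ s) *ₚ y)  ≈⟨ P.*-assoc (r *ₚ r) (s *ₚ s) y ⟨
    ((r *ₚ r) *ₚ (s *ₚ s)) *ₚ y  ≈⟨ P.*-congʳ {y} (interchange r r s s) ⟩
    ((r *ₚ s) *ₚ (r *ₚ s)) *ₚ y  ≈⟨ P.*-congʳ {y} (P.*-cong {r *ₚ s} {1ₚ} {r *ₚ s} {1ₚ} rs rs) ⟩
    (1ₚ *ₚ 1ₚ) *ₚ y              ≈⟨ P.*-congʳ {y} (P.*-identityˡ 1ₚ) ⟩
    1ₚ *ₚ y                      ≈⟨ P.*-identityˡ y ⟩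
    y                            ∎
    where
    open Relation.Binary.Reasoning.Setoid P.setoid
    open import Algebra.Properties.CommutativeSemigroup P.*-commutativeSemigroup using (interchange)
    rs : r *ₚ s ≗ 1ₚ
    rs n = trans (P.*-comm r s n) (sr n)

  -- 1 / p = 1 - x by the geometric series, so the root disappears from even powers: the coefficient
  -- of z^(2ℓ) is multiplied by (1 - x)^ℓ.
  r² : recip (sqrt p) *ₚ recip (sqrt p) ≗ ŷ
  r² = root-inverse {recip (sqrt p)} {sqrt p} {p} {ŷ} (recip-inverse (sqrt p) refl) (sqrt-square p refl) p-ŷ

  power-steps : ∀ r → r *ₚ r ≗ ŷ → ∀ l → r ^ₚ steps l 0 ≗ pow l
  power-steps r e zero    = λ _ → refl
  power-steps r e (suc l) n = trans (sym (P.*-assoc r r (r ^ₚ steps l 0) n))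
    (P.*-cong {r *ₚ r} {ŷ} {r ^ₚ steps l 0} {pow l} e (power-steps r e l) n)

  V̂-β : ∀ i l → V̂ i l ≡ U.β 0 l i
  V̂-β i l = begin
    Mμᵖ (2 ℕ.* l) i
      ≡⟨ cong (λ n → Mμᵖ n i) (sym (steps-2* l)) ⟩
    (Mμᶜ (steps l 0) *ₚ r ^ₚ steps l 0) i
      ≡⟨ cong (λ a → (a *ₚ r ^ₚ steps l 0) i) (atSquare-steps evenMoment l) ⟩
    (evenMoment l *ₚ r ^ₚ steps l 0) i
      ≡⟨ P.*-cong {evenMoment l} {walks (steps l 0) ∅ []} {r ^ₚ steps l 0} {pow l}
           (evenMoment-walks l) (power-steps r r² l) i ⟩
    (walks (steps l 0) ∅ [] *ₚ pow l) i
      ≡⟨ P.*-comm (walks (steps l 0) ∅ []) (pow l) i ⟩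
    (pow l *ₚ walks (steps l 0) ∅ []) i
      ≡⟨ sym (β-walks l i) ⟩
    U.β 0 l i ∎
    where
    open ≡-Reasoning
    r = recip (sqrt p)

  module _ where
    open Algebraic C C-fixed

    V̂-polynomial : ∀ i → i ≤ 2 → ∃ λ Q → V̂ i ≗ C *ₚ (Q ⟨ zC² ⟩)
    V̂-polynomial i i≤2 = let Q , e = β-polynomial i i≤2 in Q , λ l → trans (V̂-β i l) (e l)

    V̂-rational : ∀ i → 3 ≤ i →
      ∃ λ Q → V̂ i ≗ C *ₚ (Q ⟨ zC² ⟩ *ₚ recip ((1ₚ -ₚ zC²) ^ₚ (2 ℕ.* i ∸ 3)))
    V̂-rational i 3≤i = let Q , e = β-rational i 3≤i in Q , λ l → trans (V̂-β i l) (e l)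

open import Defs
open import Data.Nat.Base using (ℕ; _≤_; _*_; _∸_)
open import Data.Product.Base using (_×_; _,_; ∃-syntax)
open import Relation.Binary.PropositionalEquality using (_≗_)

theorem4 : (∀ (i : ℕ) → i ≤ 2 → ∃[ Q ] V̂ i ≗ C *ₚ (Q ⟨ zC² ⟩)) ×
    (∀ (i : ℕ) → 3 ≤ i →
    ∃[ Q̂ ] V̂ i ≗ C *ₚ (Q̂ ⟨ zC² ⟩ *ₚ recip ((1ₚ -ₚ zC²) ^ₚ (2 * i ∸ 3))))
theorem4 = Coefficients.V̂-polynomial , Coefficients.V̂-rational
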